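{- Let $d\ge 2$ be fixed. There is an infinite set $\mathbb{E}$ of positive integers such that $$\lim_{k\to\infty}\frac{|\mathbb{E}\cap[1,k]|}{k^{1/(d-1)}}=0,$$ such that $\delta_z(d,k)=\lfloor\lambda(d,k)\rfloor$ for every positive integer $k\notin\mathbb{E}$, and $\delta_z(d,k)=\lfloor\lambda(d,k)\rfloor-1$ for every $k\in\mathbb{E}$.
   Context: A point of $\mathbb{Z}^d$ is primitive if its coordinates are relatively prime; $\mathbb{P}^d_\circ$ denotes the set of primitive points of $\mathbb{Z}^d$ whose first non-zero coordinate is positive. For a finite $\mathcal{X}\subset\mathbb{R}^d$, $\kappa(\mathcal{X})=\max_{1\le i\le d}\sum_{x\in\mathcal{X}}|x_i|$. For a positive integer $k$, $\delta_z(d,k)=\max\{|\mathcal{X}|:\mathcal{X}\subset\mathbb{P}^d_\circ,\ \kappa(\mathcal{X})\le k\}$. Let $B(d,p)=\{x\in\mathbb{R}^d:\|x\|_1\le p\}$, and for integers $p\ge 0$ let $N_p=|B(d,p)\cap\mathbb{P}^d_\circ|$ and $\kappa_p=\kappa(B(d,p)\cap\mathbb{P}^d_\circ)$ (so $N_0=\kappa_0=0$). For a positive integer $k$, let $p$ be the smallest positive integer with $k<\kappa_p$ and set $\lambda(d,k)=N_{p-1}+\frac{d\,(k-\kappa_{p-1})}{p}$; this is the piecewise-linear interpolation of the points $(\kappa_p,N_p)$. -}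

module Defs where

open import Algebra.Definitions.RawSemiring using (_^_)
open import Data.Empty using (⊥)
open import Data.Fin using (Fin; zero; suc)
open import Data.Integer as ℤ using (ℤ; +_; -[1+_]; ∣_∣)
import Data.Integer.Properties as ℤ
open import Data.List
  using (List; []; _∷_; [_]; _++_; map; filter; length; upTo; allFin; cartesianProductWith)
open import Data.List.Extrema.Nat using (max; argmax; argmax-all; f[xs]≤f[argmax]; xs≤max; max≤v⁺)
open import Data.List.Membership.Propositional using (_∈_)
open import Data.List.Membership.Propositional.Properties
open import Data.List.Membership.Propositional.Properties.WithK using (unique∧set⇒bag)
open import Data.List.Relation.Binary.BagAndSetEquality using (∼bag⇒↭)
open import Data.List.Relation.Binary.Permutation.Propositional using (_↭_)
open import Data.List.Relation.Binary.Permutation.Propositional.Properties using (↭-length; map⁺)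
open import Data.List.Relation.Unary.All as All using (All; []; _∷_)
import Data.List.Relation.Unary.All.Properties as All
open import Data.List.Relation.Unary.AllPairs using ([]; _∷_)
open import Data.List.Relation.Unary.Any using (here; there)
open import Data.List.Relation.Unary.Unique.Propositional using (Unique)
import Data.List.Relation.Unary.Unique.Propositional.Properties as Unique
open import Data.Nat
  using (ℕ; zero; suc; NonZero; NonTrivial; _+_; _∸_; _≤_; _<_; _≤?_; _<?_; z≤n; s≤s; z<s; >-nonZero; nonTrivial⇒n>1)
open import Data.Nat.GCD using (gcd; gcd-zeroˡ; gcd-zeroʳ)
open import Data.Nat.ListAction using (sum)
open import Data.Nat.ListAction.Properties using (sum-↭)
open import Data.Nat.Properties
  using (_≟_; ≤-refl; ≤-trans; ≤-reflexive; m≤m+n; m≤n+m; +-comm)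
open import Data.Product using (∃; ∃-syntax; _×_; _,_; proj₁; proj₂)
open import Data.Rational as ℚ using (ℚ)
open import Data.Unit using (⊤; tt)
open import Data.Vec as Vec using (Vec; []; _∷_; lookup; replicate)
import Data.Vec.Properties as Vec
open import Function using (_∘_; _⇔_; mk⇔; Equivalence)
open import Level using (0ℓ)
open import Relation.Binary.PropositionalEquality using (_≡_; refl; sym; trans; cong)
open import Relation.Nullary using (yes; no; contradiction)
open import Relation.Nullary.Decidable using (_×-dec_)
open import Relation.Unary using (Pred; Decidable)

private variable
  d k p : ℕ
  A : Set

IsMaximum : Pred ℕ 0ℓ → Pred ℕ 0ℓ
IsMaximum S m = S m × (∀ n → S n → n ≤ m)

IsMinimum : Pred ℕ 0ℓ → Pred ℕ 0ℓ
IsMinimum S m = S m × (∀ n → S n → m ≤ n)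

-- The gcd of the coordinates (0 for the origin, which is thus not primitive).
content : Vec ℤ d → ℕ
content = Vec.foldr′ (λ a g → gcd ∣ a ∣ g) 0

Primitive : Pred (Vec ℤ d) 0ℓ
Primitive x = content x ≡ 1

FirstNonzeroPositive : Pred (Vec ℤ d) 0ℓ
FirstNonzeroPositive []               = ⊥
FirstNonzeroPositive (+ zero ∷ x)     = FirstNonzeroPositive x
FirstNonzeroPositive (+ (suc _) ∷ _)  = ⊤
FirstNonzeroPositive (-[1+ _ ] ∷ _)   = ⊥

ℙ∘ : ∀ d → Pred (Vec ℤ d) 0ℓ
ℙ∘ d x = Primitive x × FirstNonzeroPositive x

firstNonzeroPositive? : Decidable (FirstNonzeroPositive {d})
firstNonzeroPositive? []               = no λ ()
firstNonzeroPositive? (+ zero ∷ x)     = firstNonzeroPositive? x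
firstNonzeroPositive? (+ (suc _) ∷ _)  = yes tt
firstNonzeroPositive? (-[1+ _ ] ∷ _)   = no λ ()

ℙ∘? : ∀ d → Decidable (ℙ∘ d)
ℙ∘? d x = (content x ≟ 1) ×-dec firstNonzeroPositive? x

-- Finite sets of points are represented by duplicate-free lists.

coordinateSum : List (Vec ℤ d) → Fin d → ℕ
coordinateSum X i = sum (map (λ x → ∣ lookup x i ∣) X)

κ : List (Vec ℤ d) → ℕ
κ {d} X = max 0 (map (coordinateSum X) (allFin d))

Cardinality : (d k : ℕ) → Pred ℕ 0ℓ
Cardinality d k n =
  ∃[ X ] Unique X × All (ℙ∘ d) X × κ X ≤ k × length X ≡ n

‖_‖₁ : Vec ℤ d → ℕ
‖ x ‖₁ = Vec.sum (Vec.map ∣_∣ x)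

interval : ℕ → List ℤ
interval p = map +_ (upTo (suc p)) ++ map -[1+_] (upTo p)

cube : ∀ d → ℕ → List (Vec ℤ d)
cube zero    p = [ [] ]
cube (suc d) p = cartesianProductWith _∷_ (interval p) (cube d p)

InBall : ∀ d → ℕ → Pred (Vec ℤ d) 0ℓ
InBall d p x = ‖ x ‖₁ ≤ p × ℙ∘ d x

-- B(d,p) ∩ ℙ∘ d, found inside the cube [-p,p]^d; the two lemmas
-- ball-unique and ∈-ball below confirm that this is the right set.
ball : ∀ d → ℕ → List (Vec ℤ d)
ball d p = filter (λ x → (‖ x ‖₁ ≤? p) ×-dec ℙ∘? d x) (cube d p)

N : (d p : ℕ) → ℕ
N d p = length (ball d p)

κ[_,_] : (d p : ℕ) → ℕ
κ[ d , p ] = κ (ball d p)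

private
  ∈-interval : ∀ (a : ℤ) → ∣ a ∣ ≤ p → a ∈ interval p
  ∈-interval (+ n) n≤p = ∈-++⁺ˡ (∈-map⁺ +_ (∈-upTo⁺ (s≤s n≤p)))
  ∈-interval {p} -[1+ n ] n<p =
    ∈-++⁺ʳ (map +_ (upTo (suc p))) (∈-map⁺ -[1+_] (∈-upTo⁺ n<p))

  interval-unique : ∀ p → Unique (interval p)
  interval-unique p = Unique.++⁺
    (Unique.map⁺ ℤ.+-injective (Unique.upTo⁺ (suc p)))
    (Unique.map⁺ ℤ.-[1+-injective (Unique.upTo⁺ p))
    λ (u , v) → disjoint (∈-map⁻ +_ u) (∈-map⁻ -[1+_] v)
    where
    disjoint : ∀ {a S T} → (∃ λ m → m ∈ S × a ≡ + m) → (∃ λ n → n ∈ T × a ≡ -[1+ n ]) → ⊥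
    disjoint (_ , _ , refl) (_ , _ , ())

  ∈-cube : ∀ (x : Vec ℤ d) → (∀ i → ∣ lookup x i ∣ ≤ p) → x ∈ cube d p
  ∈-cube []      _ = here refl
  ∈-cube (a ∷ x) h =
    ∈-cartesianProductWith⁺ _∷_ (∈-interval a (h zero)) (∈-cube x (h ∘ suc))

  cube-unique : ∀ d p → Unique (cube d p)
  cube-unique zero    p = [] ∷ []
  cube-unique (suc d) p = Unique.cartesianProductWith⁺ _∷_
    Vec.∷-injective (interval-unique p) (cube-unique d p)

  coordinate≤‖‖₁ : ∀ (x : Vec ℤ d) i → ∣ lookup x i ∣ ≤ ‖ x ‖₁
  coordinate≤‖‖₁ (a ∷ x) zero    = m≤m+n ∣ a ∣ _
  coordinate≤‖‖₁ (a ∷ x) (suc i) = ≤-trans (coordinate≤‖‖₁ x i) (m≤n+m _ ∣ a ∣)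

ball-unique : ∀ d p → Unique (ball d p)
ball-unique d p = Unique.filter⁺ _ (cube-unique d p)

∈-ball : ∀ {x : Vec ℤ d} → x ∈ ball d p ⇔ InBall d p x
∈-ball {d} {p} {x} = mk⇔
  (proj₂ ∘ ∈-filter⁻ _ {xs = cube d p})
  λ h → ∈-filter⁺ _ (∈-cube x λ i → ≤-trans (coordinate≤‖‖₁ x i) (proj₁ h)) h

private
  coordinateSum≤κ : ∀ (X : List (Vec ℤ d)) i → coordinateSum X i ≤ κ X
  coordinateSum≤κ {d} X i =
    All.lookup (xs≤max 0 (map (coordinateSum X) (allFin d))) (∈-map⁺ (coordinateSum X) (∈-allFin i))

  κ≤ : ∀ (X : List (Vec ℤ d)) → (∀ i → coordinateSum X i ≤ k) → κ X ≤ k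
  κ≤ {d} X h = max≤v⁺ z≤n (All.map⁺ (All.universal h (allFin d)))

  coordinate≤sum : ∀ {X : List (Vec ℤ d)} {x} → x ∈ X → ∀ i → ∣ lookup x i ∣ ≤ coordinateSum X i
  coordinate≤sum {x = x} (here refl)           i = m≤m+n ∣ lookup x i ∣ _
  coordinate≤sum {X = y ∷ _} (there x∈X) i =
    ≤-trans (coordinate≤sum x∈X i) (m≤n+m _ ∣ lookup y i ∣)

  κ-↭ : ∀ {X Y : List (Vec ℤ d)} → X ↭ Y → κ X ≤ κ Y
  κ-↭ {X = X} {Y} X↭Y = κ≤ X λ i →
    ≤-trans (≤-reflexive (sum-↭ (map⁺ _ X↭Y))) (coordinateSum≤κ Y i)

  sublists : List A → List (List A)
  sublists []       = [ [] ]
  sublists (x ∷ xs) = map (x ∷_) (sublists xs) ++ sublists xs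

  sublists-All : ∀ {P : Pred A 0ℓ} {xs} → All P xs → All (All P) (sublists xs)
  sublists-All []         = [] ∷ []
  sublists-All (px ∷ pxs) =
    All.++⁺ (All.map⁺ (All.map (px ∷_) (sublists-All pxs))) (sublists-All pxs)

  sublists-Unique : ∀ {xs : List A} → Unique xs → All Unique (sublists xs)
  sublists-Unique []            = [] ∷ []
  sublists-Unique (x∉xs ∷ uxs)  = All.++⁺
    (All.map⁺ (All.zipWith (λ (u , v) → u ∷ v) (sublists-All x∉xs , sublists-Unique uxs)))
    (sublists-Unique uxs)

  filter∈sublists : ∀ {P : Pred A 0ℓ} (P? : Decidable P) xs → filter P? xs ∈ sublists xs
  filter∈sublists P? [] = here refl
  filter∈sublists P? (x ∷ xs) with P? x
  ... | yes _ = ∈-++⁺ˡ (∈-map⁺ (x ∷_) (filter∈sublists P? xs))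
  ... | no  _ = ∈-++⁺ʳ (map (x ∷_) (sublists xs)) (filter∈sublists P? xs)

δz-exists : ∀ d k → ∃ (IsMaximum (Cardinality d k))
δz-exists d k = length best , (best , proj₁ good , proj₁ (proj₂ good) , proj₂ (proj₂ good) , refl) , maximal
  where
  open import Data.List.Membership.DecPropositional (Vec.≡-dec {n = d} ℤ._≟_) using (_∈?_)

  points : List (Vec ℤ d)
  points = filter (ℙ∘? d) (cube d k)

  points-unique : Unique points
  points-unique = Unique.filter⁺ (ℙ∘? d) (cube-unique d k)

  Good : Pred (List (Vec ℤ d)) 0ℓ
  Good X = Unique X × All (ℙ∘ d) X × κ X ≤ k

  κ≤k? : Decidable (λ (X : List (Vec ℤ d)) → κ X ≤ k)
  κ≤k? X = κ X ≤? k

  candidates : List (List (Vec ℤ d))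
  candidates = filter κ≤k? (sublists points)

  best : List (Vec ℤ d)
  best = argmax length [] candidates

  candidate-good : ∀ {X} → X ∈ candidates → Good X
  candidate-good X∈ with ∈-filter⁻ κ≤k? {xs = sublists points} X∈
  ... | X∈s , κX≤k =
    All.lookup (sublists-Unique points-unique) X∈s ,
    All.lookup (sublists-All (All.all-filter (ℙ∘? d) (cube d k))) X∈s ,
    κX≤k

  good : Good best
  good = argmax-all length ([] , [] , κ≤ {d} [] λ _ → z≤n) (All.tabulate candidate-good)

  maximal : ∀ n → Cardinality d k n → n ≤ length best
  maximal n (X , uX , pX , κX≤k , refl) = ≤-trans
    (≤-reflexive (sym (↭-length Y↭X)))
    (All.lookup (f[xs]≤f[argmax] {f = length} [] candidates) Y∈candidates)
    where
    Y : List (Vec ℤ d)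
    Y = filter (_∈? X) points

    X⊆Y : ∀ {x} → x ∈ X → x ∈ Y
    X⊆Y {x} x∈X = ∈-filter⁺ (_∈? X)
      (∈-filter⁺ (ℙ∘? d)
        (∈-cube x λ i → ≤-trans (coordinate≤sum x∈X i) (≤-trans (coordinateSum≤κ X i) κX≤k))
        (All.lookup pX x∈X))
      x∈X

    Y↭X : Y ↭ X
    Y↭X = ∼bag⇒↭ (unique∧set⇒bag (Unique.filter⁺ (_∈? X) points-unique) uX
      (mk⇔ (proj₂ ∘ ∈-filter⁻ (_∈? X) {xs = points}) X⊆Y))

    Y∈candidates : Y ∈ candidates
    Y∈candidates = ∈-filter⁺ κ≤k? (filter∈sublists (_∈? X) points) (≤-trans (κ-↭ Y↭X) κX≤k)

δz : (d k : ℕ) → ℕ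
δz d k = proj₁ (δz-exists d k)

Exceeds : (d k : ℕ) → Pred ℕ 0ℓ
Exceeds d k p = 0 < p × k < κ[ d , p ]

private
  minimum : ∀ {S : Pred ℕ 0ℓ} → Decidable S → ∀ n → S n → ∃ (IsMinimum S)
  minimum S? zero    s = zero , s , λ _ _ → z≤n
  minimum {S} S? (suc n) s with S? zero
  ... | yes s₀ = zero , s₀ , λ _ _ → z≤n
  ... | no ¬s₀ with minimum (S? ∘ suc) n s
  ...   | m , sm , least = suc m , sm , λ where
          zero    s₀ → contradiction s₀ ¬s₀
          (suc j) sj → s≤s (least j sj)

  exceeds : ∀ d k → 1 < d → Exceeds d k (suc (suc k))
  exceeds (suc (suc n)) k _ =
    z<s , ≤-trans (coordinate≤sum x∈ zero) (coordinateSum≤κ (ball (suc (suc n)) (suc (suc k))) zero)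
    where
    zeros : ∀ n → ‖ replicate n (+ 0) ‖₁ ≡ 0
    zeros zero    = refl
    zeros (suc n) = zeros n

    x : Vec ℤ (suc (suc n))
    x = + suc k ∷ + 1 ∷ replicate n (+ 0)

    norm : ‖ x ‖₁ ≡ suc (suc k)
    norm rewrite zeros n = cong suc (+-comm k 1)

    x∈ : x ∈ ball (suc (suc n)) (suc (suc k))
    x∈ = Equivalence.from ∈-ball
      ( ≤-reflexive norm
      , trans (cong (gcd (suc k)) (gcd-zeroˡ (content (replicate n (+ 0))))) (gcd-zeroʳ (suc k))
      , tt)
  exceeds (suc zero) k (s≤s ())

-- Fails for d ≤ 1, where κ[ d , p ] is bounded in p.
threshold-exists : ∀ d k → .{{NonTrivial d}} → ∃ (IsMinimum (Exceeds d k))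
threshold-exists d k =
  minimum (λ p → (0 <? p) ×-dec (k <? κ[ d , p ])) (suc (suc k)) (exceeds d k (nonTrivial⇒n>1 d))

threshold : ∀ d k → .{{NonTrivial d}} → ℕ
threshold d k = proj₁ (threshold-exists d k)

threshold-nonZero : ∀ d k → .{{_ : NonTrivial d}} → NonZero (threshold d k)
threshold-nonZero d k = >-nonZero (proj₁ (proj₁ (proj₂ (threshold-exists d k))))

-- The threshold p is the least positive integer with k < κ[ d , p ].
lambda : ∀ d k → .{{NonTrivial d}} → ℚ
lambda d k = + N d (pₖ ∸ 1) ℚ./ 1 ℚ.+ (+ d ℤ.* (+ k ℤ.- + κ[ d , pₖ ∸ 1 ])) ℚ./ pₖ
  where
  pₖ = threshold d k
  instance _ = threshold-nonZero d k

Infinite : Pred ℕ 0ℓ → Set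
Infinite E = ∀ n → ∃[ m ] n < m × E m

-- |E ∩ [1,k]|; the list is 1, …, k.
count : {E : Pred ℕ 0ℓ} → Decidable E → ℕ → ℕ
count E? k = length (filter E? (map suc (upTo k)))

-- For r ≥ 1: f(k) / k^(1/r) → 0 as k → ∞.  For naturals f(k), k ≥ 1 and
-- rational ε > 0, the inequality f(k) / k^(1/r) < ε reads
-- f(k)^r < ε^r k, which avoids real roots.
RootQuotientTendsToZero : (f : ℕ → ℕ) (r : ℕ) → Set
RootQuotientTendsToZero f r =
  ∀ (ε : ℚ) → ℚ.Positive ε →
  ∃[ K ] ∀ k → 0 < k → K ≤ k → (+ f k ℚ./ 1) ^ℚ r ℚ.< (ε ^ℚ r) ℚ.* (+ k ℚ./ 1)
  where _^ℚ_ = _^_ ℚ.+-*-rawSemiring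

{-# OPTIONS --safe #-}

-- Summing l1-norms over the d coordinates gives δ ≤ ⌊λ⌋, since the ball B(d, p-1)
-- contains all points of norm less than p.  Conversely, for k = κ_{p-1} + m one has to
-- add to this ball n = ⌊d m / p⌋ points of norm p whose coordinate sums are at most m.
-- The points of norm p split into orbits of cyclic rotation (up to sign), each of
-- which has at most d points and equal coordinate sums; so a union of orbits does the
-- job up to fewer than d points, and these are taken from a reserved set of points
-- close to (p/d, …, p/d).
--
-- If d does not divide p, rotations of a vector with entries ⌊p/d⌋ and ⌈p/d⌉ can be
-- ordered so that all partial sums are balanced, and no k in the window is
-- exceptional.  If p = d q, a perfect balance is needed only for m = n q.  For d ≥ 3 it
-- is achieved by the points (q, …, q) + e_a − e_z with (a, z) running over the arcs of
-- an Eulerian digraph, except for n = 1 and boundedly many n close to the number of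
-- points of norm p.  For d = 2 the exceptions in the window have m mod q ∈ {0, 1}.
-- In both cases they are sparse because κ_p grows at least like p^d.  Finally n = 1 is
-- exceptional for every p = d q with q ≥ 2, since (q, …, q) is not primitive.

module Submission where

open import Defs
import Algebra.Definitions.RawSemiring as RawSemiring
open import Algebra.Bundles using (CommutativeMonoid)
import Algebra.Properties.CommutativeMonoid.Sum as CommutativeMonoidSum
import Algebra.Properties.CommutativeSemigroup as CommutativeSemigroupProperties
open import Data.Empty using (⊥)
open import Data.Fin as Fin using (Fin; zero; suc; toℕ)
import Data.Fin.Permutation as Permutation
import Data.Fin.Properties as Fin
open import Data.Integer as ℤ using (ℤ; +_; -[1+_]; ∣_∣; _-_; 1ℤ)
import Data.Integer.Properties as ℤ
open import Data.List
  using (List; []; _∷_; [_]; _∷ʳ_; _++_; map; foldr; filter; length; concatMap; upTo; applyUpTo; allFin; cartesianProductWith)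
open import Data.List.Extrema.Nat using (xs≤max; max≤v⁺)
open import Data.List.Membership.DecPropositional using (_∈?_)
open import Data.List.Membership.Propositional using (_∈_; _∉_; find; lose)
open import Data.List.Membership.Propositional.Properties
open import Data.List.Properties using (length-map; length-++; map-∘; map-++; length-upTo; upTo-∷ʳ; map-upTo)
open import Data.List.Relation.Binary.Subset.Propositional using (_⊆_)
open import Data.List.Relation.Unary.All as All using ([]; _∷_)
import Data.List.Relation.Unary.All.Properties as All
open import Data.List.Relation.Unary.AllPairs using ([]; _∷_)
open import Data.List.Relation.Unary.Any using (here; there)
open import Data.List.Relation.Unary.Unique.Propositional using (Unique)
import Data.List.Relation.Unary.Unique.Propositional.Properties as Unique
open import Data.Nat
open import Data.Nat.Coprimality as Coprimality using (coprime-divisor; coprime-/gcd)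
open import Data.Nat.Divisibility
open import Data.Nat.DivMod
open import Data.Nat.GCD
open import Data.Nat.GeneralisedArithmetic using (fold)
open import Data.Nat.ListAction using (sum)
open import Data.Nat.ListAction.Properties using (sum-++)
open import Data.Nat.Properties
open import Data.Nat.Tactic.RingSolver using (solve-∀)
open import Data.Product using (Σ-syntax; ∃-syntax; _×_; _,_; proj₁; proj₂)
open import Data.Rational as ℚ using (ℚ; floor)
import Data.Rational.Properties as ℚ
import Data.Rational.Unnormalised as ℚᵘ
import Data.Rational.Unnormalised.Properties as ℚᵘ
open import Data.Sum as Sum using (_⊎_; inj₁; inj₂; [_,_]′)
open import Data.Unit using (tt)
open import Data.Vec as Vec using (Vec; []; _∷_; lookup; tabulate)
import Data.Vec.Properties as Vec
open import Function using (_∘_; id; Equivalence)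
open import Level using (0ℓ)
open import Relation.Binary.Definitions using (DecidableEquality; tri<; tri≈; tri>)
open import Relation.Binary.PropositionalEquality hiding ([_])
open import Relation.Nullary using (¬_; yes; no; contradiction; ¬?)
open import Relation.Nullary.Decidable using (decidable-stable; _×-dec_)
open import Relation.Unary using (Pred; Decidable)

-- All balance questions go through one number, the error e in `Spread`. Points with this error fit
-- into the offset m as soon as n p + e < d (m + 1). Since n p ≤ d m, the error d - 1 is always
-- harmless. For p = d q the diagonal point is imprimitive unless q = 1, and its substitutes cost e
-- = d, or up to 2 d in the plane, where (q + 1, q - 1) is imprimitive for odd q. With n = ⌊m / q⌋
-- the remainder m mod q has to pay for this. Dropping one point gains p, which covers every error
-- that occurs, so δ never falls short of ⌊λ⌋ by more than 1. Hence E can be defined by failure of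
-- equality, and only its size remains to be estimated. For d ≥ 3 a window has boundedly many
-- exceptions, and there are O(k^(1/d)) windows up to k, of smaller order than k^(1/(d-1)). For d =
-- 2 a window of width w may hold about 2 w / q + 2 exceptions; this adds up to o(k) because q grows
-- and the widths sum to k.

private variable
  A B : Set
  d m n p e : ℕ

open CommutativeMonoidSum +-0-commutativeMonoid
  renaming (sum to ∑) using (sum-cong-≗; sum-permute; ∑-distrib-+; sum-replicate-zero)

-- Sums over duplicate-free lists

sum-map-++ : ∀ (f : A → ℕ) X Y → sum (map f (X ++ Y)) ≡ sum (map f X) + sum (map f Y)
sum-map-++ f X Y = trans (cong sum (map-++ f X Y)) (sum-++ (map f X) (map f Y))

sum-map-remove : ∀ (f : A → ℕ) Y x Z →
  sum (map f (Y ++ x ∷ Z)) ≡ f x + sum (map f (Y ++ Z))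
sum-map-remove f []      x Z = refl
sum-map-remove f (y ∷ Y) x Z rewrite sum-map-remove f Y x Z = swap (f y) (f x) _
  where
  swap : ∀ a b c → a + (b + c) ≡ b + (a + c)
  swap = solve-∀

-- Inclusion is asked only for points of positive weight: deficits vanish on points of large norm,
-- which lie outside the ball to which X is compared.
sum-map-⊆ : ∀ (f : A → ℕ) {X Y} → Unique X → (∀ {x} → x ∈ X → 0 < f x → x ∈ Y) →
  sum (map f X) ≤ sum (map f Y)
sum-map-⊆ f {[]}        _            _   = z≤n
sum-map-⊆ f {x ∷ X} {Y} (x∉X ∷ uX) sub with f x in eq
... | zero  = sum-map-⊆ f uX (sub ∘ there)
... | suc c with ∈-∃++ (sub (here refl) (subst (0 <_) (sym eq) z<s))
...   | Y₁ , Y₂ , refl = begin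
  suc c + sum (map f X)              ≤⟨ +-monoʳ-≤ (suc c) (sum-map-⊆ f uX sub′) ⟩
  suc c + sum (map f (Y₁ ++ Y₂))     ≡⟨ cong (_+ sum (map f (Y₁ ++ Y₂))) eq ⟨
  f x + sum (map f (Y₁ ++ Y₂))       ≡⟨ sum-map-remove f Y₁ x Y₂ ⟨
  sum (map f (Y₁ ++ x ∷ Y₂))         ∎
  where
  open ≤-Reasoning
  sub′ : ∀ {y} → y ∈ X → 0 < f y → y ∈ Y₁ ++ Y₂
  sub′ y∈X 0<fy with ∈-++⁻ Y₁ (sub (there y∈X) 0<fy)
  ... | inj₁ y∈Y₁         = ∈-++⁺ˡ y∈Y₁
  ... | inj₂ (here refl)  = contradiction refl (All.lookup x∉X y∈X)
  ... | inj₂ (there y∈Y₂) = ∈-++⁺ʳ Y₁ y∈Y₂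

sum-map-const : ∀ c (X : List A) → sum (map (λ _ → c) X) ≡ length X * c
sum-map-const c []      = refl
sum-map-const c (_ ∷ X) = cong (_+_ c) (sum-map-const c X)

length-⊆ : ∀ {X Y : List A} → Unique X → X ⊆ Y → length X ≤ length Y
length-⊆ {X = X} {Y} uX X⊆Y = begin
  length X                   ≡⟨ *-identityʳ _ ⟨
  length X * 1               ≡⟨ sum-map-const 1 X ⟨
  sum (map (λ _ → 1) X)      ≤⟨ sum-map-⊆ _ uX (λ x∈X _ → X⊆Y x∈X) ⟩
  sum (map (λ _ → 1) Y)      ≡⟨ sum-map-const 1 Y ⟩
  length Y * 1               ≡⟨ *-identityʳ _ ⟩
  length Y                   ∎
  where open ≤-Reasoning

sum-map-cong : ∀ {f g : A → ℕ} {X} → (∀ {x} → x ∈ X → f x ≡ g x) → sum (map f X) ≡ sum (map g X)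
sum-map-cong {X = []}    _  = refl
sum-map-cong {X = _ ∷ _} eq = cong₂ _+_ (eq (here refl)) (sum-map-cong (eq ∘ there))

sum-map-mono : ∀ {f g : A → ℕ} {X} → (∀ {x} → x ∈ X → f x ≤ g x) → sum (map f X) ≤ sum (map g X)
sum-map-mono {X = []}    _  = z≤n
sum-map-mono {X = _ ∷ _} le = +-mono-≤ (le (here refl)) (sum-map-mono (le ∘ there))

sum-map-+ : ∀ (f g : A → ℕ) X → sum (map (λ x → f x + g x) X) ≡ sum (map f X) + sum (map g X)
sum-map-+ f g []      = refl
sum-map-+ f g (x ∷ X) rewrite sum-map-+ f g X = swap (f x) (g x) _ _
  where
  swap : ∀ a b c d → a + b + (c + d) ≡ a + c + (b + d)
  swap = solve-∀

length-concatMap : ∀ (F : A → List B) X → length (concatMap F X) ≡ sum (map (length ∘ F) X)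
length-concatMap F []      = refl
length-concatMap F (x ∷ X) = trans (length-++ (F x)) (cong (_+_ (length (F x))) (length-concatMap F X))

unique-map : ∀ {f : A → B} {X} → Unique X → (∀ {x y} → x ∈ X → y ∈ X → f x ≡ f y → x ≡ y) → Unique (map f X)
unique-map {X = []} _ _ = []
unique-map {f = f} {x ∷ X} (x∉X ∷ uX) inj =
  All.tabulate (λ z∈ eq → let y , y∈X , z≡ = ∈-map⁻ f z∈ in
    All.lookup x∉X y∈X (inj (here refl) (there y∈X) (trans eq z≡)))
  ∷ unique-map uX λ x∈ y∈ → inj (there x∈) (there y∈)

unique-++ : ∀ {X Y : List A} → Unique X → Unique Y → (∀ {x} → x ∈ X → x ∉ Y) → Unique (X ++ Y)
unique-++ uX uY dis = Unique.++⁺ uX uY λ (x∈X , x∈Y) → dis x∈X x∈Y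

exists∉ : DecidableEquality A → ∀ {X Y : List A} → Unique X → length Y < length X → ∃[ x ] x ∈ X × x ∉ Y
exists∉ _≟ᴬ_ {X} {Y} uX Y<X with All.all? (λ x → _∈?_ _≟ᴬ_ x Y) X
... | yes X⊆Y = contradiction (length-⊆ uX (All.lookup X⊆Y)) (<⇒≱ Y<X)
... | no ¬X⊆Y with find (All.¬All⇒Any¬ (λ x → _∈?_ _≟ᴬ_ x Y) X ¬X⊆Y)
...   | x , x∈X , x∉Y = x , x∈X , x∉Y

-- Cyclic rotation of coordinates

%-+ˡ : ∀ m n d .{{_ : NonZero d}} → (m % d + n) % d ≡ (m + n) % d
%-+ˡ m n d = begin
  (m % d + n) % d            ≡⟨ %-distribˡ-+ (m % d) n d ⟩
  (m % d % d + n % d) % d    ≡⟨ cong (λ z → (z + n % d) % d) (m%n%n≡m%n m d) ⟩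
  (m % d + n % d) % d        ≡⟨ %-distribˡ-+ m n d ⟨
  (m + n) % d                ∎
  where open ≡-Reasoning

infixl 6 _⊕_

_⊕_ : .{{_ : NonZero d}} → Fin d → ℕ → Fin d
_⊕_ {d} i c = (toℕ i + c) mod d

toℕ-⊕ : .{{_ : NonZero d}} → ∀ (i : Fin d) c → toℕ (i ⊕ c) ≡ (toℕ i + c) % d
toℕ-⊕ {d} i c = Fin.toℕ-fromℕ< (m%n<n (toℕ i + c) d)

⊕-⊕ : .{{_ : NonZero d}} → ∀ (i : Fin d) a c → i ⊕ a ⊕ c ≡ i ⊕ (a + c)
⊕-⊕ {d} i a c = Fin.toℕ-injective (begin
  toℕ (i ⊕ a ⊕ c)                ≡⟨ toℕ-⊕ (i ⊕ a) c ⟩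
  (toℕ (i ⊕ a) + c) % d          ≡⟨ cong (λ z → (z + c) % d) (toℕ-⊕ i a) ⟩
  ((toℕ i + a) % d + c) % d      ≡⟨ %-+ˡ (toℕ i + a) c d ⟩
  (toℕ i + a + c) % d            ≡⟨ cong (_% d) (+-assoc (toℕ i) a c) ⟩
  (toℕ i + (a + c)) % d          ≡⟨ toℕ-⊕ i (a + c) ⟨
  toℕ (i ⊕ (a + c))              ∎)
  where open ≡-Reasoning

⊕-full : .{{_ : NonZero d}} → ∀ (i : Fin d) → i ⊕ d ≡ i
⊕-full {d} i = Fin.toℕ-injective (trans (toℕ-⊕ i d)
  (trans ([m+n]%n≡m%n (toℕ i) d) (m<n⇒m%n≡m (Fin.toℕ<n i))))

⊕-transitive : .{{_ : NonZero d}} → ∀ (i j : Fin d) → ∃[ c ] i ⊕ c ≡ j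
⊕-transitive {d} i j = d ∸ toℕ i + toℕ j , Fin.toℕ-injective (begin
  toℕ (i ⊕ (d ∸ toℕ i + toℕ j))         ≡⟨ toℕ-⊕ i _ ⟩
  (toℕ i + (d ∸ toℕ i + toℕ j)) % d     ≡⟨ cong (_% d) (+-assoc (toℕ i) _ _) ⟨
  (toℕ i + (d ∸ toℕ i) + toℕ j) % d     ≡⟨ cong (λ z → (z + toℕ j) % d) (m+[n∸m]≡n (<⇒≤ (Fin.toℕ<n i))) ⟩
  (d + toℕ j) % d                       ≡⟨ cong (_% d) (+-comm d (toℕ j)) ⟩
  (toℕ j + d) % d                       ≡⟨ toℕ-⊕ j d ⟨
  toℕ (j ⊕ d)                           ≡⟨ cong toℕ (⊕-full j) ⟩
  toℕ j                                 ∎)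
  where open ≡-Reasoning

⊕1-⊕[d∸1] : .{{_ : NonZero d}} → ∀ (i : Fin d) → i ⊕ 1 ⊕ (d ∸ 1) ≡ i
⊕1-⊕[d∸1] {suc _} i = trans (⊕-⊕ i 1 _) (⊕-full i)

⊕[d∸1]-⊕1 : .{{_ : NonZero d}} → ∀ (i : Fin d) → i ⊕ (d ∸ 1) ⊕ 1 ≡ i
⊕[d∸1]-⊕1 {suc d-1} i = trans (⊕-⊕ i d-1 1) (trans (cong (i ⊕_) (+-comm d-1 1)) (⊕-full i))

∑-⊕ : .{{_ : NonZero d}} → ∀ (f : Fin d → ℕ) → ∑ f ≡ ∑ (λ i → f (i ⊕ 1))
∑-⊕ {d} f = sum-permute f (Permutation.permutation (_⊕ 1) (_⊕ (d ∸ 1)) ⊕[d∸1]-⊕1 ⊕1-⊕[d∸1])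

∑-const : ∀ (f : Fin d → ℕ) c → (∀ i → f i ≡ c) → ∑ f ≡ d * c
∑-const {zero}  f c h = refl
∑-const {suc d} f c h = cong₂ _+_ (h zero) (∑-const (f ∘ suc) c (h ∘ suc))

∑-mono : ∀ {f g : Fin d → ℕ} → (∀ i → f i ≤ g i) → ∑ f ≤ ∑ g
∑-mono {zero}  h = z≤n
∑-mono {suc d} h = +-mono-≤ (h zero) (∑-mono (h ∘ suc))

≤∑ : ∀ (f : Fin d → ℕ) i → f i ≤ ∑ f
≤∑ f zero    = m≤m+n (f zero) _
≤∑ f (suc i) = ≤-trans (≤∑ (f ∘ suc) i) (m≤n+m _ (f zero))

∑-squeeze : ∀ (f : Fin d → ℕ) c → (∀ i → f i ≤ c) → d * c ≤ ∑ f → ∀ i → f i ≡ c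
∑-squeeze {suc d} f c f≤c le zero    = ≤-antisym (f≤c zero) (+-cancelʳ-≤ (d * c) _ _
  (≤-trans le (+-monoʳ-≤ (f zero) (≤-trans (∑-mono (f≤c ∘ suc)) (≤-reflexive (∑-const {d} (λ _ → c) c (λ _ → refl)))))))
∑-squeeze {suc d} f c f≤c le (suc i) = ∑-squeeze (f ∘ suc) c (f≤c ∘ suc)
  (+-cancelˡ-≤ c _ _ (≤-trans le (+-monoˡ-≤ (∑ (f ∘ suc)) (f≤c zero)))) i

-- Norms and coordinate sums

‖‖₁-∑ : ∀ (x : Vec ℤ d) → ‖ x ‖₁ ≡ ∑ (λ i → ∣ lookup x i ∣)
‖‖₁-∑ []      = refl
‖‖₁-∑ (a ∷ x) = cong (_+_ ∣ a ∣) (‖‖₁-∑ x)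

∑-coordinateSum : ∀ (X : List (Vec ℤ d)) → ∑ (coordinateSum X) ≡ sum (map ‖_‖₁ X)
∑-coordinateSum {d} []      = sum-replicate-zero d
∑-coordinateSum {d} (x ∷ X) = trans (∑-distrib-+ (λ i → ∣ lookup x i ∣) (coordinateSum X))
  (cong₂ _+_ (sym (‖‖₁-∑ x)) (∑-coordinateSum X))

coordinateSum≤κ : ∀ (X : List (Vec ℤ d)) i → coordinateSum X i ≤ κ X
coordinateSum≤κ {d} X i =
  All.lookup (xs≤max 0 (map (coordinateSum X) (allFin d))) (∈-map⁺ (coordinateSum X) (∈-allFin i))

κ-least : ∀ {k} (X : List (Vec ℤ d)) → (∀ i → coordinateSum X i ≤ k) → κ X ≤ k
κ-least {d} X h = max≤v⁺ z≤n (All.map⁺ (All.universal h (allFin d)))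

∑‖‖₁≤d*κ : ∀ (X : List (Vec ℤ d)) → sum (map ‖_‖₁ X) ≤ d * κ X
∑‖‖₁≤d*κ {d} X = subst₂ _≤_ (∑-coordinateSum X) (∑-const {d} (λ _ → κ X) (κ X) (λ _ → refl))
  (∑-mono {f = coordinateSum X} {g = λ _ → κ X} (coordinateSum≤κ X))

-- Content and sign

content-∣ : ∀ (x : Vec ℤ d) i → content x ∣ ∣ lookup x i ∣
content-∣ (a ∷ x) zero    = gcd[m,n]∣m ∣ a ∣ (content x)
content-∣ (a ∷ x) (suc i) = ∣-trans (gcd[m,n]∣n ∣ a ∣ (content x)) (content-∣ x i)

content-greatest : ∀ {g} (x : Vec ℤ d) → (∀ i → g ∣ ∣ lookup x i ∣) → g ∣ content x
content-greatest []      h = _ ∣0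
content-greatest (a ∷ x) h = gcd-greatest (h zero) (content-greatest x (h ∘ suc))

neg : Vec ℤ d → Vec ℤ d
neg = Vec.map (ℤ.-_)

neg-involutive : ∀ (x : Vec ℤ d) → neg (neg x) ≡ x
neg-involutive []      = refl
neg-involutive (a ∷ x) = cong₂ _∷_ (ℤ.neg-involutive a) (neg-involutive x)

lookup-neg : ∀ (x : Vec ℤ d) i → lookup (neg x) i ≡ ℤ.- lookup x i
lookup-neg x i = Vec.lookup-map i (ℤ.-_) x

FirstNonzeroPositive-neg : ∀ (x : Vec ℤ d) → FirstNonzeroPositive x → ¬ FirstNonzeroPositive (neg x)
FirstNonzeroPositive-neg (+ zero ∷ x) = FirstNonzeroPositive-neg x
FirstNonzeroPositive-neg (+ suc _ ∷ x) _ ()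

¬FirstNonzeroPositive⇒neg : ∀ (x : Vec ℤ d) → content x ≢ 0 →
  ¬ FirstNonzeroPositive x → FirstNonzeroPositive (neg x)
¬FirstNonzeroPositive⇒neg []               c≢0 ¬pos = c≢0 refl
¬FirstNonzeroPositive⇒neg (+ zero ∷ x)     c≢0 ¬pos =
  ¬FirstNonzeroPositive⇒neg x (c≢0 ∘ trans (gcd-identityˡ (content x))) ¬pos
¬FirstNonzeroPositive⇒neg (+ suc _ ∷ x)    c≢0 ¬pos = contradiction tt ¬pos
¬FirstNonzeroPositive⇒neg (-[1+ _ ] ∷ x)   c≢0 ¬pos = tt

infix 4 _≡±_

-- Rotation can make the first non-zero coordinate negative, so it acts on `ℙ∘` only up to sign.
-- Norms and coordinate sums do not see the sign.
_≡±_ : Vec ℤ d → Vec ℤ d → Set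
x ≡± y = x ≡ y ⊎ x ≡ neg y

≡±-trans : ∀ {x y z : Vec ℤ d} → x ≡± y → y ≡± z → x ≡± z
≡±-trans (inj₁ refl) y±z         = y±z
≡±-trans (inj₂ refl) (inj₁ refl) = inj₂ refl
≡±-trans {z = z} (inj₂ refl) (inj₂ refl) = inj₁ (neg-involutive z)

-- A vector and its negative cannot both have a positive first non-zero coordinate.
≡±⇒≡ : ∀ {x y : Vec ℤ d} → x ≡± y → FirstNonzeroPositive x → FirstNonzeroPositive y → x ≡ y
≡±⇒≡             (inj₁ x≡y)  _    _    = x≡y
≡±⇒≡ {y = y} (inj₂ refl) posx posy = contradiction posx (FirstNonzeroPositive-neg y posy)

normalise : Vec ℤ d → Vec ℤ d
normalise x with firstNonzeroPositive? x
... | yes _ = x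
... | no  _ = neg x

normalise-≡± : ∀ (x : Vec ℤ d) → normalise x ≡± x
normalise-≡± x with firstNonzeroPositive? x
... | yes _ = inj₁ refl
... | no  _ = inj₂ refl

normalise-pos : ∀ (x : Vec ℤ d) → content x ≢ 0 → FirstNonzeroPositive (normalise x)
normalise-pos x c≢0 with firstNonzeroPositive? x
... | yes pos = pos
... | no ¬pos = ¬FirstNonzeroPositive⇒neg x c≢0 ¬pos

∣lookup∣-≡± : ∀ {x y : Vec ℤ d} → x ≡± y → ∀ i → ∣ lookup x i ∣ ≡ ∣ lookup y i ∣
∣lookup∣-≡±             (inj₁ refl) i = refl
∣lookup∣-≡± {y = y} (inj₂ refl) i = trans (cong ∣_∣ (lookup-neg y i)) (ℤ.∣-i∣≡∣i∣ (lookup y i))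

module _ .{{_ : NonZero d}} where

  rotate : Vec ℤ d → Vec ℤ d
  rotate x = tabulate λ i → lookup x (i ⊕ 1)

  -- Rotation of the coordinates, acting on points up to sign.
  ρ : Vec ℤ d → Vec ℤ d
  ρ x = normalise (rotate x)

  ρ^ : ℕ → Vec ℤ d → Vec ℤ d
  ρ^ c x = fold x ρ c

  ∣lookup-ρ∣ : ∀ x i → ∣ lookup (ρ x) i ∣ ≡ ∣ lookup x (i ⊕ 1) ∣
  ∣lookup-ρ∣ x i = trans (∣lookup∣-≡± (normalise-≡± (rotate x)) i)
    (cong ∣_∣ (Vec.lookup∘tabulate _ i))

  ‖ρ‖₁ : ∀ x → ‖ ρ x ‖₁ ≡ ‖ x ‖₁
  ‖ρ‖₁ x = begin
    ‖ ρ x ‖₁                              ≡⟨ ‖‖₁-∑ (ρ x) ⟩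
    ∑ (λ i → ∣ lookup (ρ x) i ∣)          ≡⟨ sum-cong-≗ (∣lookup-ρ∣ x) ⟩
    ∑ (λ i → ∣ lookup x (i ⊕ 1) ∣)        ≡⟨ ∑-⊕ (λ i → ∣ lookup x i ∣) ⟨
    ∑ (λ i → ∣ lookup x i ∣)              ≡⟨ ‖‖₁-∑ x ⟨
    ‖ x ‖₁                                ∎
    where open ≡-Reasoning

  content-rotate : ∀ x → content (rotate x) ≡ content x
  content-rotate x = ∣-antisym
    (content-greatest x λ i → subst (content (rotate x) ∣_)
      (cong ∣_∣ (trans (Vec.lookup∘tabulate _ (i ⊕ (d ∸ 1))) (cong (lookup x) (⊕[d∸1]-⊕1 i))))
      (content-∣ (rotate x) (i ⊕ (d ∸ 1))))
    (content-greatest (rotate x) λ i → subst (content x ∣_)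
      (cong ∣_∣ (sym (Vec.lookup∘tabulate _ i)))
      (content-∣ x (i ⊕ 1)))

  content-≡± : ∀ {x y : Vec ℤ d} → x ≡± y → content x ∣ content y
  content-≡± {x} {y} x±y = content-greatest y λ i →
    subst (content x ∣_) (∣lookup∣-≡± x±y i) (content-∣ x i)

  ρ-ℙ∘ : ∀ x → ℙ∘ d x → ℙ∘ d (ρ x)
  ρ-ℙ∘ x (prim , _) =
    ∣1⇒≡1 (subst (content (ρ x) ∣_) c≡1 (content-≡± (normalise-≡± (rotate x)))) ,
    normalise-pos (rotate x) λ c≡0 → 1+n≢0 (trans (sym c≡1) c≡0)
    where
    c≡1 : content (rotate x) ≡ 1
    c≡1 = trans (content-rotate x) prim

  rotate-≡± : ∀ {x y} → x ≡± y → rotate x ≡± rotate y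
  rotate-≡±             (inj₁ refl) = inj₁ refl
  rotate-≡± {y = y} (inj₂ refl) = inj₂ (trans
    (Vec.tabulate-cong λ i → lookup-neg y (i ⊕ 1)) (Vec.tabulate-∘ (ℤ.-_) _))

  -- Negation commutes with rotation, so the normalisations made along the way amount to one overall
  -- sign.
  ρ^-≡± : ∀ c x → ρ^ c x ≡± tabulate (λ i → lookup x (i ⊕ c))
  ρ^-≡± zero    x = inj₁ (trans (sym (Vec.tabulate∘lookup x)) (Vec.tabulate-cong λ i →
    cong (lookup x) (Fin.toℕ-injective (sym (trans (toℕ-⊕ i 0)
      (trans (cong (_% d) (+-identityʳ _)) (m<n⇒m%n≡m (Fin.toℕ<n i))))))))
  ρ^-≡± (suc c) x = ≡±-trans (normalise-≡± (rotate (ρ^ c x)))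
    (≡±-trans (rotate-≡± (ρ^-≡± c x)) (inj₁ (Vec.tabulate-cong λ i →
      trans (Vec.lookup∘tabulate _ (i ⊕ 1)) (cong (lookup x) (⊕-⊕ i 1 c)))))

  ρ^-ℙ∘ : ∀ c x → ℙ∘ d x → ℙ∘ d (ρ^ c x)
  ρ^-ℙ∘ zero    x h = h
  ρ^-ℙ∘ (suc c) x h = ρ-ℙ∘ (ρ^ c x) (ρ^-ℙ∘ c x h)

  ρ^-period : ∀ x → ℙ∘ d x → ρ^ d x ≡ x
  ρ^-period x h = ≡±⇒≡ (≡±-trans (ρ^-≡± d x) (inj₁ (trans
    (Vec.tabulate-cong λ i → cong (lookup x) (⊕-full i)) (Vec.tabulate∘lookup x))))
    (proj₂ (ρ^-ℙ∘ d x h)) (proj₂ h)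

  ρ^-suc : ∀ c x → ρ^ (suc c) x ≡ ρ^ c (ρ x)
  ρ^-suc zero    x = refl
  ρ^-suc (suc c) x = cong ρ (ρ^-suc c x)

  -- Provides `ρ^ (d ∸ 1)` as inverse of `ρ` on `ℙ∘`; both injectivity and the invariance of
  -- complements come from it.
  ρ^-unroll : ∀ x → ℙ∘ d x → ρ^ (d ∸ 1) (ρ x) ≡ x
  ρ^-unroll x h = trans (sym (ρ^-suc (d ∸ 1) x))
    (trans (cong (λ c → ρ^ c x) (suc-pred d)) (ρ^-period x h))

  ρ-injective : ∀ x y → ℙ∘ d x → ℙ∘ d y → ρ x ≡ ρ y → x ≡ y
  ρ-injective x y hx hy eq = begin
    x                ≡⟨ ρ^-unroll x hx ⟨
    ρ^ (d ∸ 1) (ρ x) ≡⟨ cong (ρ^ (d ∸ 1)) eq ⟩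
    ρ^ (d ∸ 1) (ρ y) ≡⟨ ρ^-unroll y hy ⟩
    y                ∎
    where open ≡-Reasoning

  Closed : List (Vec ℤ d) → Set
  Closed V = ∀ {x} → x ∈ V → ρ x ∈ V

  -- ρ permutes a closed set, so that the i-th coordinate sum does not depend on i.
  closed-balanced : ∀ {V} → Unique V → (∀ {x} → x ∈ V → ℙ∘ d x) → Closed V →
    ∀ i → d * coordinateSum V i ≡ sum (map ‖_‖₁ V)
  closed-balanced {V} uV hV clV i = trans
    (sym (∑-const (coordinateSum V) _ λ j →
      ≤-antisym (below i j) (below j i)))
    (∑-coordinateSum V)
    where
    open ≤-Reasoning
    -- One inequality between cyclic neighbours is enough: iterated around the cycle, it bounds
    -- every coordinate sum by every other.
    step : ∀ i → coordinateSum V (i ⊕ 1) ≤ coordinateSum V i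
    step i = begin
      sum (map (λ x → ∣ lookup x (i ⊕ 1) ∣) V)       ≡⟨ sum-map-cong {X = V} (λ {x} _ → sym (∣lookup-ρ∣ x i)) ⟩
      sum (map (λ x → ∣ lookup (ρ x) i ∣) V)         ≡⟨ cong sum (map-∘ V) ⟩
      sum (map (λ x → ∣ lookup x i ∣) (map ρ V))     ≤⟨ sum-map-⊆ _
        (unique-map uV λ x∈ y∈ → ρ-injective _ _ (hV x∈) (hV y∈))
        (λ z∈ _ → let y , y∈V , z≡ = ∈-map⁻ ρ z∈ in subst (_∈ V) (sym z≡) (clV y∈V)) ⟩
      sum (map (λ x → ∣ lookup x i ∣) V)             ∎
    steps : ∀ i c → coordinateSum V (i ⊕ c) ≤ coordinateSum V i
    steps i zero    = ≤-reflexive (cong (coordinateSum V) (Fin.toℕ-injective (trans (toℕ-⊕ i 0)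
      (trans (cong (_% d) (+-identityʳ _)) (m<n⇒m%n≡m (Fin.toℕ<n i))))))
    steps i (suc c) = subst (λ j → coordinateSum V j ≤ coordinateSum V i)
      (⊕-⊕ i 1 c) (≤-trans (steps (i ⊕ 1) c) (step i))
    below : ∀ i j → coordinateSum V j ≤ coordinateSum V i
    below i j with c , refl ← ⊕-transitive i j = steps i c

-- Unions of orbits

_≟ᵛ_ : DecidableEquality (Vec ℤ d)
_≟ᵛ_ = Vec.≡-dec ℤ._≟_

insert : Vec ℤ d → List (Vec ℤ d) → List (Vec ℤ d)
insert x V with _∈?_ _≟ᵛ_ x V
... | yes _ = V
... | no  _ = x ∷ V

insert-unique : ∀ (x : Vec ℤ d) {V} → Unique V → Unique (insert x V)
insert-unique x {V} uV with _∈?_ _≟ᵛ_ x V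
... | yes _  = uV
... | no x∉V = All.tabulate (λ y∈V x≡y → x∉V (subst (_∈ V) (sym x≡y) y∈V)) ∷ uV

∈-insert⁻ : ∀ (x : Vec ℤ d) V {z} → z ∈ insert x V → z ≡ x ⊎ z ∈ V
∈-insert⁻ x V z∈ with _∈?_ _≟ᵛ_ x V
∈-insert⁻ x V z∈         | yes _ = inj₂ z∈
∈-insert⁻ x V (here z≡x) | no _  = inj₁ z≡x
∈-insert⁻ x V (there z∈) | no _  = inj₂ z∈

∈-insert-self : ∀ (x : Vec ℤ d) V → x ∈ insert x V
∈-insert-self x V with _∈?_ _≟ᵛ_ x V
... | yes x∈V = x∈V
... | no  _   = here refl

∈-insert⁺ : ∀ (x : Vec ℤ d) V → V ⊆ insert x V
∈-insert⁺ x V z∈ with _∈?_ _≟ᵛ_ x V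
... | yes _ = z∈
... | no  _ = there z∈

length-insert : ∀ (x : Vec ℤ d) V → length (insert x V) ≤ suc (length V)
length-insert x V with _∈?_ _≟ᵛ_ x V
... | yes _ = n≤1+n _
... | no  _ = ≤-refl

infixr 5 _∪_

-- The left list may contain repetitions, as orbits do; the result is duplicate-free as soon as V
-- is.
_∪_ : List (Vec ℤ d) → List (Vec ℤ d) → List (Vec ℤ d)
X ∪ V = foldr insert V X

∪-unique : ∀ (X : List (Vec ℤ d)) {V} → Unique V → Unique (X ∪ V)
∪-unique []      uV = uV
∪-unique (x ∷ X) uV = insert-unique x (∪-unique X uV)

∈-∪⁻ : ∀ (X V : List (Vec ℤ d)) {z} → z ∈ X ∪ V → z ∈ X ⊎ z ∈ V
∈-∪⁻ []      V z∈ = inj₂ z∈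
∈-∪⁻ (x ∷ X) V z∈ with ∈-insert⁻ x (X ∪ V) z∈
... | inj₁ z≡x = inj₁ (here z≡x)
... | inj₂ z∈′ with ∈-∪⁻ X V z∈′
...   | inj₁ z∈X = inj₁ (there z∈X)
...   | inj₂ z∈V = inj₂ z∈V

∪⁺ʳ : ∀ (X V : List (Vec ℤ d)) → V ⊆ X ∪ V
∪⁺ʳ []      V z∈ = z∈
∪⁺ʳ (x ∷ X) V z∈ = ∈-insert⁺ x (X ∪ V) (∪⁺ʳ X V z∈)

∪⁺ˡ : ∀ (X V : List (Vec ℤ d)) → X ⊆ X ∪ V
∪⁺ˡ (x ∷ X) V (here refl) = ∈-insert-self x (X ∪ V)
∪⁺ˡ (x ∷ X) V (there z∈)  = ∈-insert⁺ x (X ∪ V) (∪⁺ˡ X V z∈)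

length-∪ : ∀ (X V : List (Vec ℤ d)) → length (X ∪ V) ≤ length X + length V
length-∪ []      V = ≤-refl
length-∪ (x ∷ X) V = ≤-trans (length-insert x (X ∪ V)) (s≤s (length-∪ X V))

-- Points of a given norm

OnShell : ∀ d → ℕ → Vec ℤ d → Set
OnShell d p x = ‖ x ‖₁ ≡ p × ℙ∘ d x

shell : ∀ d → ℕ → List (Vec ℤ d)
shell d p = filter (λ x → ‖ x ‖₁ ≟ p) (ball d p)

shell-unique : ∀ d p → Unique (shell d p)
shell-unique d p = Unique.filter⁺ (λ x → ‖ x ‖₁ ≟ p) (ball-unique d p)

∈-shell⁺ : ∀ {x : Vec ℤ d} → OnShell d p x → x ∈ shell d p
∈-shell⁺ (norm , h) = ∈-filter⁺ _ (Equivalence.from ∈-ball (≤-reflexive norm , h)) norm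

∈-shell⁻ : ∀ {x : Vec ℤ d} → x ∈ shell d p → OnShell d p x
∈-shell⁻ {d = d} {p} {x} x∈ with ∈-filter⁻ (λ y → ‖ y ‖₁ ≟ p) {xs = ball d p} x∈
... | x∈ball , norm = norm , proj₂ (Equivalence.to (∈-ball {p = p}) x∈ball)

∈-ball⁻ : ∀ {x : Vec ℤ d} → x ∈ ball d p → InBall d p x
∈-ball⁻ = Equivalence.to ∈-ball

∈-ball⁺ : ∀ {x : Vec ℤ d} → InBall d p x → x ∈ ball d p
∈-ball⁺ = Equivalence.from ∈-ball

-- The average coordinate sum of n points of norm p is n p / d.
Spread : List (Vec ℤ d) → (p e n : ℕ) → Set
Spread {d} S p e n = ∃[ Y ] Unique Y × Y ⊆ S × length Y ≡ n ×
  (∀ i → d * coordinateSum Y i ≤ n * p + e)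

module _ {d : ℕ} .{{_ : NonZero d}} where

  ρ-OnShell : ∀ x → OnShell d p x → OnShell d p (ρ x)
  ρ-OnShell x (norm , h) = trans (‖ρ‖₁ x) norm , ρ-ℙ∘ x h

  ρ^-OnShell : ∀ c x → OnShell d p x → OnShell d p (ρ^ c x)
  ρ^-OnShell zero    x h = h
  ρ^-OnShell (suc c) x h = ρ-OnShell (ρ^ c x) (ρ^-OnShell c x h)

  ρ^-Closed : ∀ {V} → Closed V → ∀ c {x} → x ∈ V → ρ^ c x ∈ V
  ρ^-Closed cV zero    x∈ = x∈
  ρ^-Closed cV (suc c) x∈ = cV (ρ^-Closed cV c x∈)

  -- If x has a rotational symmetry up to sign, this list repeats points, so d is only an upper
  -- bound for the size of the orbit.
  orbit : Vec ℤ d → List (Vec ℤ d)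
  orbit x = map (λ c → ρ^ c x) (upTo d)

  self∈orbit : ∀ x → x ∈ orbit x
  self∈orbit x = ∈-map⁺ (λ c → ρ^ c x) (∈-upTo⁺ (>-nonZero⁻¹ d))

  ∈-orbit⁻ : ∀ {x z} → z ∈ orbit x → ∃[ c ] z ≡ ρ^ c x
  ∈-orbit⁻ {x} z∈ with ∈-map⁻ (λ c → ρ^ c x) z∈
  ... | c , _ , eq = c , eq

  orbit-closed : ∀ {x} → ℙ∘ d x → Closed (orbit x)
  orbit-closed {x} h z∈ with ∈-map⁻ (λ c → ρ^ c x) z∈
  ... | c , c∈ , refl with suc c ≟ d
  ...   | yes refl = subst (_∈ orbit x) (sym (ρ^-period x h)) (self∈orbit x)
  ...   | no 1+c≢d = ∈-map⁺ (λ c → ρ^ c x) (∈-upTo⁺ (≤∧≢⇒< (∈-upTo⁻ c∈) 1+c≢d))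

  length-orbit : ∀ x → length (orbit x) ≡ d
  length-orbit x = trans (length-map _ (upTo d)) (length-upTo d)

  ∪-closed : ∀ X V → Closed X → Closed V → Closed (X ∪ V)
  ∪-closed X V cX cV z∈ with ∈-∪⁻ X V z∈
  ... | inj₁ z∈X = ∪⁺ˡ X V (cX z∈X)
  ... | inj₂ z∈V = ∪⁺ʳ X V (cV z∈V)

  closure : List (Vec ℤ d) → List (Vec ℤ d)
  closure []      = []
  closure (x ∷ X) = orbit x ∪ closure X

  closure-unique : ∀ X → Unique (closure X)
  closure-unique []      = []
  closure-unique (x ∷ X) = ∪-unique (orbit x) (closure-unique X)

  closure-closed : ∀ X → (∀ {x} → x ∈ X → ℙ∘ d x) → Closed (closure X)
  closure-closed []      h ()
  closure-closed (x ∷ X) h = ∪-closed (orbit x) (closure X) (orbit-closed (h (here refl)))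
    (closure-closed X (h ∘ there))

  ⊆-closure : ∀ X → X ⊆ closure X
  ⊆-closure (x ∷ X) (here refl) = ∪⁺ˡ (orbit x) (closure X) (self∈orbit x)
  ⊆-closure (x ∷ X) (there z∈)  = ∪⁺ʳ (orbit x) (closure X) (⊆-closure X z∈)

  closure-OnShell : ∀ X → (∀ {x} → x ∈ X → OnShell d p x) → closure X ⊆ shell d p
  closure-OnShell (x ∷ X) h z∈ with ∈-∪⁻ (orbit x) (closure X) z∈
  ... | inj₂ z∈X = closure-OnShell X (h ∘ there) z∈X
  ... | inj₁ z∈x with c , refl ← ∈-orbit⁻ z∈x = ∈-shell⁺ (ρ^-OnShell c x (h (here refl)))

  length-closure : ∀ X → length (closure X) ≤ length X * d
  length-closure []      = z≤n
  length-closure (x ∷ X) = ≤-trans (length-∪ (orbit x) (closure X))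
    (+-mono-≤ (≤-reflexive (length-orbit x)) (length-closure X))

  closed-Spread : ∀ {V} → Unique V → (∀ {x} → x ∈ V → OnShell d p x) → Closed V →
    ∀ i → d * coordinateSum V i ≡ length V * p
  closed-Spread {p} {V} uV sV cV i = begin
    d * coordinateSum V i         ≡⟨ closed-balanced uV (proj₂ ∘ sV) cV i ⟩
    sum (map ‖_‖₁ V)              ≡⟨ sum-map-cong {X = V} (proj₁ ∘ sV) ⟩
    sum (map (λ _ → p) V)         ≡⟨ sum-map-const p V ⟩
    length V * p                  ∎
    where open ≡-Reasoning

  -- Since orbits have at most d points, greedily collecting orbits misses a
  -- prescribed cardinality by less than d.
  closed-subset : ∀ {U} → Unique U → (∀ {x} → x ∈ U → ℙ∘ d x) → Closed U → ∀ n →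
    ∃[ V ] Unique V × V ⊆ U × Closed V × length V ≤ n × (n < length V + d ⊎ length U ≤ length V)
  closed-subset {U} uU hU cU n = grow n [] [] (λ ()) (λ ()) z≤n (≤-reflexive (sym (+-identityʳ n)))
    where
    -- Fuel cannot run out early: each round adds at least one point, and n ≤ `fuel + length V`
    -- without fuel means that V already has n points.
    grow : ∀ fuel V → Unique V → V ⊆ U → Closed V → length V ≤ n → n ≤ fuel + length V →
      ∃[ V ] Unique V × V ⊆ U × Closed V × length V ≤ n × (n < length V + d ⊎ length U ≤ length V)
    grow fuel V uV V⊆U cV V≤n n≤ with n <? length V + d | length U ≤? length V
    ... | yes n< | _      = V , uV , V⊆U , cV , V≤n , inj₁ n<
    ... | no  _  | yes U≤ = V , uV , V⊆U , cV , V≤n , inj₂ U≤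
    grow zero    V uV V⊆U cV V≤n n≤ | no n≮ | no _ =
      contradiction (≤-trans (s≤s n≤) (m<m+n (length V) (>-nonZero⁻¹ d))) n≮
    grow (suc fuel) V uV V⊆U cV V≤n n≤ | no n≮ | no U≰V with exists∉ _≟ᵛ_ uU (≰⇒> U≰V)
    -- Stopping was refused, so `length V + d` ≤ n and a whole orbit still fits.
    ... | x , x∈U , x∉V = grow fuel (orbit x ∪ V) (∪-unique (orbit x) uV) sub
      (∪-closed (orbit x) V (orbit-closed (hU x∈U)) cV)
      (≤-trans (length-∪ (orbit x) V) (≤-trans
        (≤-reflexive (trans (cong (_+ length V) (length-orbit x)) (+-comm d (length V))))
        (≮⇒≥ n≮)))
      (≤-trans n≤ (≤-trans (≤-reflexive (sym (+-suc fuel _))) (+-monoʳ-≤ fuel bigger)))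
      where
      sub : orbit x ∪ V ⊆ U
      sub z∈ with ∈-∪⁻ (orbit x) V z∈
      ... | inj₂ z∈V = V⊆U z∈V
      ... | inj₁ z∈x with c , refl ← ∈-orbit⁻ z∈x = ρ^-Closed cU c x∈U
      bigger : suc (length V) ≤ length (orbit x ∪ V)
      bigger = length-⊆ {X = x ∷ V} {Y = orbit x ∪ V}
        (All.tabulate (λ y∈V x≡y → x∉V (subst (_∈ V) (sym x≡y) y∈V)) ∷ uV)
        λ { (here refl) → ∪⁺ˡ (orbit x) V (self∈orbit x) ; (there z∈V) → ∪⁺ʳ (orbit x) V z∈V }

  module Reserve {p : ℕ} {R : List (Vec ℤ d)} (uR : Unique R) (R⊆S : R ⊆ shell d p) (cR : Closed R) where

    rest : List (Vec ℤ d)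
    rest = filter (λ x → ¬? (_∈?_ _≟ᵛ_ x R)) (shell d p)

    rest⁻ : ∀ {x} → x ∈ rest → x ∈ shell d p × x ∉ R
    rest⁻ = ∈-filter⁻ (λ x → ¬? (_∈?_ _≟ᵛ_ x R)) {xs = shell d p}

    rest⁺ : ∀ {x} → x ∈ shell d p → x ∉ R → x ∈ rest
    rest⁺ = ∈-filter⁺ (λ x → ¬? (_∈?_ _≟ᵛ_ x R))

    -- If `ρ x` were in R, going on around the orbit would bring x itself into R.
    rest-closed : Closed rest
    rest-closed {x} x∈ with rest⁻ x∈
    ... | x∈S , x∉R = rest⁺ (∈-shell⁺ (ρ-OnShell x (∈-shell⁻ x∈S))) λ ρx∈R →
      x∉R (subst (_∈ R) (ρ^-unroll x (proj₂ (∈-shell⁻ {p = p} x∈S))) (ρ^-Closed cR (d ∸ 1) ρx∈R))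

    shell≤rest+R : length (shell d p) ≤ length rest + length R
    shell≤rest+R = ≤-trans (length-⊆ {Y = rest ++ R} (shell-unique d p) sub) (≤-reflexive (length-++ rest))
      where
      sub : shell d p ⊆ rest ++ R
      sub {x} x∈ with _∈?_ _≟ᵛ_ x R
      ... | yes x∈R = ∈-++⁺ʳ rest x∈R
      ... | no  x∉R = ∈-++⁺ˡ (rest⁺ x∈ x∉R)

    -- Orbits outside R meet the average exactly, so the whole error comes from the r points left to
    -- R. Aiming at n - c points by orbits ensures r ≥ c, for reserves that cannot supply very few
    -- points in balance. The second alternative for r arises when `rest` is used up.
    spread : ∀ c {n} → c ≤ n →
      (∀ r → c ≤ r → r < c + d ⊎ length rest + r ≡ n → Spread R p e r) →
      Spread (shell d p) p e n
    spread {e} c {n} c≤n fill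
      with closed-subset (Unique.filter⁺ _ (shell-unique d p)) (λ x∈ → proj₂ (∈-shell⁻ {p = p} (proj₁ (rest⁻ x∈))))
             rest-closed (n ∸ c)
    ... | V , uV , V⊆rest , cV , V≤n-c , near = combine (fill r c≤r bound)
      where
      v = length V
      r = n ∸ v
      v+c≤n : v + c ≤ n
      v+c≤n = ≤-trans (+-monoˡ-≤ c V≤n-c) (≤-reflexive (m∸n+n≡m c≤n))
      v≤n : v ≤ n
      v≤n = ≤-trans (m≤m+n v c) v+c≤n
      c≤r : c ≤ r
      c≤r = m+n≤o⇒m≤o∸n c (≤-trans (≤-reflexive (+-comm c v)) v+c≤n)
      v+r≡n : v + r ≡ n
      v+r≡n = m+[n∸m]≡n v≤n
      bound : r < c + d ⊎ length rest + r ≡ n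
      bound = Sum.map (λ lt → +-cancelˡ-< v r (c + d) (begin-strict
        v + r              ≡⟨ v+r≡n ⟩
        n                  ≡⟨ m∸n+n≡m c≤n ⟨
        n ∸ c + c          <⟨ +-monoˡ-< c lt ⟩
        v + d + c          ≡⟨ +-assoc v d c ⟩
        v + (d + c)        ≡⟨ cong (_+_ v) (+-comm d c) ⟩
        v + (c + d)        ∎))
        (λ le → trans (cong (_+ r) (≤-antisym le (length-⊆ uV V⊆rest))) v+r≡n) near
        where open ≤-Reasoning
      combine : Spread R p e r → Spread (shell d p) p e n
      combine (Q , uQ , Q⊆R , |Q|≡r , balQ) =
        V ++ Q , unique-++ uV uQ (λ x∈V x∈Q → proj₂ (rest⁻ (V⊆rest x∈V)) (Q⊆R x∈Q)) , sub ,
        trans (length-++ V) (trans (cong (_+_ v) |Q|≡r) v+r≡n) , bal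
        where
        sub : V ++ Q ⊆ shell d p
        sub x∈ with ∈-++⁻ V x∈
        ... | inj₁ x∈V = proj₁ (rest⁻ (V⊆rest x∈V))
        ... | inj₂ x∈Q = R⊆S (Q⊆R x∈Q)
        bal : ∀ i → d * coordinateSum (V ++ Q) i ≤ n * p + e
        bal i = begin
          d * coordinateSum (V ++ Q) i                         ≡⟨ cong (_*_ d) (sum-map-++ (λ x → ∣ lookup x i ∣) V Q) ⟩
          d * (coordinateSum V i + coordinateSum Q i)          ≡⟨ *-distribˡ-+ d (coordinateSum V i) _ ⟩
          d * coordinateSum V i + d * coordinateSum Q i        ≤⟨ +-mono-≤ (≤-reflexive (closed-Spread {p} uV (λ x∈ → ∈-shell⁻ (proj₁ (rest⁻ (V⊆rest x∈)))) cV i)) (balQ i) ⟩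
          v * p + (r * p + e)                                  ≡⟨ +-assoc (v * p) (r * p) e ⟨
          v * p + r * p + e                                    ≡⟨ cong (_+ e) (*-distribʳ-+ p v r) ⟨
          (v + r) * p + e                                      ≡⟨ cong (λ z → z * p + e) v+r≡n ⟩
          n * p + e                                            ∎
          where open ≤-Reasoning

-- Bounds for δ

module Bounds (d : ℕ) .{{_ : NonZero d}} where

  ball-closed : ∀ p → Closed (ball d p)
  ball-closed p {x} x∈ with ∈-ball⁻ x∈
  ... | norm , h = ∈-ball⁺ (≤-trans (≤-reflexive (‖ρ‖₁ x)) norm , ρ-ℙ∘ x h)

  ball-balanced : ∀ p i → d * coordinateSum (ball d p) i ≡ sum (map ‖_‖₁ (ball d p))
  ball-balanced p = closed-balanced (ball-unique d p) (λ x∈ → proj₂ (∈-ball⁻ {p = p} x∈)) (ball-closed p)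

  coordinateSum-ball : ∀ p i → coordinateSum (ball d p) i ≡ κ[ d , p ]
  coordinateSum-ball p i = ≤-antisym (coordinateSum≤κ (ball d p) i) (κ-least (ball d p) λ j →
    ≤-reflexive (*-cancelˡ-≡ _ _ d (trans (ball-balanced p j) (sym (ball-balanced p i)))))

  κ-ball : ∀ p → d * κ[ d , p ] ≡ sum (map ‖_‖₁ (ball d p))
  κ-ball p = trans (cong (_*_ d) (sym (coordinateSum-ball p (0 mod d)))) (ball-balanced p _)

  κ-ball-0 : κ[ d , 0 ] ≡ 0
  κ-ball-0 = [ (λ d≡0 → contradiction d≡0 (≢-nonZero⁻¹ d)) , id ]′ (m*n≡0⇒m≡0∨n≡0 d (n≤0⇒n≡0 (begin
    d * κ[ d , 0 ]                        ≡⟨ κ-ball 0 ⟩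
    sum (map ‖_‖₁ (ball d 0))             ≤⟨ sum-map-mono {X = ball d 0} (λ x∈ → proj₁ (∈-ball⁻ x∈)) ⟩
    sum (map (λ _ → 0) (ball d 0))        ≡⟨ sum-map-const 0 (ball d 0) ⟩
    length (ball d 0) * 0                 ≡⟨ *-zeroʳ (length (ball d 0)) ⟩
    0                                     ∎)))
    where open ≤-Reasoning

  κ-ball-mono : ∀ {p p′} → p ≤ p′ → κ[ d , p ] ≤ κ[ d , p′ ]
  κ-ball-mono {p} {p′} p≤p′ = κ-least (ball d p) λ i → ≤-trans
    (sum-map-⊆ (λ x → ∣ lookup x i ∣) (ball-unique d p) λ x∈ _ → ball-mono x∈)
    (coordinateSum≤κ (ball d p′) i)
    where
    ball-mono : ball d p ⊆ ball d p′
    ball-mono x∈ with ∈-ball⁻ x∈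
    ... | norm , h = ∈-ball⁺ (≤-trans norm p≤p′ , h)

  -- Points of norm above P have deficit zero, so X has at most the deficit of the whole ball; on
  -- the ball, deficit and norm add up to P + 1.
  sum-deficit : ∀ P {X : List (Vec ℤ d)} → Unique X → (∀ {x} → x ∈ X → ℙ∘ d x) →
    sum (map (λ x → suc P ∸ ‖ x ‖₁) X) + d * κ[ d , P ] ≤ N d P * suc P
  sum-deficit P {X} uX hX = begin
    sum (map deficit X) + d * κ[ d , P ]                         ≤⟨ +-monoˡ-≤ (d * κ[ d , P ]) (sum-map-⊆ deficit uX short∈ball) ⟩
    sum (map deficit (ball d P)) + d * κ[ d , P ]                ≡⟨ cong (_+_ (sum (map deficit (ball d P)))) (κ-ball P) ⟩
    sum (map deficit (ball d P)) + sum (map ‖_‖₁ (ball d P))     ≡⟨ sum-map-+ deficit ‖_‖₁ (ball d P) ⟨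
    sum (map (λ x → deficit x + ‖ x ‖₁) (ball d P))              ≡⟨ sum-map-cong {X = ball d P} (λ x∈ → m∸n+n≡m (m≤n⇒m≤1+n (proj₁ (∈-ball⁻ x∈)))) ⟩
    sum (map (λ _ → suc P) (ball d P))                           ≡⟨ sum-map-const (suc P) (ball d P) ⟩
    N d P * suc P                                                ∎
    where
    open ≤-Reasoning
    deficit : Vec ℤ d → ℕ
    deficit x = suc P ∸ ‖ x ‖₁
    short∈ball : ∀ {x} → x ∈ X → 0 < deficit x → x ∈ ball d P
    short∈ball {x} x∈ pos = ∈-ball⁺ (s≤s⁻¹ (m∸n≢0⇒n<m λ eq → <⇒≢ pos (sym eq)) , hX x∈)

  sum-norm+deficit : ∀ P (X : List (Vec ℤ d)) →
    length X * suc P ≤ sum (map ‖_‖₁ X) + sum (map (λ x → suc P ∸ ‖ x ‖₁) X)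
  sum-norm+deficit P X = begin
    length X * suc P                                              ≡⟨ sum-map-const (suc P) X ⟨
    sum (map (λ _ → suc P) X)                                     ≤⟨ sum-map-mono {X = X} (λ {x} _ → m≤n+m∸n (suc P) ‖ x ‖₁) ⟩
    sum (map (λ x → ‖ x ‖₁ + (suc P ∸ ‖ x ‖₁)) X)                 ≡⟨ sum-map-+ ‖_‖₁ _ X ⟩
    sum (map ‖_‖₁ X) + sum (map (λ x → suc P ∸ ‖ x ‖₁) X)         ∎
    where open ≤-Reasoning

  -- A duality argument: every point counts as P + 1 ≤ norm + deficit, where the norms are bounded
  -- through κ and the deficits by those of the ball.
  length-bound : ∀ P {X : List (Vec ℤ d)} → Unique X → (∀ {x} → x ∈ X → ℙ∘ d x) →
    length X * suc P + d * κ[ d , P ] ≤ d * κ X + N d P * suc P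
  length-bound P {X} uX hX = begin
    length X * suc P + d * κ[ d , P ]                ≤⟨ +-monoˡ-≤ (d * κ[ d , P ]) (sum-norm+deficit P X) ⟩
    sum (map ‖_‖₁ X) + D + d * κ[ d , P ]            ≡⟨ +-assoc (sum (map ‖_‖₁ X)) D _ ⟩
    sum (map ‖_‖₁ X) + (D + d * κ[ d , P ])          ≤⟨ +-mono-≤ (∑‖‖₁≤d*κ X) (sum-deficit P uX hX) ⟩
    d * κ X + N d P * suc P                          ∎
    where
    open ≤-Reasoning
    D = sum (map (λ x → suc P ∸ ‖ x ‖₁) X)

  δ-upper : ∀ P m → δz d (κ[ d , P ] + m) ≤ N d P + (d * m) / suc P
  δ-upper P m with proj₂ (δz-exists d (κ[ d , P ] + m))
  ... | (X , uX , hX , κX≤ , |X|≡δ) , _ = subst (_≤ N d P + (d * m) / suc P) |X|≡δ (begin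
    length X                                 ≤⟨ m≤n+m∸n (length X) (N d P) ⟩
    N d P + (length X ∸ N d P)               ≡⟨ cong (_+_ (N d P)) (m*n/n≡m (length X ∸ N d P) (suc P)) ⟨
    N d P + (length X ∸ N d P) * suc P / suc P ≤⟨ +-monoʳ-≤ (N d P) (/-monoˡ-≤ (suc P) bound) ⟩
    N d P + (d * m) / suc P                  ∎)
    where
    open ≤-Reasoning
    total : length X * suc P ≤ d * m + N d P * suc P
    total = +-cancelʳ-≤ (d * κ[ d , P ]) _ _ (begin
      length X * suc P + d * κ[ d , P ]           ≤⟨ length-bound P uX (All.lookup hX) ⟩
      d * κ X + N d P * suc P                     ≤⟨ +-monoˡ-≤ (N d P * suc P) (*-monoʳ-≤ d κX≤) ⟩
      d * (κ[ d , P ] + m) + N d P * suc P        ≡⟨ expand d κ[ d , P ] m (N d P * suc P) ⟩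
      d * m + N d P * suc P + d * κ[ d , P ]      ∎)
      where
      expand : ∀ d a m c → d * (a + m) + c ≡ d * m + c + d * a
      expand = solve-∀
    bound : (length X ∸ N d P) * suc P ≤ d * m
    bound = begin
      (length X ∸ N d P) * suc P              ≡⟨ *-distribʳ-∸ (suc P) (length X) (N d P) ⟩
      length X * suc P ∸ N d P * suc P        ≤⟨ ∸-monoˡ-≤ (N d P * suc P) total ⟩
      d * m + N d P * suc P ∸ N d P * suc P   ≡⟨ m+n∸n≡m (d * m) (N d P * suc P) ⟩
      d * m                                   ∎

  δ-lower : ∀ P {Y : List (Vec ℤ d)} → Unique Y → Y ⊆ shell d (suc P) →
    (∀ i → coordinateSum Y i ≤ m) → N d P + length Y ≤ δz d (κ[ d , P ] + m)
  δ-lower {m} P {Y} uY Y⊆S small = proj₂ (proj₂ (δz-exists d (κ[ d , P ] + m))) _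
    ( ball d P ++ Y
    , unique-++ (ball-unique d P) uY (λ x∈B x∈Y → <-irrefl
        (proj₁ (∈-shell⁻ (Y⊆S x∈Y))) (s≤s (proj₁ (∈-ball⁻ x∈B))))
    , All.++⁺ (All.tabulate λ x∈ → proj₂ (∈-ball⁻ {p = P} x∈)) (All.tabulate λ x∈ → proj₂ (∈-shell⁻ {p = suc P} (Y⊆S x∈)))
    , κ-least (ball d P ++ Y) (λ i → ≤-trans
        (≤-reflexive (sum-map-++ (λ x → ∣ lookup x i ∣) (ball d P) Y))
        (+-mono-≤ (coordinateSum≤κ (ball d P) i) (small i)))
    , length-++ (ball d P))

  δ-lower-0 : ∀ P m → N d P ≤ δz d (κ[ d , P ] + m)
  δ-lower-0 P m = subst (_≤ δz d (κ[ d , P ] + m)) (+-identityʳ (N d P))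
    (δ-lower P [] (λ ()) λ _ → z≤n)

  -- Coordinate sums are integers, so it suffices that they are below m + 1. After multiplication by
  -- d this rounding gains d - 1.
  δ-lower-Spread : ∀ P m → Spread (shell d (suc P)) (suc P) e n → n * suc P + e < d * suc m →
    N d P + n ≤ δz d (κ[ d , P ] + m)
  δ-lower-Spread {e} {n} P m (Y , uY , Y⊆S , |Y|≡n , bal) lt =
    subst (λ l → N d P + l ≤ δz d (κ[ d , P ] + m)) |Y|≡n
      (δ-lower P uY Y⊆S λ i → s≤s⁻¹ (*-cancelˡ-< d _ _ (≤-<-trans (bal i) lt)))

  κ-step-≤ : ∀ P → d * κ[ d , suc P ] ≤ d * κ[ d , P ] + length (shell d (suc P)) * suc P
  κ-step-≤ P = begin
    d * κ[ d , suc P ]                                          ≡⟨ κ-ball (suc P) ⟩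
    sum (map ‖_‖₁ (ball d (suc P)))                             ≤⟨ sum-map-⊆ ‖_‖₁ (ball-unique d (suc P)) (λ x∈ _ → split x∈) ⟩
    sum (map ‖_‖₁ (ball d P ++ shell d (suc P)))                ≡⟨ sum-map-++ ‖_‖₁ (ball d P) _ ⟩
    sum (map ‖_‖₁ (ball d P)) + sum (map ‖_‖₁ (shell d (suc P))) ≡⟨ cong₂ _+_ (κ-ball P) (trans (sym (sum-map-const (suc P) (shell d (suc P)))) (sym (sum-map-cong {X = shell d (suc P)} (proj₁ ∘ ∈-shell⁻)))) ⟨
    d * κ[ d , P ] + length (shell d (suc P)) * suc P           ∎
    where
    open ≤-Reasoning
    split : ball d (suc P) ⊆ ball d P ++ shell d (suc P)
    split {x} x∈ with ∈-ball⁻ x∈ | ‖ x ‖₁ ≟ suc P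
    ... | _    , h | yes eq = ∈-++⁺ʳ (ball d P) (∈-shell⁺ (eq , h))
    ... | norm , h | no neq = ∈-++⁺ˡ (∈-ball⁺ (s≤s⁻¹ (≤∧≢⇒< norm neq) , h))

  κ-step-≥ : ∀ P {R : List (Vec ℤ d)} → Unique R → R ⊆ shell d (suc P) →
    d * κ[ d , P ] + length R * suc P ≤ d * κ[ d , suc P ]
  κ-step-≥ P {R} uR R⊆S = begin
    d * κ[ d , P ] + length R * suc P                  ≡⟨ cong₂ _+_ (κ-ball P) (trans (sym (sum-map-const (suc P) R)) (sym (sum-map-cong {X = R} (λ x∈ → proj₁ (∈-shell⁻ (R⊆S x∈)))))) ⟩
    sum (map ‖_‖₁ (ball d P)) + sum (map ‖_‖₁ R)       ≡⟨ sum-map-++ ‖_‖₁ (ball d P) R ⟨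
    sum (map ‖_‖₁ (ball d P ++ R))                     ≤⟨ sum-map-⊆ ‖_‖₁ (unique-++ (ball-unique d P) uR λ x∈B x∈R →
                                                            <-irrefl (proj₁ (∈-shell⁻ (R⊆S x∈R))) (s≤s (proj₁ (∈-ball⁻ x∈B))))
                                                            (λ x∈ _ → sub x∈) ⟩
    sum (map ‖_‖₁ (ball d (suc P)))                    ≡⟨ κ-ball (suc P) ⟨
    d * κ[ d , suc P ]                                 ∎
    where
    open ≤-Reasoning
    sub : ball d P ++ R ⊆ ball d (suc P)
    sub x∈ with ∈-++⁻ (ball d P) x∈
    ... | inj₂ x∈R with norm , h ← ∈-shell⁻ {p = suc P} (R⊆S x∈R) = ∈-ball⁺ (≤-reflexive norm , h)
    ... | inj₁ x∈B with norm , h ← ∈-ball⁻ {p = P} x∈B = ∈-ball⁺ (m≤n⇒m≤1+n norm , h)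

  -- Equality in length-bound leaves only the whole ball and one further point of
  -- norm d (q + 2) with coordinates at most q + 2, hence all equal to q + 2.
  δ≢-divisible : ∀ P q → suc P ≡ d * suc (suc q) →
    δz d (κ[ d , P ] + suc (suc q)) ≢ N d P + 1
  δ≢-divisible P q p≡ δ≡ with proj₂ (δz-exists d (κ[ d , P ] + suc (suc q)))
  ... | (X , uX , hX , κX≤ , |X|≡δ) , _ = x-imprimitive
    where
    open ≤-Reasoning
    |X|≡ : length X ≡ N d P + 1
    |X|≡ = trans |X|≡δ δ≡
    deficit : Vec ℤ d → ℕ
    deficit x = suc P ∸ ‖ x ‖₁
    D = sum (map deficit X)
    total : sum (map ‖_‖₁ X) ≤ d * κ[ d , P ] + suc P
    total = begin
      sum (map ‖_‖₁ X)                           ≤⟨ ∑‖‖₁≤d*κ X ⟩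
      d * κ X                                    ≤⟨ *-monoʳ-≤ d κX≤ ⟩
      d * (κ[ d , P ] + suc (suc q))             ≡⟨ *-distribˡ-+ d κ[ d , P ] _ ⟩
      d * κ[ d , P ] + d * suc (suc q)           ≡⟨ cong (_+_ (d * κ[ d , P ])) p≡ ⟨
      d * κ[ d , P ] + suc P                     ∎
    -- With N + 1 points in X the general bound is attained, so X must carry the full deficit of the
    -- ball.
    tight : N d P * suc P ≤ D + d * κ[ d , P ]
    tight = +-cancelʳ-≤ (suc P) _ _ (begin
      N d P * suc P + suc P                      ≡⟨ expand (N d P) (suc P) ⟩
      (N d P + 1) * suc P                        ≡⟨ cong (_* suc P) |X|≡ ⟨
      length X * suc P                           ≤⟨ sum-norm+deficit P X ⟩
      sum (map ‖_‖₁ X) + D                       ≤⟨ +-monoˡ-≤ D total ⟩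
      d * κ[ d , P ] + suc P + D                 ≡⟨ swap (d * κ[ d , P ]) (suc P) D ⟩
      D + d * κ[ d , P ] + suc P                 ∎)
      where
      expand : ∀ a b → a * b + b ≡ (a + 1) * b
      expand = solve-∀
      swap : ∀ a b c → a + b + c ≡ c + a + b
      swap = solve-∀
    -- A missing point of the ball has positive deficit; adding it to X would violate `sum-deficit`.
    ball⊆X : ball d P ⊆ X
    ball⊆X {y} y∈B with _∈?_ _≟ᵛ_ y X
    ... | yes y∈X = y∈X
    ... | no  y∉X with norm , h ← ∈-ball⁻ y∈B = contradiction (begin-strict
      N d P * suc P                              ≤⟨ tight ⟩
      D + d * κ[ d , P ]                         <⟨ +-monoˡ-< (d * κ[ d , P ]) (m<n+m D (m<n⇒0<n∸m (s≤s norm))) ⟩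
      deficit y + D + d * κ[ d , P ]             ≤⟨ sum-deficit P {y ∷ X} (All.tabulate (λ z∈X y≡z → y∉X (subst (_∈ X) (sym y≡z) z∈X)) ∷ uX)
                                                    (λ { (here refl) → h ; (there z∈) → All.lookup hX z∈ }) ⟩
      N d P * suc P                              ∎) (<-irrefl refl)
    extra : ∃[ x ] x ∈ X × x ∉ ball d P
    extra = exists∉ _≟ᵛ_ uX (≤-reflexive (trans (+-comm 1 (N d P)) (sym |X|≡)))
    x = proj₁ extra
    x∈X = proj₁ (proj₂ extra)
    x∉B = proj₂ (proj₂ extra)
    coordinate≤ : ∀ i → ∣ lookup x i ∣ ≤ suc (suc q)
    coordinate≤ i = +-cancelʳ-≤ κ[ d , P ] _ _ (begin
      ∣ lookup x i ∣ + κ[ d , P ]                          ≡⟨ cong (_+_ ∣ lookup x i ∣) (coordinateSum-ball P i) ⟨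
      sum (map (λ z → ∣ lookup z i ∣) (x ∷ ball d P))      ≤⟨ sum-map-⊆ (λ z → ∣ lookup z i ∣) {Y = X}
        (All.tabulate (λ z∈B x≡z → x∉B (subst (_∈ ball d P) (sym x≡z) z∈B)) ∷ ball-unique d P)
        (λ { (here refl) _ → x∈X ; (there z∈B) _ → ball⊆X z∈B }) ⟩
      coordinateSum X i                                    ≤⟨ coordinateSum≤κ X i ⟩
      κ X                                                  ≤⟨ κX≤ ⟩
      κ[ d , P ] + suc (suc q)                             ≡⟨ +-comm κ[ d , P ] _ ⟩
      suc (suc q) + κ[ d , P ]                             ∎)
    norm≥ : d * suc (suc q) ≤ ‖ x ‖₁
    norm≥ = subst (_≤ ‖ x ‖₁) p≡ (≰⇒> λ norm → x∉B (∈-ball⁺ (norm , All.lookup hX x∈X)))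
    coordinate≡ : ∀ i → ∣ lookup x i ∣ ≡ suc (suc q)
    coordinate≡ = ∑-squeeze (λ i → ∣ lookup x i ∣) (suc (suc q)) coordinate≤
      (≤-trans norm≥ (≤-reflexive (‖‖₁-∑ x)))
    x-imprimitive : ⊥
    x-imprimitive with ∣1⇒≡1 (subst (suc (suc q) ∣_) (proj₁ (All.lookup hX x∈X))
      (content-greatest x λ i → ∣-reflexive (sym (coordinate≡ i))))
    ... | ()

-- Reserved points close to the diagonal

sum-upTo-suc : ∀ (f : ℕ → ℕ) r → sum (map f (upTo (suc r))) ≡ sum (map f (upTo r)) + f r
sum-upTo-suc f r = begin
  sum (map f (upTo (suc r)))          ≡⟨ cong (sum ∘ map f) (upTo-∷ʳ r) ⟨
  sum (map f (upTo r ∷ʳ r))           ≡⟨ sum-map-++ f (upTo r) [ r ] ⟩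
  sum (map f (upTo r)) + (f r + 0)    ≡⟨ cong (_+_ (sum (map f (upTo r)))) (+-identityʳ (f r)) ⟩
  sum (map f (upTo r)) + f r          ∎
  where open ≡-Reasoning

∑-toℕ : ∀ (f : ℕ → ℕ) d → ∑ {d} (f ∘ toℕ) ≡ sum (map f (upTo d))
∑-toℕ f d = trans (shifted f d) (cong sum (sym (map-upTo f d)))
  where
  shifted : ∀ (f : ℕ → ℕ) d → ∑ {d} (f ∘ toℕ) ≡ sum (applyUpTo f d)
  shifted f zero    = refl
  shifted f (suc d) = cong (_+_ (f 0)) (shifted (f ∘ suc) d)

sum-upTo-shift : ∀ (f : ℕ → ℕ) r → sum (map (f ∘ suc) (upTo r)) + f 0 ≡ sum (map f (upTo r)) + f r
sum-upTo-shift f zero    = refl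
sum-upTo-shift f (suc r) = begin
  sum (map (f ∘ suc) (upTo (suc r))) + f 0               ≡⟨ cong (_+ f 0) (sum-upTo-suc (f ∘ suc) r) ⟩
  sum (map (f ∘ suc) (upTo r)) + f (suc r) + f 0         ≡⟨ swap (sum (map (f ∘ suc) (upTo r))) (f (suc r)) (f 0) ⟩
  sum (map (f ∘ suc) (upTo r)) + f 0 + f (suc r)         ≡⟨ cong (_+ f (suc r)) (sum-upTo-shift f r) ⟩
  sum (map f (upTo r)) + f r + f (suc r)                 ≡⟨ cong (_+ f (suc r)) (sum-upTo-suc f r) ⟨
  sum (map f (upTo (suc r))) + f (suc r)                 ∎
  where
  open ≡-Reasoning
  swap : ∀ a b c → a + b + c ≡ a + c + b
  swap = solve-∀

%≡%⇒∣ : ∀ x k d .{{_ : NonZero d}} → (x + k) % d ≡ x % d → d ∣ k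
%≡%⇒∣ x k d eq = ∣m+n∣m⇒∣n (divides ((x + k) / d) (+-cancelˡ-≡ (x % d) _ _ (begin
  x % d + (x / d * d + k)                ≡⟨ +-assoc (x % d) _ k ⟨
  x % d + x / d * d + k                  ≡⟨ cong (_+ k) (m≡m%n+[m/n]*n x d) ⟨
  x + k                                  ≡⟨ m≡m%n+[m/n]*n (x + k) d ⟩
  (x + k) % d + (x + k) / d * d          ≡⟨ cong (_+ (x + k) / d * d) eq ⟩
  x % d + (x + k) / d * d                ∎))) (n∣m*n (x / d))
  where open ≡-Reasoning

suc-/ : ∀ r n .{{_ : NonZero n}} → suc r / n ≡ r / n ⊎ n ∣ suc r
suc-/ r n with suc r % n in eq
... | zero  = inj₂ (m%n≡0⇒n∣m (suc r) n eq)
... | suc k = inj₁ (sym (begin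
  r / n                         ≡⟨ cong (_/ n) r≡ ⟩
  (k + suc r / n * n) / n       ≡⟨ +-distrib-/-∣ʳ k (n∣m*n (suc r / n)) ⟩
  k / n + suc r / n * n / n     ≡⟨ cong₂ _+_ (m<n⇒m/n≡0 (<-trans (n<1+n k) (subst (_< n) eq (m%n<n (suc r) n)))) (m*n/n≡m (suc r / n) n) ⟩
  suc r / n                     ∎))
  where
  open ≡-Reasoning
  r≡ : r ≡ k + suc r / n * n
  r≡ = suc-injective (trans (m≡m%n+[m/n]*n (suc r) n) (cong (_+ suc r / n * n) eq))

neg-nonNegative : ∀ (f : Fin d → ℕ) → ¬ FirstNonzeroPositive (neg (tabulate (+_ ∘ f)))
neg-nonNegative {zero}  f ()
neg-nonNegative {suc d} f with f zero
... | zero  = neg-nonNegative (f ∘ suc)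
... | suc _ = λ ()

nonNegativePoint : (Fin d → ℕ) → Vec ℤ d
nonNegativePoint v = tabulate (+_ ∘ v)

lookup-nonNegativePoint : ∀ (v : Fin d → ℕ) i → ∣ lookup (nonNegativePoint v) i ∣ ≡ v i
lookup-nonNegativePoint v i = cong ∣_∣ (Vec.lookup∘tabulate (+_ ∘ v) i)

nonNegativePoint-OnShell : ∀ (v : Fin d → ℕ) → (∀ g → (∀ i → g ∣ v i) → g ∣ 1) → ∑ v ≡ p →
  OnShell d p (nonNegativePoint v)
nonNegativePoint-OnShell v prim total =
  trans (‖‖₁-∑ x) (trans (sum-cong-≗ (lookup-nonNegativePoint v)) total) ,
  content≡1 , decidable-stable (firstNonzeroPositive? x) λ ¬pos →
    neg-nonNegative v (¬FirstNonzeroPositive⇒neg x (λ c≡0 → 1+n≢0 (trans (sym content≡1) c≡0)) ¬pos)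
  where
  x = nonNegativePoint v
  content≡1 : content x ≡ 1
  content≡1 = ∣1⇒≡1 (prim (content x) λ i → subst (content x ∣_) (lookup-nonNegativePoint v i) (content-∣ x i))

module Rotations {d : ℕ} .{{_ : NonZero d}} (v : Fin d → ℕ) {p : ℕ}
  (prim : ∀ g → (∀ i → g ∣ v i) → g ∣ 1)
  (total : ∑ v ≡ p)
  (aperiodic : ∀ c → (∀ i → v (i ⊕ c) ≡ v i) → c % d ≡ 0) where

  base : Vec ℤ d
  base = nonNegativePoint v

  base-OnShell : OnShell d p base
  base-OnShell = nonNegativePoint-OnShell v prim total

  lookup-ρ^ : ∀ c i → ∣ lookup (ρ^ c base) i ∣ ≡ v (i ⊕ c)
  lookup-ρ^ c i = trans (∣lookup∣-≡± (ρ^-≡± c base) i)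
    (trans (cong ∣_∣ (Vec.lookup∘tabulate (λ j → lookup base (j ⊕ c)) i)) (lookup-nonNegativePoint v (i ⊕ c)))

  -- Equal rotations make the difference of their exponents a period of v.
  ρ^-injective : ∀ a a′ → ρ^ a base ≡ ρ^ a′ base → a % d ≡ a′ % d
  ρ^-injective a a′ eq = begin
    a % d                    ≡⟨ %-remove-+ʳ a (m%n≡0⇒n∣m (ā + a′) d (aperiodic (ā + a′) agree)) ⟨
    (a + (ā + a′)) % d       ≡⟨ cong (_% d) (swap a ā a′) ⟩
    (ā + a + a′) % d         ≡⟨ %-remove-+ˡ a′ d∣ā+a ⟩
    a′ % d                   ∎
    where
    open ≡-Reasoning
    swap : ∀ x y z → x + (y + z) ≡ y + x + z
    swap = solve-∀
    -- Represents - a modulo d, exponents being natural numbers.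
    ā = d ∸ a % d
    d∣ā+a : d ∣ ā + a
    d∣ā+a = subst (d ∣_) (begin
      d + a / d * d                  ≡⟨ cong (_+ a / d * d) (m∸n+n≡m (m%n≤n a d)) ⟨
      ā + a % d + a / d * d          ≡⟨ +-assoc ā (a % d) _ ⟩
      ā + (a % d + a / d * d)        ≡⟨ cong (_+_ ā) (m≡m%n+[m/n]*n a d) ⟨
      ā + a                          ∎) (∣m∣n⇒∣m+n ∣-refl (n∣m*n (a / d)))
    agree : ∀ j → v (j ⊕ (ā + a′)) ≡ v j
    agree j = begin
      v (j ⊕ (ā + a′))               ≡⟨ cong v (⊕-⊕ j ā a′) ⟨
      v (j ⊕ ā ⊕ a′)                 ≡⟨ lookup-ρ^ a′ (j ⊕ ā) ⟨
      ∣ lookup (ρ^ a′ base) (j ⊕ ā) ∣ ≡⟨ cong (λ x → ∣ lookup x (j ⊕ ā) ∣) eq ⟨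
      ∣ lookup (ρ^ a base) (j ⊕ ā) ∣  ≡⟨ lookup-ρ^ a (j ⊕ ā) ⟩
      v (j ⊕ ā ⊕ a)                  ≡⟨ cong v (⊕-⊕ j ā a) ⟩
      v (j ⊕ (ā + a))                ≡⟨ cong v (Fin.toℕ-injective (trans (toℕ-⊕ j (ā + a))
                                          (trans (%-remove-+ʳ (toℕ j) d∣ā+a) (m<n⇒m%n≡m (Fin.toℕ<n j))))) ⟩
      v j                            ∎

  R : List (Vec ℤ d)
  R = closure [ base ]

  R⊆shell : R ⊆ shell d p
  R⊆shell = closure-OnShell [ base ] λ { (here refl) → base-OnShell }

  R-closed : Closed R
  R-closed = closure-closed [ base ] λ { (here refl) → proj₂ base-OnShell }

  open Reserve (closure-unique [ base ]) R⊆shell R-closed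

  -- The points left to the reserve are the first r rotations in the order s. Always r ≤ d: if the
  -- orbits outside R are used up, the remainder is at most the size of R because n does not exceed
  -- that of the shell.
  Spread-shell : (s : ℕ → ℕ) → (∀ t k → t + suc k < d → s (t + suc k) % d ≢ s t % d) →
    (∀ r i → r ≤ d → d * sum (map (λ t → v (i ⊕ s t)) (upTo r)) ≤ r * p + e) →
    ∀ n → n ≤ length (shell d p) → Spread (shell d p) p e n
  Spread-shell {e} s distinct bound n n≤ = spread 0 z≤n λ r _ few → rotations r (r≤d r few)
    where
    r≤d : ∀ r → r < d ⊎ length rest + r ≡ n → r ≤ d
    r≤d r (inj₁ r<d) = <⇒≤ r<d
    r≤d r (inj₂ eq)  = +-cancelˡ-≤ (length rest) r d (begin
      length rest + r            ≡⟨ eq ⟩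
      n                          ≤⟨ n≤ ⟩
      length (shell d p)         ≤⟨ shell≤rest+R ⟩
      length rest + length R     ≤⟨ +-monoʳ-≤ (length rest) (≤-trans (length-closure [ base ]) (≤-reflexive (*-identityˡ d))) ⟩
      length rest + d            ∎)
      where open ≤-Reasoning
    rotations : ∀ r → r ≤ d → Spread R p e r
    rotations r r≤d = map (λ t → ρ^ (s t) base) (upTo r) , unique-map (Unique.upTo⁺ r) inj , sub ,
      trans (length-map _ (upTo r)) (length-upTo r) , bal
      where
      sub : map (λ t → ρ^ (s t) base) (upTo r) ⊆ R
      sub z∈ with ∈-map⁻ (λ t → ρ^ (s t) base) z∈
      ... | t , _ , refl = ρ^-Closed R-closed (s t) (⊆-closure [ base ] (here refl))
      clash : ∀ {t t′} → t < t′ → t′ < r → ρ^ (s t′) base ≢ ρ^ (s t) base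
      clash {t} {t′} t<t′ t′<r eq = distinct t (t′ ∸ suc t)
        (subst (_< d) (sym t+) (<-≤-trans t′<r r≤d))
        (trans (cong (λ z → s z % d) t+) (ρ^-injective (s t′) (s t) eq))
        where
        t+ : t + suc (t′ ∸ suc t) ≡ t′
        t+ = trans (+-suc t _) (m+[n∸m]≡n t<t′)
      inj : ∀ {t t′} → t ∈ upTo r → t′ ∈ upTo r → ρ^ (s t) base ≡ ρ^ (s t′) base → t ≡ t′
      inj {t} {t′} t∈ t′∈ eq with <-cmp t t′
      ... | tri< t<t′ _ _ = contradiction (sym eq) (clash t<t′ (∈-upTo⁻ t′∈))
      ... | tri≈ _ t≡t′ _ = t≡t′
      ... | tri> _ _ t′<t = contradiction eq (clash t′<t (∈-upTo⁻ t∈))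
      bal : ∀ i → d * coordinateSum (map (λ t → ρ^ (s t) base) (upTo r)) i ≤ r * p + e
      bal i = subst (λ S → d * S ≤ r * p + e)
        (trans (sum-map-cong {X = upTo r} (λ {t} _ → sym (lookup-ρ^ (s t) i))) (cong sum (map-∘ (upTo r))))
        (bound r i r≤d)

-- If d does not divide p, take the rotations of v_i = ⌊(p + i) / d⌋ in the order
-- t ↦ t p + ⌊t g / d⌋ with g = gcd(p, d), so that partial sums telescope to
-- ⌊(r p + u) / d⌋ with 0 ≤ u < d.
module NonDivisible {d p : ℕ} .{{_ : NonZero d}} (d∤p : ¬ d ∣ p) where

  v : Fin d → ℕ
  v i = (p + toℕ i) / d

  instance
    gcd-nonZero : NonZero (gcd p d)
    gcd-nonZero = ≢-nonZero (gcd[m,n]≢0 p d (inj₂ (≢-nonZero⁻¹ d)))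

  g = gcd p d
  d′ = d / g
  p′ = p / g

  d≡ : d ≡ d′ * g
  d≡ = sym (m/n*n≡m (gcd[m,n]∣n p d))

  p≡ : p ≡ p′ * g
  p≡ = sym (m/n*n≡m (gcd[m,n]∣m p d))

  instance
    d′-nonZero : NonZero d′
    d′-nonZero = ≢-nonZero λ d′≡0 → ≢-nonZero⁻¹ d (trans d≡ (cong (_* g) d′≡0))

  -- The multiples t p alone repeat modulo d with period d′; the term t / d′ moves each block of d′
  -- shifts to another residue class modulo g.
  shift : ℕ → ℕ
  shift t = t * p + t / d′

  total : ∑ v ≡ p
  total = trans (∑-toℕ (λ u → (p + u) / d) d) (hermite p)
    where
    hermite : ∀ p → sum (map (λ u → (p + u) / d) (upTo d)) ≡ p
    hermite zero    = begin
      sum (map (λ u → u / d) (upTo d))      ≡⟨ sum-map-cong {X = upTo d} (λ u∈ → m<n⇒m/n≡0 (∈-upTo⁻ u∈)) ⟩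
      sum (map (λ _ → 0) (upTo d))          ≡⟨ sum-map-const 0 (upTo d) ⟩
      length (upTo d) * 0                   ≡⟨ *-zeroʳ (length (upTo d)) ⟩
      0                                     ∎
      where open ≡-Reasoning
    -- Passing from p to p + 1 moves the range of summands by one place: ⌊p / d⌋ leaves and ⌊p / d⌋
    -- + 1 enters.
    hermite (suc p) = +-cancelʳ-≡ ((p + 0) / d) _ _ (begin
      sum (map (λ u → (suc p + u) / d) (upTo d)) + (p + 0) / d   ≡⟨ cong (_+ (p + 0) / d) (sum-map-cong {X = upTo d} λ {u} _ → cong (_/ d) (sym (+-suc p u))) ⟩
      sum (map (λ u → (p + suc u) / d) (upTo d)) + (p + 0) / d   ≡⟨ sum-upTo-shift (λ u → (p + u) / d) d ⟩
      sum (map (λ u → (p + u) / d) (upTo d)) + (p + d) / d       ≡⟨ cong₂ _+_ (hermite p) (+-distrib-/-∣ʳ p ∣-refl) ⟩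
      p + (p / d + d / d)                                        ≡⟨ cong (λ z → p + (p / d + z)) (n/n≡1 d) ⟩
      p + (p / d + 1)                                            ≡⟨ cong (_+_ p) (+-comm (p / d) 1) ⟩
      p + suc (p / d)                                            ≡⟨ +-suc p (p / d) ⟩
      suc p + p / d                                              ≡⟨ cong (λ z → suc p + z / d) (+-identityʳ p) ⟨
      suc p + (p + 0) / d                                        ∎)
      where open ≡-Reasoning

  first last : Fin d
  first = 0 mod d
  last  = (d ∸ 1) mod d

  toℕ-first : toℕ first ≡ 0
  toℕ-first = trans (Fin.toℕ-fromℕ< (m%n<n 0 d)) (m<n⇒m%n≡m (>-nonZero⁻¹ d))

  toℕ-last : toℕ last ≡ d ∸ 1
  toℕ-last = trans (Fin.toℕ-fromℕ< (m%n<n (d ∸ 1) d)) (m<n⇒m%n≡m (≤-reflexive (suc-pred d)))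

  v-first : v first ≡ p / d
  v-first = cong (_/ d) (trans (cong (_+_ p) toℕ-first) (+-identityʳ p))

  -- Here d ∤ p enters: otherwise all entries would be p / d. The consecutive integers at the two
  -- ends give primitivity at once.
  v-last : v last ≡ suc (p / d)
  v-last with suc-/ (p + (d ∸ 1)) d
  ... | inj₂ d∣ = contradiction (∣m+n∣m⇒∣n (subst (d ∣_) (trans (sym (+-suc p (d ∸ 1))) (trans (cong (_+_ p) (suc-pred d)) (+-comm p d))) d∣) ∣-refl) d∤p
  ... | inj₁ eq = begin
    (p + toℕ last) / d       ≡⟨ cong (λ z → (p + z) / d) toℕ-last ⟩
    (p + (d ∸ 1)) / d        ≡⟨ eq ⟨
    suc (p + (d ∸ 1)) / d    ≡⟨ cong (_/ d) (trans (sym (+-suc p (d ∸ 1))) (cong (_+_ p) (suc-pred d))) ⟩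
    (p + d) / d              ≡⟨ +-distrib-/-∣ʳ p ∣-refl ⟩
    p / d + d / d            ≡⟨ cong (_+_ (p / d)) (n/n≡1 d) ⟩
    p / d + 1                ≡⟨ +-comm (p / d) 1 ⟩
    suc (p / d)              ∎
    where open ≡-Reasoning

  prim : ∀ h → (∀ i → h ∣ v i) → h ∣ 1
  prim h h∣v = ∣m+n∣m⇒∣n (subst (h ∣_) (trans v-last (+-comm 1 (p / d))) (h∣v last))
    (subst (h ∣_) v-first (h∣v first))

  -- v is non-decreasing with different ends. A period f + 1 < d would put the small first value at
  -- place f + 1 and the large last value at place f, just before it.
  aperiodic : ∀ c → (∀ i → v (i ⊕ c) ≡ v i) → c % d ≡ 0
  aperiodic c periodic with c % d in eq
  ... | zero  = refl
  ... | suc f = contradiction (/-monoˡ-≤ d (+-monoʳ-≤ p (n≤1+n f))) (<⇒≱ (begin-strict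
    (p + suc f) / d            ≡⟨ cong (λ z → (p + z) / d) (sym at-first) ⟩
    v (first ⊕ c)              ≡⟨ trans (periodic first) v-first ⟩
    p / d                      <⟨ n<1+n (p / d) ⟩
    suc (p / d)                ≡⟨ trans (periodic last) v-last ⟨
    v (last ⊕ c)               ≡⟨ cong (λ z → (p + z) / d) at-last ⟩
    (p + f) / d                ∎))
    where
    open ≤-Reasoning
    f<d : suc f < d
    f<d = subst (_< d) eq (m%n<n c d)
    at-first : toℕ (first ⊕ c) ≡ suc f
    at-first = trans (toℕ-⊕ first c) (trans (cong (λ z → (z + c) % d) toℕ-first) eq)
    at-last : toℕ (last ⊕ c) ≡ f
    at-last = begin-equality
      toℕ (last ⊕ c)               ≡⟨ toℕ-⊕ last c ⟩
      (toℕ last + c) % d           ≡⟨ cong (λ z → (z + c) % d) toℕ-last ⟩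
      (d ∸ 1 + c) % d              ≡⟨ cong (_% d) (+-comm (d ∸ 1) c) ⟩
      (c + (d ∸ 1)) % d            ≡⟨ %-+ˡ c (d ∸ 1) d ⟨
      (c % d + (d ∸ 1)) % d        ≡⟨ cong (λ z → (z + (d ∸ 1)) % d) eq ⟩
      (suc f + (d ∸ 1)) % d        ≡⟨ cong (_% d) (trans (sym (+-suc f (d ∸ 1))) (cong (_+_ f) (suc-pred d))) ⟩
      (f + d) % d                  ≡⟨ [m+n]%n≡m%n f d ⟩
      f % d                        ≡⟨ m<n⇒m%n≡m (<-trans (n<1+n f) f<d) ⟩
      f                            ∎

  -- Residues modulo g determine t / d′. If these agree, d divides (k + 1) p, and so d′ divides k +
  -- 1 because p′ is coprime to d′; but a step by a positive multiple of d′ changes t / d′.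
  distinct : ∀ t k → t + suc k < d → shift (t + suc k) % d ≢ shift t % d
  distinct t k <d eq = contradiction (m/n≡0⇒m<n k/d′≡0) (≤⇒≯ (∣⇒≤ d′∣k))
    where
    open ≡-Reasoning
    t′ = t + suc k
    reduce : ∀ t → t < d → shift t % d % g ≡ t / d′
    reduce t t<d = begin
      shift t % d % g          ≡⟨ m∣n⇒o%n%m≡o%m g d (shift t) (gcd[m,n]∣n p d) ⟩
      shift t % g              ≡⟨ %-remove-+ˡ (t / d′) (∣n⇒∣m*n t (gcd[m,n]∣m p d)) ⟩
      t / d′ % g               ≡⟨ m<n⇒m%n≡m (m<n*o⇒m/o<n {t} {g} {d′} (subst (t <_) (trans d≡ (*-comm d′ g)) t<d)) ⟩
      t / d′                   ∎
    same : t′ / d′ ≡ t / d′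
    same = trans (sym (reduce t′ <d)) (trans (cong (_% g) eq) (reduce t (≤-<-trans (m≤m+n t (suc k)) <d)))
    expand : ∀ t k p a → (t + k) * p + a ≡ t * p + a + k * p
    expand = solve-∀
    d∣kp : d ∣ suc k * p
    d∣kp = %≡%⇒∣ (shift t) (suc k * p) d (trans (cong (_% d) (begin
      shift t + suc k * p              ≡⟨ expand t (suc k) p (t / d′) ⟨
      t′ * p + t / d′                  ≡⟨ cong (_+_ (t′ * p)) same ⟨
      shift t′                         ∎)) eq)
    d′∣k : d′ ∣ suc k
    d′∣k = coprime-divisor (Coprimality.sym (coprime-/gcd p d)) (*-cancelʳ-∣ g
      (subst₂ _∣_ d≡ (trans (cong (_*_ (suc k)) p≡) (rearrange (suc k) p′ g)) d∣kp))
      where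
      rearrange : ∀ k p g → k * (p * g) ≡ p * k * g
      rearrange = solve-∀
    quotient-+ : t′ / d′ ≡ t / d′ + suc k / d′
    quotient-+ = +-distrib-/-∣ʳ t d′∣k
    k/d′≡0 : suc k / d′ ≡ 0
    k/d′≡0 = +-cancelˡ-≡ (t / d′) _ _ (trans (sym quotient-+) (trans same (sym (+-identityʳ _))))

  -- The entry of v at j is the carry, possibly above 1, when p is added to the residue j modulo d.
  -- So the sum counts the carries in adding p repeatedly.
  partial : ∀ r i → sum (map (λ t → v (i ⊕ shift t)) (upTo r)) ≡ (r * p + toℕ (i ⊕ (r / d′))) / d
  partial zero    i = sym (m<n⇒m/n≡0 (Fin.toℕ<n (i ⊕ (0 / d′))))
  partial (suc r) i = begin
    sum (map (λ t → v (i ⊕ shift t)) (upTo (suc r)))       ≡⟨ sum-upTo-suc _ r ⟩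
    sum (map (λ t → v (i ⊕ shift t)) (upTo r)) + v (i ⊕ shift r) ≡⟨ cong₂ _+_ (partial r i) (cong (λ z → (p + z) / d) index) ⟩
    X / d + (p + X % d) / d                                ≡⟨ +-comm (X / d) _ ⟩
    (p + X % d) / d + X / d                                ≡⟨ cong (_+_ ((p + X % d) / d)) (m*n/n≡m (X / d) d) ⟨
    (p + X % d) / d + X / d * d / d                        ≡⟨ +-distrib-/-∣ʳ (p + X % d) (n∣m*n (X / d)) ⟨
    (p + X % d + X / d * d) / d                            ≡⟨ cong (_/ d) (trans (+-assoc p (X % d) _) (cong (_+_ p) (sym (m≡m%n+[m/n]*n X d)))) ⟩
    (p + X) / d                                            ≡⟨ cong (_/ d) (+-assoc p (r * p) u) ⟨
    (suc r * p + u) / d                                    ≡⟨ carry (suc-/ r d′) ⟩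
    (suc r * p + toℕ (i ⊕ (suc r / d′))) / d               ∎
    where
    open ≡-Reasoning
    u = toℕ (i ⊕ (r / d′))
    X = r * p + u
    index : toℕ (i ⊕ shift r) ≡ X % d
    index = begin
      toℕ (i ⊕ (r * p + r / d′))      ≡⟨ cong (λ c → toℕ (i ⊕ c)) (+-comm (r * p) (r / d′)) ⟩
      toℕ (i ⊕ (r / d′ + r * p))      ≡⟨ cong toℕ (⊕-⊕ i (r / d′) (r * p)) ⟨
      toℕ (i ⊕ (r / d′) ⊕ r * p)      ≡⟨ toℕ-⊕ (i ⊕ (r / d′)) (r * p) ⟩
      (u + r * p) % d                 ≡⟨ cong (_% d) (+-comm u (r * p)) ⟩
      X % d                           ∎
    carry : suc r / d′ ≡ r / d′ ⊎ d′ ∣ suc r →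
      (suc r * p + u) / d ≡ (suc r * p + toℕ (i ⊕ (suc r / d′))) / d
    carry (inj₁ eq) = cong (λ a → (suc r * p + toℕ (i ⊕ a)) / d) (sym eq)
    -- The start value changes only when d′ divides r + 1. Then d divides (r + 1) p, and a start
    -- value below d does not affect the quotient.
    carry (inj₂ d′∣) = trans (drop (i ⊕ (r / d′))) (sym (drop (i ⊕ (suc r / d′))))
      where
      d∣rp : d ∣ suc r * p
      d∣rp = subst (_∣ suc r * p) (sym d≡) (*-pres-∣ d′∣ (gcd[m,n]∣m p d))
      drop : ∀ (j : Fin d) → (suc r * p + toℕ j) / d ≡ suc r * p / d
      drop j = trans (+-distrib-/-∣ˡ (toℕ j) d∣rp)
        (trans (cong (_+_ (suc r * p / d)) (m<n⇒m/n≡0 (Fin.toℕ<n j))) (+-identityʳ _))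

  bound : ∀ r i → r ≤ d → d * sum (map (λ t → v (i ⊕ shift t)) (upTo r)) ≤ r * p + (d ∸ 1)
  bound r i _ = begin
    d * sum (map (λ t → v (i ⊕ shift t)) (upTo r))      ≡⟨ cong (_*_ d) (partial r i) ⟩
    d * ((r * p + u) / d)                               ≡⟨ *-comm d _ ⟩
    (r * p + u) / d * d                                 ≤⟨ m/n*n≤m (r * p + u) d ⟩
    r * p + u                                           ≤⟨ +-monoʳ-≤ (r * p) (s≤s⁻¹ (subst (u <_) (sym (suc-pred d)) (Fin.toℕ<n (i ⊕ (r / d′))))) ⟩
    r * p + (d ∸ 1)                                     ∎
    where
    open ≤-Reasoning
    u = toℕ (i ⊕ (r / d′))

  Spread-nonDivisible : ∀ n → n ≤ length (shell d p) → Spread (shell d p) p (d ∸ 1) n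
  Spread-nonDivisible = Rotations.Spread-shell v prim total aperiodic shift distinct bound

-- Reserved points for norms divisible by d

indicator : ℕ → ℕ → ℕ
indicator zero    zero    = 1
indicator (suc a) (suc u) = indicator a u
indicator zero    (suc _) = 0
indicator (suc _) zero    = 0

indicator-refl : ∀ a → indicator a a ≡ 1
indicator-refl zero    = refl
indicator-refl (suc a) = indicator-refl a

indicator-≢ : ∀ {a u} → a ≢ u → indicator a u ≡ 0
indicator-≢ {zero}  {zero}  a≢u = contradiction refl a≢u
indicator-≢ {zero}  {suc u} a≢u = refl
indicator-≢ {suc a} {zero}  a≢u = refl
indicator-≢ {suc a} {suc u} a≢u = indicator-≢ (a≢u ∘ cong suc)

indicator≤1 : ∀ a u → indicator a u ≤ 1
indicator≤1 zero    zero    = ≤-refl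
indicator≤1 zero    (suc u) = z≤n
indicator≤1 (suc a) zero    = z≤n
indicator≤1 (suc a) (suc u) = indicator≤1 a u

∑-indicator : ∀ {d a} → a < d → ∑ {d} (indicator a ∘ toℕ) ≡ 1
∑-indicator {suc d} {zero}  _         = cong suc (trans (∑-const {d} (λ _ → 0) 0 (λ _ → refl)) (*-zeroʳ d))
∑-indicator {suc d} {suc a} (s≤s a<d) = ∑-indicator a<d

-- The point (q + c, q, …, q, q − c); the sum of r consecutive rotations telescopes.
module Bump {d c q : ℕ} .{{_ : NonZero d}} (1<d : 1 < d) (0<c : 0 < c) (c≤q : c ≤ q) where

  spike : Fin d → ℕ
  spike i = c * indicator 0 (toℕ i)

  spike≤c : ∀ i → spike i ≤ c
  spike≤c i = ≤-trans (*-monoʳ-≤ c (indicator≤1 0 (toℕ i))) (≤-reflexive (*-identityʳ c))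

  v : Fin d → ℕ
  v i = q + spike i ∸ spike (i ⊕ 1)

  v-spike : ∀ i → v i + spike (i ⊕ 1) ≡ q + spike i
  v-spike i = m∸n+n≡m (≤-trans (spike≤c (i ⊕ 1)) (≤-trans c≤q (m≤m+n q (spike i))))

  total : ∑ v ≡ d * q
  total = +-cancelʳ-≡ (∑ spike) _ _ (begin
    ∑ v + ∑ spike                        ≡⟨ cong (_+_ (∑ v)) (∑-⊕ spike) ⟩
    ∑ v + ∑ (λ i → spike (i ⊕ 1))        ≡⟨ ∑-distrib-+ v (λ i → spike (i ⊕ 1)) ⟨
    ∑ (λ i → v i + spike (i ⊕ 1))        ≡⟨ sum-cong-≗ v-spike ⟩
    ∑ (λ i → q + spike i)                ≡⟨ ∑-distrib-+ (λ _ → q) spike ⟩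
    ∑ {d} (λ _ → q) + ∑ spike           ≡⟨ cong (_+ ∑ spike) (∑-const {d} (λ _ → q) q (λ _ → refl)) ⟩
    d * q + ∑ spike                     ∎)
    where open ≡-Reasoning

  -- The first entry q + c is the only one above q.
  aperiodic : ∀ s → (∀ i → v (i ⊕ s) ≡ v i) → s % d ≡ 0
  aperiodic s periodic = decidable-stable (s % d ≟ 0) λ s%d≢0 → <⇒≢ (begin-strict
    v (first ⊕ s)           ≤⟨ m∸n≤m _ (spike (first ⊕ s ⊕ 1)) ⟩
    q + spike (first ⊕ s)   ≡⟨ cong (λ z → q + c * z) (indicator-≢ λ 0≡ → s%d≢0 (trans (sym (first-⊕ s)) (sym 0≡))) ⟩
    q + c * 0               ≡⟨ cong (_+_ q) (*-zeroʳ c) ⟩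
    q + 0                   <⟨ +-monoʳ-< q 0<c ⟩
    q + c                   ≡⟨ cong (_+_ q) (*-identityʳ c) ⟨
    q + c * 1               ≡⟨ cong (q + c * 1 ∸_) (*-zeroʳ c) ⟨
    q + c * 1 ∸ c * 0       ≡⟨ cong₂ (λ y z → q + c * indicator 0 y ∸ c * indicator 0 z) toℕ-first (trans (first-⊕ 1) (m<n⇒m%n≡m 1<d)) ⟨
    v first                 ∎) (periodic first)
    where
    open ≤-Reasoning
    first : Fin d
    first = 0 mod d
    toℕ-first : toℕ first ≡ 0
    toℕ-first = trans (Fin.toℕ-fromℕ< (m%n<n 0 d)) (m<n⇒m%n≡m (<-trans z<s 1<d))
    first-⊕ : ∀ s → toℕ (first ⊕ s) ≡ s % d
    first-⊕ s = trans (toℕ-⊕ first s) (cong (λ z → (z + s) % d) toℕ-first)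

  distinct : ∀ t k → t + suc k < d → (t + suc k) % d ≢ t % d
  distinct t k lt eq = m≢1+m+n t (sym (trans (sym (+-suc t k)) (begin
    t + suc k            ≡⟨ m<n⇒m%n≡m lt ⟨
    (t + suc k) % d     ≡⟨ eq ⟩
    t % d               ≡⟨ m<n⇒m%n≡m (≤-<-trans (m≤m+n t (suc k)) lt) ⟩
    t                    ∎)))
    where open ≡-Reasoning

  partial : ∀ r i → sum (map (λ t → v (i ⊕ t)) (upTo r)) + spike (i ⊕ r) ≡ r * q + spike (i ⊕ 0)
  partial zero    i = refl
  partial (suc r) i = begin
    sum (map (λ t → v (i ⊕ t)) (upTo (suc r))) + spike (i ⊕ suc r)       ≡⟨ cong₂ _+_ (sum-upTo-suc (λ t → v (i ⊕ t)) r) (cong spike (trans (cong (i ⊕_) (+-comm 1 r)) (sym (⊕-⊕ i r 1)))) ⟩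
    S + v (i ⊕ r) + spike (i ⊕ r ⊕ 1)     ≡⟨ +-assoc S _ _ ⟩
    S + (v (i ⊕ r) + spike (i ⊕ r ⊕ 1))   ≡⟨ cong (_+_ S) (v-spike (i ⊕ r)) ⟩
    S + (q + spike (i ⊕ r))               ≡⟨ swap S q _ ⟩
    q + (S + spike (i ⊕ r))               ≡⟨ cong (_+_ q) (partial r i) ⟩
    q + (r * q + spike (i ⊕ 0))           ≡⟨ +-assoc q (r * q) _ ⟨
    suc r * q + spike (i ⊕ 0)             ∎
    where
    open ≡-Reasoning
    S = sum (map (λ t → v (i ⊕ t)) (upTo r))
    swap : ∀ a b c → a + (b + c) ≡ b + (a + c)
    swap = solve-∀

  bound : ∀ r i → r ≤ d → d * sum (map (λ t → v (i ⊕ t)) (upTo r)) ≤ r * (d * q) + d * c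
  bound r i _ = begin
    d * S                                  ≤⟨ *-monoʳ-≤ d (m≤m+n S (spike (i ⊕ r))) ⟩
    d * (S + spike (i ⊕ r))                ≡⟨ cong (_*_ d) (partial r i) ⟩
    d * (r * q + spike (i ⊕ 0))            ≤⟨ *-monoʳ-≤ d (+-monoʳ-≤ (r * q) (spike≤c (i ⊕ 0))) ⟩
    d * (r * q + c)                        ≡⟨ expand d r q c ⟩
    r * (d * q) + d * c                   ∎
    where
    open ≤-Reasoning
    S = sum (map (λ t → v (i ⊕ t)) (upTo r))
    expand : ∀ d r q c → d * (r * q + c) ≡ r * (d * q) + d * c
    expand = solve-∀

  Spread-bump : (∀ g → (∀ i → g ∣ v i) → g ∣ 1) → ∀ n → n ≤ length (shell d (d * q)) →
    Spread (shell d (d * q)) (d * q) (d * c) n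
  Spread-bump prim = Rotations.Spread-shell v prim total aperiodic id distinct bound

toℕ-mod : ∀ d .{{_ : NonZero d}} u → u < d → toℕ (u mod d) ≡ u
toℕ-mod d u u<d = trans (Fin.toℕ-fromℕ< (m%n<n u d)) (m<n⇒m%n≡m u<d)

-- From d = 3 on, the bump with c = 1 has the consecutive integers q + 1 and q at places 0 and 1,
-- hence is primitive.
Spread-divisible₃ : .{{_ : NonZero d}} → 3 ≤ d → ∀ q → 0 < q →
  ∀ n → n ≤ length (shell d (d * q)) → Spread (shell d (d * q)) (d * q) d n
Spread-divisible₃ {d} 3≤d q 0<q n n≤ = subst (λ e → Spread (shell d (d * q)) (d * q) e n) (*-identityʳ d)
  (Spread-bump (λ g g∣v → ∣m+n∣m⇒∣n (subst (g ∣_) v₀ (g∣v (0 mod d))) (subst (g ∣_) v₁ (g∣v (1 mod d)))) n n≤)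
  where
  1<d = <-≤-trans (s≤s z<s) 3≤d
  open Bump {d} {1} {q} 1<d z<s 0<q
  value : ∀ u → suc u < d → v (u mod d) ≡ q + 1 * indicator 0 u ∸ 1 * indicator 0 (suc u)
  value u 1+u<d = cong₂ (λ y z → q + 1 * indicator 0 y ∸ 1 * indicator 0 z) at
    (trans (toℕ-⊕ (u mod d) 1) (trans (cong (λ z → (z + 1) % d) at)
      (trans (cong (_% d) (+-comm u 1)) (m<n⇒m%n≡m 1+u<d))))
    where
    at : toℕ (u mod d) ≡ u
    at = toℕ-mod d u (<-trans (n<1+n u) 1+u<d)
  v₀ : v (0 mod d) ≡ q + 1
  v₀ = value 0 1<d
  v₁ : v (1 mod d) ≡ q
  v₁ = trans (value 1 3≤d) (+-identityʳ q)

module Planar (d≡2 : d ≡ 2) {c q : ℕ} (0<c : 0 < c) (c≤q : c ≤ q) where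

  private instance
    d-nonZero : NonZero d
    d-nonZero = ≢-nonZero λ d≡0 → 0≢1+n (trans (sym d≡0) d≡2)

  open Bump {d} {c} {q} (≤-reflexive (sym d≡2)) 0<c c≤q public

  private
    values : ∀ {d} .{{_ : NonZero d}} → (d≡2 : d ≡ 2) → ∀ g →
      (∀ (i : Fin d) → g ∣ q + c * indicator 0 (toℕ i) ∸ c * indicator 0 (toℕ (i ⊕ 1))) →
      (g ∣ q + c * 1 ∸ c * 0) × (g ∣ q + c * 0 ∸ c * 1)
    values refl g g∣ = g∣ zero , g∣ (suc zero)

  planar-divisors : ∀ g → (∀ i → g ∣ v i) → (g ∣ q + c) × (g ∣ q ∸ c)
  planar-divisors g g∣v with g∣q+c , g∣q-c ← values d≡2 g g∣v =
    subst (g ∣_) (cong₂ (λ x y → q + x ∸ y) (*-identityʳ c) (*-zeroʳ c)) g∣q+c ,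
    subst (g ∣_) (trans (cong₂ (λ x y → q + x ∸ y) (*-zeroʳ c) (*-identityʳ c)) (cong (_∸ c) (+-identityʳ q))) g∣q-c

  ∣2c : ∀ {g} → g ∣ q + c → g ∣ q ∸ c → g ∣ 2 * c
  ∣2c {g} g∣q+c g∣q-c = ∣m+n∣m⇒∣n (subst (g ∣_) eq g∣q+c) g∣q-c
    where
    open ≡-Reasoning
    eq : q + c ≡ q ∸ c + 2 * c
    eq = begin
      q + c                 ≡⟨ cong (_+ c) (m∸n+n≡m c≤q) ⟨
      q ∸ c + c + c         ≡⟨ +-assoc (q ∸ c) c c ⟩
      q ∸ c + (c + c)       ≡⟨ cong (λ z → q ∸ c + (c + z)) (+-identityʳ c) ⟨
      q ∸ c + 2 * c         ∎

-- The gcd of q + 1 and q - 1 divides 2, and q + 1 is odd.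
Spread-even-half : d ≡ 2 → ∀ h → 0 < h → ∀ n → n ≤ length (shell d (d * (2 * h))) →
  Spread (shell d (d * (2 * h))) (d * (2 * h)) (d * 1) n
Spread-even-half d≡2 h 0<h = Spread-bump λ g g∣v →
  let g∣q+1 , g∣q-1 = planar-divisors g g∣v in
  ∣m+n∣m⇒∣n {m = 2 * h} g∣q+1 (∣m⇒∣m*n h (∣2c g∣q+1 g∣q-1))
  where
  open Planar d≡2 {1} {2 * h} z<s (*-mono-< {0} {2} {0} {h} z<s 0<h)

-- For odd q both q + 1 and q - 1 are even, so the bump is raised to 2: q + 2 and q - 2 are odd and
-- differ by 4. It fits because h > 0 gives q ≥ 3.
Spread-odd-half : d ≡ 2 → ∀ h → 0 < h → ∀ n → n ≤ length (shell d (d * (2 * h + 1))) →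
  Spread (shell d (d * (2 * h + 1))) (d * (2 * h + 1)) (d * 2) n
Spread-odd-half d≡2 h 0<h = Spread-bump λ g g∣v →
  let g∣q+2 , g∣q-2 = planar-divisors g g∣v
      g∣4 : g ∣ 4
      g∣4 = ∣2c g∣q+2 g∣q-2
      g∣2 : g ∣ 2
      g∣2 = ∣m+n∣m⇒∣n {m = 4 * (h + 1)} (subst (g ∣_) (twice h) (∣n⇒∣m*n 2 g∣q+2)) (∣m⇒∣m*n (h + 1) g∣4)
  in ∣m+n∣m⇒∣n {m = 2 * (h + 1)} (subst (g ∣_) (odd h) g∣q+2) (∣m⇒∣m*n (h + 1) g∣2)
  where
  open Planar d≡2 {2} {2 * h + 1} z<s (≤-trans (*-monoʳ-≤ 2 0<h) (m≤m+n (2 * h) 1))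
  odd : ∀ h → 2 * h + 1 + 2 ≡ 2 * (h + 1) + 1
  odd = solve-∀
  twice : ∀ h → 2 * (2 * h + 1 + 2) ≡ 4 * (h + 1) + 2
  twice = solve-∀

-- The planar case q = 1, too small for a bump of 2. Here the diagonal point (1, 1) is primitive
-- and, being fixed by `ρ`, is a closed reserve on its own.
Spread-2-2 : ∀ n → n ≤ length (shell 2 2) → Spread (shell 2 2) 2 1 n
Spread-2-2 n n≤ = spread 0 z≤n λ r _ few → subsets r (few⇒≤1 r few)
  where
  R : List (Vec ℤ 2)
  R = [ + 1 ∷ + 1 ∷ [] ]
  R⊆shell : R ⊆ shell 2 2
  R⊆shell (here refl) = ∈-shell⁺ (refl , refl , tt)
  R-closed : Closed R
  R-closed (here refl) = here refl
  open Reserve {2} {2} {R} ([] ∷ []) R⊆shell R-closed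
  few⇒≤1 : ∀ r → r < 2 ⊎ length rest + r ≡ n → r ≤ 1
  few⇒≤1 r (inj₁ r<2) = s≤s⁻¹ r<2
  few⇒≤1 r (inj₂ eq)  = +-cancelˡ-≤ (length rest) r 1 (≤-trans (≤-reflexive eq) (≤-trans n≤ shell≤rest+R))
  subsets : ∀ r → r ≤ 1 → Spread R 2 1 r
  subsets zero          _        = [] , [] , (λ ()) , refl , λ _ → z≤n
  subsets (suc zero)    _        = R , [] ∷ [] , id , refl , λ { zero → n≤1+n 2 ; (suc zero) → n≤1+n 2 }
  subsets (suc (suc _)) (s≤s ())

-- An arc (a , z) stands for the point (q, …, q) + e_a − e_z; an Eulerian set of
-- arcs gives points with equal coordinate sums.
module Arcs (b : ℕ) where

  Arc : Set
  Arc = ℕ × ℕ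

  Valid : ℕ → Arc → Set
  Valid d (a , z) = a < d × z < d × a ≢ z

  -- The directed cycle 0 → 1 → ... → t + 1 → 0. Sizes start at 2 because a single arc with distinct
  -- ends is never Eulerian.
  cycle : ℕ → List Arc
  cycle t = (suc t , 0) ∷ map (λ j → j , suc j) (upTo (suc t))

  cycle-bounded : ∀ t {a z} → (a , z) ∈ cycle t → a < 2 + t × z < 2 + t × a ≢ z
  cycle-bounded t (here refl) = ≤-refl , z<s , λ ()
  cycle-bounded t (there ∈path) with ∈-map⁻ (λ j → j , suc j) ∈path
  ... | j , j∈ , refl = m≤n⇒m≤1+n (∈-upTo⁻ j∈) , s≤s (∈-upTo⁻ j∈) , λ j≡1+j → 1+n≢n (sym j≡1+j)

  cycle-unique : ∀ t → Unique (cycle t)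
  cycle-unique t = All.tabulate (λ x∈ → case-path (∈-map⁻ (λ j → j , suc j) x∈))
    ∷ unique-map (Unique.upTo⁺ (suc t)) (λ _ _ eq → cong proj₁ eq)
    where
    case-path : ∀ {x} → ∃[ j ] j ∈ upTo (suc t) × x ≡ (j , suc j) → (suc t , 0) ≢ x
    case-path (_ , _ , refl) ()

  cycle-length : ∀ t → length (cycle t) ≡ 2 + t
  cycle-length t = cong suc (trans (length-map _ (upTo (suc t))) (length-upTo (suc t)))

  Eulerian : List Arc → Set
  Eulerian A = ∀ u → sum (map (λ x → indicator (proj₁ x) u) A) ≡ sum (map (λ x → indicator (proj₂ x) u) A)

  cycle-Eulerian : ∀ t → Eulerian (cycle t)
  cycle-Eulerian t u = begin
    f (suc t) + sum (map (λ x → indicator (proj₁ x) u) (map (λ j → j , suc j) (upTo (suc t))))  ≡⟨ cong (λ l → f (suc t) + sum l) (map-∘ (upTo (suc t))) ⟨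
    f (suc t) + sum (map f (upTo (suc t)))            ≡⟨ +-comm (f (suc t)) _ ⟩
    sum (map f (upTo (suc t))) + f (suc t)            ≡⟨ sum-upTo-shift f (suc t) ⟨
    sum (map (f ∘ suc) (upTo (suc t))) + f 0          ≡⟨ +-comm _ (f 0) ⟩
    f 0 + sum (map (f ∘ suc) (upTo (suc t)))          ≡⟨ cong (λ l → f 0 + sum l) (map-∘ (upTo (suc t))) ⟩
    f 0 + sum (map (λ x → indicator (proj₂ x) u) (map (λ j → j , suc j) (upTo (suc t)))) ∎
    where
    open ≡-Reasoning
    f : ℕ → ℕ
    f a = indicator a u

  record Balanced (t : ℕ) (A : List Arc) : Set where
    field
      unique   : Unique A
      valid    : ∀ {x} → x ∈ A → Valid (3 + b) x
      size     : length A ≡ 2 + t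
      eulerian : Eulerian A

  -- d + 1 arcs form no cycle, but a (d − 1)-cycle together with a 2-cycle.
  arcs : ℕ → List Arc
  arcs t with t ≤? suc b
  ... | yes _ = cycle t
  ... | no  _ = (0 , 2 + b) ∷ (2 + b , 0) ∷ cycle b

  arcs-balanced : ∀ t → t < 3 + b → Balanced t (arcs t)
  arcs-balanced t t<d with t ≤? suc b
  ... | yes t≤ = record
    { unique   = cycle-unique t
    ; valid    = λ x∈ → let a< , z< , a≢z = cycle-bounded t x∈ in
                   <-≤-trans a< (s≤s (s≤s t≤)) , <-≤-trans z< (s≤s (s≤s t≤)) , a≢z
    ; size     = cycle-length t
    ; eulerian = cycle-Eulerian t
    }
  ... | no t≰ = record
    { unique   = All.tabulate (λ { (here refl) () ; (there x∈) refl → <-irrefl refl (proj₁ (proj₂ (cycle-bounded b x∈))) })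
               ∷ All.tabulate (λ { x∈ refl → <-irrefl refl (proj₁ (cycle-bounded b x∈)) })
               ∷ cycle-unique b
    ; valid    = λ { (here refl)         → z<s , ≤-refl , (λ ())
                   ; (there (here refl)) → ≤-refl , z<s , (λ ())
                   ; (there (there x∈))  → let a< , z< , a≢z = cycle-bounded b x∈ in
                       m≤n⇒m≤1+n a< , m≤n⇒m≤1+n z< , a≢z }
    ; size     = trans (cong (_+_ 2) (cycle-length b)) (cong (_+_ 2) (≤-antisym (≰⇒> t≰) (s≤s⁻¹ t<d)))
    ; eulerian = λ u → trans (cong (λ S → indicator 0 u + (indicator (2 + b) u + S)) (cycle-Eulerian b u))
                   (swap (indicator 0 u) (indicator (2 + b) u) _)
    }
    where
    swap : ∀ x y z → x + (y + z) ≡ y + (x + z)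
    swap = solve-∀

  -- At least two points are always left to the reserve, so the remainders to provide for have the d
  -- sizes 2, ..., d + 1.
  pool : List Arc
  pool = concatMap arcs (upTo (3 + b))

  module Points {d q : ℕ} .{{_ : NonZero d}} (d≡ : d ≡ 3 + b) (0<q : 0 < q) where

    coordinate : Arc → Fin d → ℕ
    coordinate (a , z) i = q + indicator a (toℕ i) ∸ indicator z (toℕ i)

    point : Arc → Vec ℤ d
    point x = nonNegativePoint (coordinate x)

    coordinate-+ : ∀ x i → coordinate x i + indicator (proj₂ x) (toℕ i) ≡ q + indicator (proj₁ x) (toℕ i)
    coordinate-+ (a , z) i = m∸n+n≡m (≤-trans (indicator≤1 z (toℕ i)) (≤-trans 0<q (m≤m+n q _)))

    coordinate-at : ∀ x u (u<d : u < d) →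
      coordinate x (Fin.fromℕ< u<d) ≡ q + indicator (proj₁ x) u ∸ indicator (proj₂ x) u
    coordinate-at (a , z) u u<d = cong (λ w → q + indicator a w ∸ indicator z w) (Fin.toℕ-fromℕ< u<d)

    coordinate-source : ∀ {a z} (a<d : a < d) → a ≢ z → coordinate (a , z) (Fin.fromℕ< a<d) ≡ q + 1
    coordinate-source {a} {z} a<d a≢z = trans (coordinate-at (a , z) a a<d)
      (cong₂ (λ s t → q + s ∸ t) (indicator-refl a) (indicator-≢ (a≢z ∘ sym)))

    coordinate-other : ∀ {a z} u (u<d : u < d) → u ≢ a → u ≢ z → coordinate (a , z) (Fin.fromℕ< u<d) ≡ q
    coordinate-other {a} {z} u u<d u≢a u≢z = trans (coordinate-at (a , z) u u<d)
      (trans (cong₂ (λ s t → q + s ∸ t) (indicator-≢ (u≢a ∘ sym)) (indicator-≢ (u≢z ∘ sym))) (+-identityʳ q))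

    -- Some coordinate lies off the arc and equals q, next to q + 1 at the source: this makes the
    -- point primitive, and it is where d ≥ 3 enters.
    third : ∀ a z → ∃[ u ] u < 3 × u ≢ a × u ≢ z
    third zero          zero          = 1 , s≤s z<s , (λ ()) , (λ ())
    third zero          (suc zero)    = 2 , ≤-refl , (λ ()) , (λ ())
    third zero          (suc (suc _)) = 1 , s≤s z<s , (λ ()) , (λ ())
    third (suc zero)    zero          = 2 , ≤-refl , (λ ()) , (λ ())
    third (suc (suc _)) zero          = 1 , s≤s z<s , (λ ()) , (λ ())
    third (suc _)       (suc _)       = 0 , z<s , (λ ()) , (λ ())

    point-OnShell : ∀ x → Valid d x → OnShell d (d * q) (point x)
    point-OnShell x@(a , z) (a<d , z<d , a≢z) = nonNegativePoint-OnShell (coordinate x) prim total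
      where
      prim : ∀ g → (∀ i → g ∣ coordinate x i) → g ∣ 1
      prim g g∣ with third a z
      ... | u , u<3 , u≢a , u≢z = ∣m+n∣m⇒∣n
        (subst (g ∣_) (coordinate-source a<d a≢z) (g∣ (Fin.fromℕ< a<d)))
        (subst (g ∣_) (coordinate-other u u<d u≢a u≢z) (g∣ (Fin.fromℕ< u<d)))
        where
        u<d : u < d
        u<d = <-≤-trans u<3 (≤-trans (m≤m+n 3 b) (≤-reflexive (sym d≡)))
      total : ∑ (coordinate x) ≡ d * q
      total = +-cancelʳ-≡ 1 _ _ (begin
        ∑ (coordinate x) + 1                                   ≡⟨ cong (_+_ (∑ (coordinate x))) (∑-indicator z<d) ⟨
        ∑ (coordinate x) + ∑ {d} (indicator z ∘ toℕ)          ≡⟨ ∑-distrib-+ (coordinate x) (indicator z ∘ toℕ) ⟨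
        ∑ (λ i → coordinate x i + indicator z (toℕ i))         ≡⟨ sum-cong-≗ (coordinate-+ x) ⟩
        ∑ {d} (λ i → q + indicator a (toℕ i))                 ≡⟨ ∑-distrib-+ {d} (λ _ → q) (indicator a ∘ toℕ) ⟩
        ∑ {d} (λ _ → q) + ∑ {d} (indicator a ∘ toℕ)          ≡⟨ cong₂ _+_ (∑-const {d} (λ _ → q) q (λ _ → refl)) (∑-indicator a<d) ⟩
        d * q + 1                                             ∎)
        where open ≡-Reasoning

    -- The source is the only coordinate above q and the target the only one below.
    point-injective : ∀ x y → Valid d x → Valid d y → point x ≡ point y → x ≡ y
    point-injective (a , z) (a′ , z′) (a<d , z<d , a≢z) _ eq = cong₂ _,_ a≡a′ z≡z′
      where
      open ≤-Reasoning
      same : ∀ i → coordinate (a , z) i ≡ coordinate (a′ , z′) i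
      same i = trans (sym (lookup-nonNegativePoint (coordinate (a , z)) i))
        (trans (cong (λ x → ∣ lookup x i ∣) eq) (lookup-nonNegativePoint (coordinate (a′ , z′)) i))
      a≡a′ : a ≡ a′
      a≡a′ with a′ ≟ a
      ... | yes a′≡a = sym a′≡a
      ... | no a′≢a = contradiction (begin-strict
        q + 1                                         ≡⟨ coordinate-source a<d a≢z ⟨
        coordinate (a , z) (Fin.fromℕ< a<d)           ≡⟨ same (Fin.fromℕ< a<d) ⟩
        coordinate (a′ , z′) (Fin.fromℕ< a<d)         ≡⟨ coordinate-at (a′ , z′) a a<d ⟩
        q + indicator a′ a ∸ indicator z′ a           ≤⟨ m∸n≤m _ (indicator z′ a) ⟩
        q + indicator a′ a                            ≡⟨ cong (_+_ q) (indicator-≢ a′≢a) ⟩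
        q + 0                                         <⟨ +-monoʳ-< q z<s ⟩
        q + 1                                         ∎) (<-irrefl refl)
      z≡z′ : z ≡ z′
      z≡z′ with z′ ≟ z
      ... | yes z′≡z = sym z′≡z
      ... | no z′≢z = contradiction (begin-strict
        q                                             ≤⟨ m≤m+n q (indicator a′ z) ⟩
        q + indicator a′ z ∸ 0                        ≡⟨ cong (q + indicator a′ z ∸_) (indicator-≢ z′≢z) ⟨
        q + indicator a′ z ∸ indicator z′ z           ≡⟨ coordinate-at (a′ , z′) z z<d ⟨
        coordinate (a′ , z′) (Fin.fromℕ< z<d)         ≡⟨ same (Fin.fromℕ< z<d) ⟨
        coordinate (a , z) (Fin.fromℕ< z<d)           ≡⟨ coordinate-at (a , z) z z<d ⟩
        q + indicator a z ∸ indicator z z             ≡⟨ cong₂ (λ s t → q + s ∸ t) (indicator-≢ a≢z) (indicator-refl z) ⟩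
        q + 0 ∸ 1                                     ≡⟨ cong (_∸ 1) (+-identityʳ q) ⟩
        q ∸ 1                                         <⟨ ≤-reflexive (trans (+-comm 1 (q ∸ 1)) (m∸n+n≡m 0<q)) ⟩
        q                                             ∎) (<-irrefl refl)

    coordinateSum-Eulerian : ∀ {A} → Eulerian A → ∀ i → coordinateSum (map point A) i ≡ length A * q
    coordinateSum-Eulerian {A} eul i = +-cancelʳ-≡ (sum (map (λ x → indicator (proj₂ x) u) A)) _ _ (begin
      coordinateSum (map point A) i + T            ≡⟨ cong (λ S → sum S + T) (map-∘ A) ⟨
      sum (map (λ x → ∣ lookup (point x) i ∣) A) + T ≡⟨ cong (_+ T) (sum-map-cong {X = A} λ {x} _ → lookup-nonNegativePoint (coordinate x) i) ⟩
      sum (map (λ x → coordinate x i) A) + T       ≡⟨ sum-map-+ (λ x → coordinate x i) _ A ⟨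
      sum (map (λ x → coordinate x i + indicator (proj₂ x) u) A) ≡⟨ sum-map-cong {X = A} (λ {x} _ → coordinate-+ x i) ⟩
      sum (map (λ x → q + indicator (proj₁ x) u) A)  ≡⟨ sum-map-+ (λ _ → q) _ A ⟩
      sum (map (λ _ → q) A) + sum (map (λ x → indicator (proj₁ x) u) A) ≡⟨ cong₂ _+_ (sum-map-const q A) (eul u) ⟩
      length A * q + T                             ∎)
      where
      open ≡-Reasoning
      u = toℕ i
      T = sum (map (λ x → indicator (proj₂ x) u) A)

    poolPoints : ∀ {x} → x ∈ map point pool → OnShell d (d * q) x
    poolPoints x∈ with ∈-map⁻ point x∈
    ... | y , y∈pool , refl with ∈-concatMap⁻ arcs {xs = upTo (3 + b)} y∈pool
    ...   | found with find found
    ...     | t , t∈ , y∈arcs = point-OnShell y (subst (λ d → Valid d y) (sym d≡)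
            (Balanced.valid (arcs-balanced t (∈-upTo⁻ t∈)) y∈arcs))

    R : List (Vec ℤ d)
    R = closure (map point pool)

    open Reserve (closure-unique (map point pool)) (closure-OnShell (map point pool) poolPoints)
      (closure-closed (map point pool) (λ x∈ → proj₂ (poolPoints x∈)))

    Spread-R : ∀ t → t < 3 + b → Spread R (d * q) 0 (2 + t)
    Spread-R t t<d = map point (arcs t) , unique-map unique (λ x∈ y∈ → point-injective _ _ (valid-d x∈) (valid-d y∈)) ,
      sub , trans (length-map point (arcs t)) size , λ i → ≤-reflexive (begin
        d * coordinateSum (map point (arcs t)) i    ≡⟨ cong (_*_ d) (coordinateSum-Eulerian {arcs t} eulerian i) ⟩
        d * (length (arcs t) * q)                   ≡⟨ cong (λ l → d * (l * q)) size ⟩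
        d * ((2 + t) * q)                           ≡⟨ expand d (2 + t) q ⟩
        (2 + t) * (d * q) + 0                       ∎)
      where
      open ≡-Reasoning
      open Balanced (arcs-balanced t t<d)
      valid-d : ∀ {x} → x ∈ arcs t → Valid d x
      valid-d {x} x∈ = subst (λ d → Valid d x) (sym d≡) (valid x∈)
      expand : ∀ d r q → d * (r * q) ≡ r * (d * q) + 0
      expand = solve-∀
      sub : map point (arcs t) ⊆ R
      sub z∈ with ∈-map⁻ point z∈
      ... | y , y∈ , refl = ⊆-closure (map point pool)
        (∈-map⁺ point (∈-concatMap⁺ arcs (lose (∈-upTo⁺ t<d) y∈)))

    -- The reserve has at most `length pool * d` points, so the upper bound on n keeps the orbits
    -- outside it from running out before n is reached.
    Spread-perfect : ∀ n → 2 ≤ n → n + length pool * d ≤ length (shell d (d * q)) →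
      Spread (shell d (d * q)) (d * q) 0 n
    Spread-perfect n 2≤n n≤ = spread 2 2≤n λ r 2≤r few → fill r 2≤r (r< r few)
      where
      open ≤-Reasoning
      n≤rest : n ≤ length rest
      n≤rest = +-cancelʳ-≤ (length pool * d) n (length rest) (begin
        n + length pool * d                       ≤⟨ n≤ ⟩
        length (shell d (d * q))                 ≤⟨ shell≤rest+R ⟩
        length rest + length R                     ≤⟨ +-monoʳ-≤ (length rest) (length-closure (map point pool)) ⟩
        length rest + length (map point pool) * d ≡⟨ cong (λ l → length rest + l * d) (length-map point pool) ⟩
        length rest + length pool * d             ∎)
      r< : ∀ r → r < 2 + d ⊎ length rest + r ≡ n → r < 2 + d
      r< r (inj₁ lt) = lt
      r< r (inj₂ eq) = ≤-<-trans (+-cancelˡ-≤ (length rest) r 0 (≤-trans (≤-reflexive eq) (≤-trans n≤rest (≤-reflexive (sym (+-identityʳ _)))))) z<s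
      fill : ∀ r → 2 ≤ r → r < 2 + d → Spread R (d * q) 0 r
      fill (suc (suc t)) _ (s≤s (s≤s t<d)) = Spread-R t (subst (t <_) d≡ t<d)
      fill (suc zero) (s≤s ()) _

-- Growth of κ_p

length-cartesianProductWith : ∀ {A B C : Set} (f : A → B → C) xs ys →
  length (cartesianProductWith f xs ys) ≡ length xs * length ys
length-cartesianProductWith f []       ys = refl
length-cartesianProductWith f (x ∷ xs) ys = trans (length-++ (map (f x) ys))
  (cong₂ _+_ (length-map (f x) ys) (length-cartesianProductWith f xs ys))

box : ℕ → ∀ n → List (Vec ℤ n)
box t zero    = [ [] ]
box t (suc n) = cartesianProductWith _∷_ (map +_ (upTo t)) (box t n)

box-unique : ∀ t n → Unique (box t n)
box-unique t zero    = [] ∷ []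
box-unique t (suc n) = Unique.cartesianProductWith⁺ _∷_ Vec.∷-injective
  (Unique.map⁺ ℤ.+-injective (Unique.upTo⁺ t)) (box-unique t n)

length-box : ∀ t n → length (box t n) ≡ t ^ n
length-box t zero    = refl
length-box t (suc n) = trans (length-cartesianProductWith _∷_ (map +_ (upTo t)) (box t n))
  (cong₂ _*_ (trans (length-map +_ (upTo t)) (length-upTo t)) (length-box t n))

‖box‖₁ : ∀ t n {x} → x ∈ box t n → ‖ x ‖₁ ≤ n * t
‖box‖₁ t zero    (here refl) = z≤n
‖box‖₁ t (suc n) x∈ with ∈-cartesianProductWith⁻ _∷_ (map +_ (upTo t)) (box t n) x∈
... | a , y , a∈ , y∈ , refl with ∈-map⁻ +_ a∈
...   | j , j∈ , refl = +-mono-≤ (<⇒≤ (∈-upTo⁻ j∈)) (‖box‖₁ t n y∈)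

-- The points (1, a, y) with t ≤ a < 2 t and y in a box are trivially primitive.
slab : ∀ {b} t → d ≡ 2 + b → ∃[ L ] Unique L × (∀ {x} → x ∈ L → InBall d (1 + d * t) x) ×
  length L ≡ t ^ (1 + b) × ∃[ i ] (∀ {x} → x ∈ L → t ≤ ∣ lookup x i ∣)
slab {b = b} t refl = map (+ 1 ∷_) tails ,
  Unique.map⁺ Vec.∷-injectiveʳ tails-unique , inBall ,
  trans (length-map (+ 1 ∷_) tails) tails-length , suc zero , large
  where
  heads : List ℤ
  heads = map (λ j → + (t + j)) (upTo t)
  tails : List (Vec ℤ (suc b))
  tails = cartesianProductWith _∷_ heads (box t b)
  tails-unique : Unique tails
  tails-unique = Unique.cartesianProductWith⁺ _∷_ Vec.∷-injective
    (Unique.map⁺ (λ eq → +-cancelˡ-≡ t _ _ (ℤ.+-injective eq)) (Unique.upTo⁺ t)) (box-unique t b)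
  tails-length : length tails ≡ t ^ (1 + b)
  tails-length = trans (length-cartesianProductWith _∷_ heads (box t b))
    (cong₂ _*_ (trans (length-map _ (upTo t)) (length-upTo t)) (length-box t b))
  member : ∀ {x} → x ∈ map (+ 1 ∷_) tails →
    ∃[ j ] ∃[ y ] j < t × y ∈ box t b × x ≡ + 1 ∷ + (t + j) ∷ y
  member x∈ with ∈-map⁻ (+ 1 ∷_) x∈
  ... | z , z∈ , refl with ∈-cartesianProductWith⁻ _∷_ heads (box t b) z∈
  ...   | a , y , a∈ , y∈ , refl with ∈-map⁻ (λ j → + (t + j)) a∈
  ...     | j , j∈ , refl = j , y , ∈-upTo⁻ j∈ , y∈ , refl
  inBall : ∀ {x} → x ∈ map (+ 1 ∷_) tails → InBall (2 + b) (1 + (2 + b) * t) x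
  inBall x∈ with member x∈
  ... | j , y , j<t , y∈ , refl =
    s≤s (≤-trans (+-mono-≤ (+-monoʳ-≤ t (<⇒≤ j<t)) (‖box‖₁ t b y∈)) (≤-reflexive (+-assoc t t (b * t)))) ,
    gcd-zeroˡ (content (+ (t + j) ∷ y)) , tt
  large : ∀ {x} → x ∈ map (+ 1 ∷_) tails → t ≤ ∣ lookup x (suc zero) ∣
  large x∈ with member x∈
  ... | j , y , _ , _ , refl = m≤m+n t j

-- The slab has t^(d - 1) points, all of size at least t in one common coordinate.
κ-ball-growth : ∀ t → 1 < d → t ^ d ≤ κ[ d , 1 + d * t ]
κ-ball-growth {d} t 1<d with slab t (sym (m+[n∸m]≡n 1<d))
... | L , uL , inBall , |L|≡ , i , large = begin
  t ^ d                                             ≡⟨ cong (t ^_) (m+[n∸m]≡n 1<d) ⟨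
  t * t ^ (1 + (d ∸ 2))                             ≡⟨ *-comm t _ ⟩
  t ^ (1 + (d ∸ 2)) * t                             ≡⟨ cong (_* t) |L|≡ ⟨
  length L * t                                      ≡⟨ sum-map-const t L ⟨
  sum (map (λ _ → t) L)                             ≤⟨ sum-map-mono {X = L} large ⟩
  coordinateSum L i                                 ≤⟨ sum-map-⊆ (λ x → ∣ lookup x i ∣) uL (λ x∈ _ → ∈-ball⁺ {p = 1 + d * t} (inBall x∈)) ⟩
  coordinateSum (ball d (1 + d * t)) i              ≤⟨ coordinateSum≤κ (ball d (1 + d * t)) i ⟩
  κ[ d , 1 + d * t ]                                ∎
  where open ≤-Reasoning

-- Exceptional values of k

Spread-weaken : ∀ {S : List (Vec ℤ d)} {e e′} → e ≤ e′ → Spread S p e n → Spread S p e′ n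
Spread-weaken {p = p} {n} e≤e′ (Y , uY , Y⊆S , |Y|≡n , bal) =
  Y , uY , Y⊆S , |Y|≡n , λ i → ≤-trans (bal i) (+-monoʳ-≤ (n * p) e≤e′)

even⊎odd : ∀ n → ∃[ h ] (n ≡ 2 * h ⊎ n ≡ 2 * h + 1)
even⊎odd zero = 0 , inj₁ refl
even⊎odd (suc n) with even⊎odd n
... | h , inj₁ refl = h , inj₂ (+-comm 1 (2 * h))
... | h , inj₂ refl = suc h , inj₁ (lemma h)
  where
  lemma : ∀ h → suc (2 * h + 1) ≡ 2 * suc h
  lemma = solve-∀

-- Two points of norm p make the window that ends at κ_p longer than p / d, the offset at which a
-- diagonal point would be wanted.
two-shell-points : ∀ {b} → d ≡ 2 + b → ∀ p → ∃[ L ]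
  Unique L × (∀ {x} → x ∈ L → OnShell d (3 + p) x) × length L ≡ 2
two-shell-points {b = b} refl p = x ∷ y ∷ [] , ((λ ()) ∷ []) ∷ [] ∷ [] ,
  (λ { (here refl)         → cong suc (trans (cong (_+_ (2 + p)) (zeros b)) (+-identityʳ (2 + p))) ,
         gcd-zeroˡ (content (+ (2 + p) ∷ Vec.replicate b (+ 0))) , tt
     ; (there (here refl)) → trans (cong (λ z → 2 + p + suc z) (zeros b)) (+-comm (2 + p) 1) ,
         trans (cong (gcd (2 + p)) (gcd-zeroˡ (content (Vec.replicate b (+ 0))))) (gcd-zeroʳ (2 + p)) , tt }) , refl
  where
  x y : Vec ℤ (2 + b)
  x = + 1 ∷ + (2 + p) ∷ Vec.replicate b (+ 0)
  y = + (2 + p) ∷ + 1 ∷ Vec.replicate b (+ 0)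
  zeros : ∀ n → ‖ Vec.replicate n (+ 0) ‖₁ ≡ 0
  zeros zero    = refl
  zeros (suc n) = zeros n

-- Floors of rational numbers

floor-≃ : ∀ (x : ℚ) A p .{{_ : NonZero p}} → ℚ.toℚᵘ x ℚᵘ.≃ (+ A ℚᵘ./ p) → ℚ.floor x ≡ + (A / p)
floor-≃ (ℚ.mkℚ (+ u) v-1 _) A p@(suc _) (ℚᵘ.*≡* eq) = trans (ℤ.*-identityˡ (+ (u / suc v-1))) (cong +_ (begin
  u / v                  ≡⟨ m*n/o*n≡m/o u p v ⟨
  u * p / (v * p)        ≡⟨ cong (_/ (v * p)) (ℤ.+-injective (trans (ℤ.pos-* u p) (trans eq (sym (ℤ.pos-* A v))))) ⟩
  A * v / (v * p)        ≡⟨ /-congʳ {m = A * v} (*-comm v p) ⟩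
  A * v / (p * v)        ≡⟨ m*n/o*n≡m/o A v p ⟩
  A / p                  ∎))
  where
  open ≡-Reasoning
  v = suc v-1
  instance
    vp-nonZero : NonZero (v * p)
    vp-nonZero = m*n≢0 v p
    pv-nonZero : NonZero (p * v)
    pv-nonZero = m*n≢0 p v
-- A negative numerator is incompatible with the non-negative fraction A / p.
floor-≃ (ℚ.mkℚ -[1+ u ] v-1 _) zero    (suc _) (ℚᵘ.*≡* ())
floor-≃ (ℚ.mkℚ -[1+ u ] v-1 _) (suc _) (suc _) (ℚᵘ.*≡* ())

toℚᵘ-/ : ∀ i p .{{_ : NonZero p}} → ℚ.toℚᵘ (i ℚ./ p) ℚᵘ.≃ (i ℚᵘ./ p)
toℚᵘ-/ i (suc p-1) = ℚ.toℚᵘ-fromℚᵘ (ℚᵘ.mkℚᵘ i p-1)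

floor-+-/ : ∀ a b p .{{_ : NonZero p}} → ℚ.floor (+ a ℚ./ 1 ℚ.+ + b ℚ./ p) ≡ + (a + b / p)
floor-+-/ a b p = trans (floor-≃ _ (a * p + b) p (ℚᵘ.≃-trans (ℚ.toℚᵘ-homo-+ (+ a ℚ./ 1) (+ b ℚ./ p))
  (ℚᵘ.≃-trans (ℚᵘ.+-cong (toℚᵘ-/ (+ a) 1) (toℚᵘ-/ (+ b) p)) (common p))))
  (cong +_ (trans (+-distrib-/-∣ˡ b (n∣m*n a)) (cong (_+ b / p) (m*n/n≡m a p))))
  where
  common : ∀ p .{{_ : NonZero p}} → (+ a ℚᵘ./ 1) ℚᵘ.+ (+ b ℚᵘ./ p) ℚᵘ.≃ (+ (a * p + b) ℚᵘ./ p)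
  common (suc p-1) = ℚᵘ.*≡* (cong₂ ℤ._*_
    (trans (cong₂ ℤ._+_ (sym (ℤ.pos-* a (suc p-1))) (ℤ.*-identityʳ (+ b))) (sym (ℤ.pos-+ (a * suc p-1) b)))
    (cong +_ (sym (+-identityʳ (suc p-1)))))

-- Windows between consecutive values κ_p

module Window (d : ℕ) .{{_ : NonTrivial d}} where

  private instance
    d-nonZero : NonZero d
    d-nonZero = nonTrivial⇒nonZero d

  open Bounds d

  1<d : 1 < d
  1<d = nonTrivial⇒n>1 d

  pred-threshold : ℕ → ℕ
  pred-threshold k = threshold d k ∸ 1

  suc-pred-threshold : ∀ k → suc (pred-threshold k) ≡ threshold d k
  suc-pred-threshold k = suc-pred (threshold d k) {{threshold-nonZero d k}}

  threshold-least : ∀ k p → 0 < p → k < κ[ d , p ] → threshold d k ≤ p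
  threshold-least k p 0<p k<κ = proj₂ (proj₂ (threshold-exists d k)) p (0<p , k<κ)

  <κ-threshold : ∀ k → k < κ[ d , threshold d k ]
  <κ-threshold k = proj₂ (proj₁ (proj₂ (threshold-exists d k)))

  κ-threshold≤ : ∀ k → κ[ d , pred-threshold k ] ≤ k
  κ-threshold≤ k with pred-threshold k in eq
  -- Minimality of the threshold says nothing about the norm 0, as thresholds are positive; κ_0 = 0
  -- fills the gap.
  ... | zero  = subst (_≤ k) (sym κ-ball-0) z≤n
  ... | suc P = ≮⇒≥ λ k<κ → <⇒≱ (subst (suc P <_) (trans (cong suc (sym eq)) (suc-pred-threshold k)) ≤-refl)
    (threshold-least k (suc P) z<s k<κ)

  threshold-mono : ∀ {k k′} → k ≤ k′ → threshold d k ≤ threshold d k′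
  threshold-mono {k} {k′} k≤k′ = threshold-least k (threshold d k′)
    (subst (0 <_) (suc-pred-threshold k′) z<s) (≤-<-trans k≤k′ (<κ-threshold k′))

  threshold-unique : ∀ {k P} → κ[ d , P ] ≤ k → k < κ[ d , suc P ] → pred-threshold k ≡ P
  threshold-unique {k} {P} κ≤k k<κ = ≤-antisym
    (s≤s⁻¹ (subst (_≤ suc P) (sym (suc-pred-threshold k)) (threshold-least k (suc P) z<s k<κ)))
    (s≤s⁻¹ (subst (P <_) (sym (suc-pred-threshold k)) (≰⇒> λ t≤P →
      <⇒≱ (<κ-threshold k) (≤-trans (κ-ball-mono t≤P) κ≤k))))

  offset : ℕ → ℕ
  offset k = k ∸ κ[ d , pred-threshold k ]

  κ+offset : ∀ k → κ[ d , pred-threshold k ] + offset k ≡ k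
  κ+offset k = m+[n∸m]≡n (κ-threshold≤ k)

  ⌊λ⌋ : ℕ → ℕ
  ⌊λ⌋ k = N d (pred-threshold k) + d * offset k / suc (pred-threshold k)

  floor-lambda : ∀ k → ℚ.floor (lambda d k) ≡ + ⌊λ⌋ k
  floor-lambda k = trans (cong (λ i → ℚ.floor (+ N d P ℚ./ 1 ℚ.+ i ℚ./ threshold d k)) numerator)
    (trans (floor-+-/ (N d P) (d * offset k) (threshold d k))
      (cong (λ z → + (N d P + z)) (/-congʳ {m = d * offset k} (sym (suc-pred-threshold k)))))
    where
    instance _ = threshold-nonZero d k
    P = pred-threshold k
    numerator : + d ℤ.* (+ k ℤ.- + κ[ d , P ]) ≡ + (d * offset k)
    numerator = trans (cong (+ d ℤ.*_) (trans (ℤ.m-n≡m⊖n k κ[ d , P ]) (ℤ.⊖-≥ (κ-threshold≤ k))))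
      (sym (ℤ.pos-* d (offset k)))

  -- Classifies p by the error that the reserve guarantees: d - 1 for `uniform`, 2 d for `planar`.
  -- For `spatial` two results are combined later, error d for every n and error 0 for most n, so
  -- only q is recorded.
  data ShellType (p : ℕ) : Set where
    uniform : (∀ n → n ≤ length (shell d p) → Spread (shell d p) p (d ∸ 1) n) → ShellType p
    planar  : ∀ q → d ≡ 2 → p ≡ d * q → 2 ≤ q →
      (∀ n → n ≤ length (shell d p) → Spread (shell d p) p (d * 2) n) → ShellType p
    spatial : ∀ q → 3 ≤ d → p ≡ d * q → 0 < q → ShellType p

  shellType : ∀ p → 0 < p → ShellType p
  shellType p 0<p with d ∣? p | d ≟ 2
  ... | no d∤p             | _       = uniform (NonDivisible.Spread-nonDivisible d∤p)
  ... | yes (divides q p≡) | no d≢2  = spatial q (≤∧≢⇒< 1<d (d≢2 ∘ sym)) (trans p≡ (*-comm q d))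
    (≤∧≢⇒< z≤n λ 0≡q → <-irrefl refl (<-≤-trans 0<p (≤-reflexive (trans p≡ (cong (_* d) (sym 0≡q))))))
  ... | yes (divides q p≡) | yes d≡2 with even⊎odd q
  ...   | zero , inj₁ refl = contradiction p≡ (λ p≡0 → <-irrefl (sym p≡0) 0<p)
  ...   | h@(suc _) , inj₁ refl = planar q d≡2 p≡dq (*-monoʳ-≤ 2 (s≤s z≤n)) λ n n≤ →
    Spread-weaken {p = p} {n} (*-monoʳ-≤ d (s≤s z≤n)) (subst (λ p → Spread (shell d p) p (d * 1) n) (sym p≡dq)
      (Spread-even-half d≡2 h z<s n (subst (λ p → n ≤ length (shell d p)) p≡dq n≤)))
    where
    p≡dq : p ≡ d * (2 * h)
    p≡dq = trans p≡ (*-comm q d)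
  -- For q = 1 the primitive diagonal point gives the error d - 1, as in the case d ∤ p.
  ...   | zero , inj₂ refl = uniform λ n → subst₂ (λ d p → n ≤ length (shell d p) → Spread (shell d p) p (d ∸ 1) n)
    (sym d≡2) (sym (trans p≡ (trans (+-identityʳ d) d≡2))) (Spread-2-2 n)
  ...   | h@(suc _) , inj₂ refl = planar q d≡2 p≡dq (≤-trans (*-monoʳ-≤ 2 (s≤s z≤n)) (m≤m+n (2 * h) 1)) λ n n≤ →
    subst (λ p → Spread (shell d p) p (d * 2) n) (sym p≡dq)
      (Spread-odd-half d≡2 h z<s n (subst (λ p → n ≤ length (shell d p)) p≡dq n≤))
    where
    p≡dq : p ≡ d * (2 * h + 1)
    p≡dq = trans p≡ (*-comm q d)

  -- The extra p is what giving up one point of norm p pays for. It covers the planar error 2 d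
  -- because q ≥ 2.
  Spread-slack : ∀ p → 0 < p → ∀ n → n ≤ length (shell d p) → Spread (shell d p) p (p + (d ∸ 1)) n
  Spread-slack p 0<p n n≤ with shellType p 0<p
  ... | uniform spread = Spread-weaken {p = p} {n} (m≤n+m (d ∸ 1) p) (spread n n≤)
  ... | planar q d≡2 p≡dq 2≤q spread = Spread-weaken {p = p} {n} (≤-trans (*-monoʳ-≤ d 2≤q) (≤-trans (≤-reflexive (sym p≡dq)) (m≤m+n p (d ∸ 1)))) (spread n n≤)
  ... | spatial q 3≤d refl 0<q = Spread-weaken {p = p} {n}
    (≤-trans (≤-reflexive (sym (suc-pred d))) (+-monoˡ-≤ (d ∸ 1) 0<p))
    (Spread-divisible₃ 3≤d q 0<q n n≤)

  quot : ℕ → ℕ → ℕ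
  quot P m = d * m / suc P

  quot*p≤ : ∀ P m → quot P m * suc P ≤ d * m
  quot*p≤ P m = m/n*n≤m (d * m) (suc P)

  quot<shell : ∀ P m → κ[ d , P ] + m < κ[ d , suc P ] → quot P m < length (shell d (suc P))
  quot<shell P m k<κ = *-cancelʳ-< (suc P) (quot P m) _ (≤-<-trans (quot*p≤ P m) (+-cancelˡ-< (d * κ[ d , P ]) _ _ (begin-strict
    d * κ[ d , P ] + d * m                                ≡⟨ *-distribˡ-+ d κ[ d , P ] m ⟨
    d * (κ[ d , P ] + m)                                  <⟨ *-monoʳ-< d k<κ ⟩
    d * κ[ d , suc P ]                                    ≤⟨ κ-step-≤ P ⟩
    d * κ[ d , P ] + length (shell d (suc P)) * suc P     ∎)))
    where open ≤-Reasoning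

  δ-lower-1 : ∀ P m → κ[ d , P ] + m < κ[ d , suc P ] → N d P + quot P m ≤ suc (δz d (κ[ d , P ] + m))
  δ-lower-1 P m k<κ with quot P m in eq
  ... | zero  = ≤-trans (≤-reflexive (+-identityʳ _)) (m≤n⇒m≤1+n (δ-lower-0 P m))
  ... | suc n = ≤-trans (≤-reflexive (+-suc (N d P) n)) (s≤s (δ-lower-Spread P m
    (Spread-slack (suc P) z<s n (<⇒≤ (<-trans (n<1+n n) (subst (_< length (shell d (suc P))) eq (quot<shell P m k<κ)))))
    (begin-strict
      n * suc P + (suc P + (d ∸ 1))   ≡⟨ rearrange n (suc P) (d ∸ 1) ⟩
      suc n * suc P + (d ∸ 1)         ≤⟨ +-monoˡ-≤ (d ∸ 1) (subst (λ z → z * suc P ≤ d * m) eq (quot*p≤ P m)) ⟩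
      d * m + (d ∸ 1)                 <⟨ +-monoʳ-< (d * m) (≤-reflexive (suc-pred d)) ⟩
      d * m + d                       ≡⟨ +-comm (d * m) d ⟩
      d + d * m                       ≡⟨ *-suc d m ⟨
      d * suc m                       ∎)))
    where
    open ≤-Reasoning
    rearrange : ∀ n p c → n * p + (p + c) ≡ suc n * p + c
    rearrange = solve-∀

  δ-exact : ∀ P m → quot P m * suc P + e < d * suc m → Spread (shell d (suc P)) (suc P) e (quot P m) →
    δz d (κ[ d , P ] + m) ≡ N d P + quot P m
  δ-exact P m small spread = ≤-antisym (δ-upper P m) (δ-lower-Spread P m spread small)

  -- Necessary conditions for δ to miss ⌊λ⌋; an upper bound on the number of exceptions asks for no
  -- more.
  data Exception (P m : ℕ) : Set where
    planar  : ∀ q c → d ≡ 2 → suc P ≡ d * q → 2 ≤ q → c < 2 → ∀ n → m ≡ n * q + c → Exception P m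
    spatial : ∀ q n → 3 ≤ d → suc P ≡ d * q → m ≡ n * q → n < length (shell d (suc P)) →
      n ≡ 1 ⊎ length (shell d (suc P)) < n + length (Arcs.pool (d ∸ 3)) * d → Exception P m

  exception : ∀ P m → κ[ d , P ] + m < κ[ d , suc P ] →
    δz d (κ[ d , P ] + m) ≢ N d P + quot P m → Exception P m
  exception P m k<κ δ≢ with shellType (suc P) z<s
  ... | uniform spread = contradiction (δ-exact P m (begin-strict
      quot P m * suc P + (d ∸ 1)      ≤⟨ +-monoˡ-≤ (d ∸ 1) (quot*p≤ P m) ⟩
      d * m + (d ∸ 1)                 <⟨ +-monoʳ-< (d * m) (≤-reflexive (suc-pred d)) ⟩
      d * m + d                       ≡⟨ +-comm (d * m) d ⟩
      d + d * m                       ≡⟨ *-suc d m ⟨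
      d * suc m                       ∎)
      (spread (quot P m) (<⇒≤ (quot<shell P m k<κ)))) δ≢
    where
    open ≤-Reasoning
  -- With n = ⌊m / q⌋ points, d m exceeds n p by d (m mod q), which pays for the error 2 d once m
  -- mod q ≥ 2.
  ... | planar q d≡2 p≡ 2≤q spread = planar q (m % q) d≡2 p≡ 2≤q (≰⇒> λ 2≤c → δ≢ (δ-exact P m (begin-strict
      quot P m * suc P + d * 2        ≡⟨ cong₂ (λ z w → z * w + d * 2) quot≡ p≡ ⟩
      m / q * (d * q) + d * 2         ≡⟨ factor (m / q) d q 2 ⟩
      d * (2 + m / q * q)             ≤⟨ *-monoʳ-≤ d (+-monoˡ-≤ (m / q * q) 2≤c) ⟩
      d * (m % q + m / q * q)         ≡⟨ cong (_*_ d) (m≡m%n+[m/n]*n m q) ⟨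
      d * m                           <⟨ *-monoʳ-< d (n<1+n m) ⟩
      d * suc m                       ∎)
      (spread (quot P m) (<⇒≤ (quot<shell P m k<κ))))) (m / q)
      (trans (m≡m%n+[m/n]*n m q) (+-comm (m % q) _))
    where
    open ≤-Reasoning
    instance
      q-nonZero : NonZero q
      q-nonZero = >-nonZero (<-≤-trans z<s 2≤q)
      dq-nonZero : NonZero (d * q)
      dq-nonZero = m*n≢0 d q
    quot≡ : quot P m ≡ m / q
    quot≡ = trans (/-congʳ {m = d * m} p≡) (m*n/m*o≡n/o d m q)
    factor : ∀ n d q c → n * (d * q) + d * c ≡ d * (c + n * q)
    factor = solve-∀
  ... | spatial q 3≤d p≡ 0<q = spatial q (m / q) 3≤d p≡ m≡nq (subst (_< length (shell d (suc P))) quot≡ (quot<shell P m k<κ)) extreme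
    where
    open ≤-Reasoning
    instance
      q-nonZero : NonZero q
      q-nonZero = >-nonZero 0<q
      dq-nonZero : NonZero (d * q)
      dq-nonZero = m*n≢0 d q
    quot≡ : quot P m ≡ m / q
    quot≡ = trans (/-congʳ {m = d * m} p≡) (m*n/m*o≡n/o d m q)
    factor : ∀ n d q → n * (d * q) + d ≡ d * (1 + n * q)
    factor = solve-∀
    m%q≡0 : m % q ≡ 0
    -- Likewise, any remainder m mod q ≥ 1 pays for the error d.
    m%q≡0 = decidable-stable (m % q ≟ 0) λ m%q≢0 → δ≢ (δ-exact P m (begin-strict
      quot P m * suc P + d            ≡⟨ cong₂ (λ z w → z * w + d) quot≡ p≡ ⟩
      m / q * (d * q) + d             ≡⟨ factor (m / q) d q ⟩
      d * (1 + m / q * q)             ≤⟨ *-monoʳ-≤ d (+-monoˡ-≤ (m / q * q) (n≢0⇒n>0 m%q≢0)) ⟩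
      d * (m % q + m / q * q)         ≡⟨ cong (_*_ d) (m≡m%n+[m/n]*n m q) ⟨
      d * m                           <⟨ *-monoʳ-< d (n<1+n m) ⟩
      d * suc m                       ∎)
      (subst (λ s → Spread (shell d s) s d (quot P m)) (sym p≡)
        (Spread-divisible₃ 3≤d q 0<q (quot P m) (subst (λ s → quot P m ≤ length (shell d s)) p≡ (<⇒≤ (quot<shell P m k<κ))))))
    m≡nq : m ≡ m / q * q
    m≡nq = trans (m≡m%n+[m/n]*n m q) (cong (_+ m / q * q) m%q≡0)
    C = length (Arcs.pool (d ∸ 3)) * d
    -- For n = 0 the ball alone attains the bound.
    n≢0 : m / q ≢ 0
    n≢0 n≡0 = δ≢ (≤-antisym (δ-upper P m) (≤-trans
      (≤-reflexive (trans (cong (_+_ (N d P)) (trans quot≡ n≡0)) (+-identityʳ _))) (δ-lower-0 P m)))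
    extreme : m / q ≡ 1 ⊎ length (shell d (suc P)) < m / q + C
    extreme with m / q ≟ 1 | m / q + C ≤? length (shell d (suc P))
    ... | yes n≡1 | _       = inj₁ n≡1
    ... | no _    | no n+C≰ = inj₂ (≰⇒> n+C≰)
    ... | no n≢1  | yes n+C≤ = contradiction (δ-exact P m (begin-strict
      quot P m * suc P + 0            ≡⟨ +-identityʳ _ ⟩
      quot P m * suc P                ≤⟨ quot*p≤ P m ⟩
      d * m                           <⟨ *-monoʳ-< d (n<1+n m) ⟩
      d * suc m                       ∎)
      (subst₂ (λ s n → Spread (shell d s) s 0 n) (sym p≡) (sym quot≡)
        (Arcs.Points.Spread-perfect (d ∸ 3) (sym (m+[n∸m]≡n 3≤d)) 0<q (m / q)
          (≤∧≢⇒< (n≢0⇒n>0 n≢0) (n≢1 ∘ sym))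
          (subst (λ s → m / q + C ≤ length (shell d s)) p≡ n+C≤)))) δ≢

  -- At offset q, ⌊λ⌋ calls for exactly one extra point of norm d q. The choice q = n + 2 keeps q ≥
  -- 2 and puts the witness above n.
  infinitely-many : ∀ n → ∃[ k ] n < k × 0 < k × δz d k ≢ ⌊λ⌋ k
  infinitely-many n = K , ≤-trans (n≤1+n (suc n)) q≤K , <-≤-trans z<s q≤K , λ δ≡ →
    δ≢-divisible P n p≡ (trans δ≡ (trans (cong₂ (λ P m → N d P + d * m / suc P) P≡ offset≡)
      (cong (_+_ (N d P)) (trans (cong (_/ suc P) (sym p≡)) (n/n≡1 (suc P))))))
    where
    q = 2 + n
    P = d * q ∸ 1
    p≡ : suc P ≡ d * q
    p≡ = suc-pred (d * q) {{m*n≢0 d q}}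
    K = κ[ d , P ] + q
    q≤K : q ≤ K
    q≤K = m≤n+m q κ[ d , P ]
    3≤p : 3 ≤ suc P
    3≤p = ≤-trans (n≤1+n 3) (≤-trans (*-mono-≤ 1<d (s≤s (s≤s (z≤n {n})))) (≤-reflexive (sym p≡)))
    K<κ : K < κ[ d , suc P ]
    K<κ with L , uL , onShell , |L|≡2 ← two-shell-points (sym (m+[n∸m]≡n 1<d)) (suc P ∸ 3) =
      *-cancelˡ-< d K _ (begin-strict
        d * (κ[ d , P ] + q)                 ≡⟨ *-distribˡ-+ d κ[ d , P ] q ⟩
        d * κ[ d , P ] + d * q               ≡⟨ cong (_+_ (d * κ[ d , P ])) p≡ ⟨
        d * κ[ d , P ] + suc P               <⟨ +-monoʳ-< (d * κ[ d , P ]) (m<m+n (suc P) z<s) ⟩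
        d * κ[ d , P ] + 2 * suc P           ≡⟨ cong (λ l → d * κ[ d , P ] + l * suc P) |L|≡2 ⟨
        d * κ[ d , P ] + length L * suc P    ≤⟨ κ-step-≥ P uL (λ {x} x∈ → ∈-shell⁺ (subst (λ p → OnShell d p x) (m+[n∸m]≡n 3≤p) (onShell x∈))) ⟩
        d * κ[ d , suc P ]                   ∎)
      where open ≤-Reasoning
    P≡ : pred-threshold K ≡ P
    P≡ = threshold-unique (m≤m+n κ[ d , P ] q) K<κ
    offset≡ : offset K ≡ q
    offset≡ = trans (cong (λ P → K ∸ κ[ d , P ]) P≡) (m+n∸m≡n κ[ d , P ] q)

-- Counting exceptions

*-^ : ∀ m n o → (m * n) ^ o ≡ m ^ o * n ^ o
*-^ m n zero    = refl
*-^ m n (suc o) rewrite *-^ m n o = swap m n (m ^ o) (n ^ o)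
  where
  swap : ∀ a b c d → a * b * (c * d) ≡ a * c * (b * d)
  swap = solve-∀

-- Reduction of the limit to natural numbers

infixr 8 _^ℚ_

_^ℚ_ : ℚ → ℕ → ℚ
_^ℚ_ = RawSemiring._^_ ℚ.+-*-rawSemiring

ι : ℕ → ℚ
ι n = + n ℚ./ 1

ι-* : ∀ m n → ι (m * n) ≡ ι m ℚ.* ι n
ι-* m n = ℚ.toℚᵘ-injective (ℚᵘ.≃-trans (toℚᵘ-/ (+ (m * n)) 1)
  (ℚᵘ.≃-trans (ℚᵘ.*≡* (cong (ℤ._* (+ 1)) (ℤ.pos-* m n)))
  (ℚᵘ.≃-sym (ℚᵘ.≃-trans (ℚ.toℚᵘ-homo-* (ι m) (ι n)) (ℚᵘ.*-cong (toℚᵘ-/ (+ m) 1) (toℚᵘ-/ (+ n) 1))))))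

ι-< : m < n → ι m ℚ.< ι n
ι-< {m} {n} m<n = ℚ.toℚᵘ-cancel-< (ℚᵘ.<-respˡ-≃ (ℚᵘ.≃-sym (toℚᵘ-/ (+ m) 1)) (ℚᵘ.<-respʳ-≃ (ℚᵘ.≃-sym (toℚᵘ-/ (+ n) 1))
  (ℚᵘ.*<* (subst₂ ℤ._<_ (sym (ℤ.*-identityʳ (+ m))) (sym (ℤ.*-identityʳ (+ n))) (ℤ.+<+ m<n)))))

ι-^ : ∀ n r → ι (n ^ r) ≡ ι n ^ℚ r
ι-^ n zero    = refl
ι-^ n (suc r) = trans (ι-* n (n ^ r)) (cong (ι n ℚ.*_) (ι-^ n r))

ι-denominator : ∀ (ε : ℚ) → ℚ.Positive ε → ∃[ a ] ε ℚ.* ι (ℚ.↧ₙ ε) ≡ ι (suc a)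
ι-denominator ε@(ℚ.mkℚ (+ suc a) b-1 _) _ = a , ℚ.toℚᵘ-injective
  (ℚᵘ.≃-trans (ℚ.toℚᵘ-homo-* ε (ι (suc b-1)))
  (ℚᵘ.≃-trans (ℚᵘ.*-congˡ {ℚ.toℚᵘ ε} (toℚᵘ-/ (+ suc b-1) 1))
  (ℚᵘ.≃-trans (ℚᵘ.*≡* (cong +_ (rearrange (suc a) (suc b-1)))) (ℚᵘ.≃-sym (toℚᵘ-/ (+ suc a) 1)))))
  where
  rearrange : ∀ a b → a * b * 1 ≡ a * (b * 1)
  rearrange = solve-∀

^ℚ-*-ι : ∀ ε a M r k → ε ℚ.* ι M ≡ ι a → (ε ^ℚ r) ℚ.* ι k ℚ.* ι (M ^ r) ≡ ι (a ^ r * k)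
^ℚ-*-ι ε a M zero    k eq = trans (ℚ.*-identityʳ _) (trans (ℚ.*-identityˡ (ι k)) (cong ι (sym (+-identityʳ k))))
^ℚ-*-ι ε a M (suc r) k eq = begin
  ε ℚ.* E ℚ.* ι k ℚ.* ι (M * M ^ r)              ≡⟨ cong (ε ℚ.* E ℚ.* ι k ℚ.*_) (ι-* M (M ^ r)) ⟩
  ε ℚ.* E ℚ.* ι k ℚ.* (ι M ℚ.* ι (M ^ r))        ≡⟨ cong (ℚ._* (ι M ℚ.* ι (M ^ r))) (ℚ.*-assoc ε E (ι k)) ⟩
  ε ℚ.* (E ℚ.* ι k) ℚ.* (ι M ℚ.* ι (M ^ r))      ≡⟨ interchange ε (E ℚ.* ι k) (ι M) (ι (M ^ r)) ⟩
  ε ℚ.* ι M ℚ.* (E ℚ.* ι k ℚ.* ι (M ^ r))        ≡⟨ cong₂ ℚ._*_ eq (^ℚ-*-ι ε a M r k eq) ⟩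
  ι a ℚ.* ι (a ^ r * k)                          ≡⟨ ι-* a (a ^ r * k) ⟨
  ι (a * (a ^ r * k))                            ≡⟨ cong ι (*-assoc a (a ^ r) k) ⟨
  ι (a * a ^ r * k)                              ∎
  where
  open ≡-Reasoning
  E = ε ^ℚ r
  interchange : ∀ w x y z → w ℚ.* x ℚ.* (y ℚ.* z) ≡ w ℚ.* y ℚ.* (x ℚ.* z)
  interchange = CommutativeSemigroupProperties.interchange
    (CommutativeMonoid.commutativeSemigroup ℚ.*-1-commutativeMonoid)

-- For M the denominator of ε one has ε ≥ 1 / M, so (M f(k))^r < k is strong enough; multiplication
-- by M^r leaves only integers to compare.
rootQuotientTendsToZero : ∀ (f : ℕ → ℕ) r →
  (∀ M → ∃[ K ] ∀ k → K ≤ k → (M * f k) ^ r < k) → RootQuotientTendsToZero f r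
rootQuotientTendsToZero f r small ε ε>0 with ι-denominator ε ε>0 | small (ℚ.↧ₙ ε)
... | a , eq | K , bound = K , λ k _ K≤k → ℚ.*-cancelʳ-<-nonNeg (ι (M ^ r)) {{ℚ.normalize-nonNeg (M ^ r) 1}} (subst₂ ℚ._<_
  (trans (cong ι (trans (*-^ M (f k) r) (*-comm (M ^ r) (f k ^ r)))) (trans (ι-* (f k ^ r) (M ^ r)) (cong (ℚ._* ι (M ^ r)) (ι-^ (f k) r))))
  (sym (^ℚ-*-ι ε (suc a) M r k eq))
  (ι-< (<-≤-trans (bound k K≤k) (m≤n*m k (suc a ^ r) {{m^n≢0 (suc a) r}}))))
  where
  M = ℚ.↧ₙ ε

count≤length : ∀ {E : Pred ℕ 0ℓ} (E? : Decidable E) k (L : List ℕ) →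
  (∀ {k′} → 0 < k′ → k′ ≤ k → E k′ → k′ ∈ L) → count E? k ≤ length L
count≤length E? k L covered = length-⊆ {Y = L}
  (Unique.filter⁺ E? (Unique.map⁺ suc-injective (Unique.upTo⁺ k))) sub
  where
  sub : filter E? (map suc (upTo k)) ⊆ L
  sub x∈ with ∈-filter⁻ E? {xs = map suc (upTo k)} x∈
  ... | x∈′ , Ex with ∈-map⁻ suc x∈′
  ...   | j , j∈ , refl = covered z<s (∈-upTo⁻ j∈) Ex

power-bound : ∀ M c t C r → c ≤ t * C → (M * c) ^ r ≤ (M * C) ^ r * t ^ r
power-bound M c t C r c≤tC = begin
  (M * c) ^ r              ≤⟨ ^-monoˡ-≤ r (*-monoʳ-≤ M c≤tC) ⟩
  (M * (t * C)) ^ r        ≡⟨ cong (_^ r) (rearrange M t C) ⟩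
  (M * C * t) ^ r          ≡⟨ *-^ (M * C) t r ⟩
  (M * C) ^ r * t ^ r      ∎
  where
  open ≤-Reasoning
  rearrange : ∀ a b c → a * (b * c) ≡ a * c * b
  rearrange = solve-∀

-- The left side of the first hypothesis is Q c with Q = 4 (M + 1). On the right, the first two
-- terms are bounded by k each and the third is 2 k, whence 4 M c < 4 k; this is the origin of the 4
-- in Q.
quarter : ∀ M c a t k → 4 * suc M * c ≤ 4 * suc M * a + 2 * (4 * suc M) * t + 2 * k →
  8 * suc M * t < k → 4 * suc M * a ≤ k → M * c < k
quarter M c a t k total 8t<k 4a≤k = *-cancelˡ-< 4 (M * c) k (begin-strict
  4 * (M * c)                                          ≤⟨ *-monoʳ-≤ 4 (*-monoˡ-≤ c (n≤1+n M)) ⟩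
  4 * (suc M * c)                                      ≡⟨ *-assoc 4 (suc M) c ⟨
  4 * suc M * c                                        ≤⟨ total ⟩
  4 * suc M * a + 2 * (4 * suc M) * t + 2 * k          ≡⟨ cong (λ x → 4 * suc M * a + x * t + 2 * k) (sym (*-assoc 2 4 (suc M))) ⟩
  4 * suc M * a + 8 * suc M * t + 2 * k                <⟨ +-monoˡ-< (2 * k) (+-mono-≤-< 4a≤k 8t<k) ⟩
  k + k + 2 * k                                        ≡⟨ four k ⟩
  4 * k                                                ∎)
  where
  open ≤-Reasoning
  four : ∀ k → k + k + 2 * k ≡ 4 * k
  four = solve-∀

module Exceptions (d : ℕ) .{{_ : NonTrivial d}} where

  open Window d

  private instance
    d-nonZero : NonZero d
    d-nonZero = nonTrivial⇒nonZero d

  δ≤⌊λ⌋ : ∀ k → δz d k ≤ ⌊λ⌋ k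
  δ≤⌊λ⌋ k = subst (λ k′ → δz d k′ ≤ ⌊λ⌋ k) (κ+offset k) (Bounds.δ-upper d (pred-threshold k) (offset k))

  in-window : ∀ k → κ[ d , pred-threshold k ] + offset k < κ[ d , suc (pred-threshold k) ]
  in-window k = subst₂ _<_ (sym (κ+offset k)) (cong κ[ d ,_] (sym (suc-pred-threshold k))) (<κ-threshold k)

  ⌊λ⌋≤1+δ : ∀ k → ⌊λ⌋ k ≤ suc (δz d k)
  ⌊λ⌋≤1+δ k = subst (λ k′ → ⌊λ⌋ k ≤ suc (δz d k′)) (κ+offset k)
    (δ-lower-1 (pred-threshold k) (offset k) (in-window k))

  exceptional : ∀ k → δz d k ≢ ⌊λ⌋ k → Exception (pred-threshold k) (offset k)
  exceptional k δ≢ = exception (pred-threshold k) (offset k) (in-window k)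
    (δ≢ ∘ subst (λ k′ → δz d k′ ≡ ⌊λ⌋ k) (κ+offset k))

  -- With E the exact set of failures, the formula outside E is immediate, and on E it follows from
  -- ⌊λ⌋ - 1 ≤ δ ≤ ⌊λ⌋.
  E : Pred ℕ 0ℓ
  E k = 0 < k × δz d k ≢ ⌊λ⌋ k

  E? : Decidable E
  E? k = (0 <? k) ×-dec ¬? (δz d k ≟ ⌊λ⌋ k)

  pred-threshold-mono : ∀ {k k′} → k ≤ k′ → pred-threshold k ≤ pred-threshold k′
  pred-threshold-mono k≤k′ = ∸-monoˡ-≤ 1 (threshold-mono k≤k′)

  -- With t about p / d, k ≥ κ_(1 + d t) ≥ t^d, while C p^(d-1) ≤ C (3 d t)^(d-1) = T t^(d-1). So t
  -- > T is enough, and Q is chosen to force it.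
  threshold-growth : ∀ C → ∃[ K ] ∀ k → K ≤ k → C * threshold d k ^ (d ∸ 1) < k
  threshold-growth C = κ[ d , Q ] , λ k K≤k → large k (≰⇒> λ t≤Q →
    <⇒≱ (<κ-threshold k) (≤-trans (Bounds.κ-ball-mono d t≤Q) K≤k))
    where
    T Q : ℕ
    T = C * (3 * d) ^ (d ∸ 1)
    Q = 2 + d * suc T
    large : ∀ k → Q < threshold d k → C * threshold d k ^ (d ∸ 1) < k
    large k Q<p = begin-strict
      C * threshold d k ^ (d ∸ 1)               ≤⟨ *-monoʳ-≤ C (^-monoˡ-≤ (d ∸ 1) p≤) ⟩
      C * (3 * d * t) ^ (d ∸ 1)                 ≡⟨ cong (_*_ C) (*-^ (3 * d) t (d ∸ 1)) ⟩
      C * ((3 * d) ^ (d ∸ 1) * t ^ (d ∸ 1))     ≡⟨ *-assoc C _ _ ⟨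
      T * t ^ (d ∸ 1)                           <⟨ *-monoˡ-< (t ^ (d ∸ 1)) {{m^n≢0 t (d ∸ 1) {{t-nonZero}}}} T<t ⟩
      t * t ^ (d ∸ 1)                           ≡⟨ cong (t ^_) (suc-pred d) ⟩
      t ^ d                                     ≤⟨ κ-ball-growth t 1<d ⟩
      κ[ d , 1 + d * t ]                        ≤⟨ Bounds.κ-ball-mono d 1+dt≤P ⟩
      κ[ d , P ]                                ≤⟨ κ-threshold≤ k ⟩
      k                                         ∎
      where
      open ≤-Reasoning
      P t : ℕ
      P = pred-threshold k
      t = (P ∸ 1) / d
      p≡ : suc P ≡ threshold d k
      p≡ = suc-pred-threshold k
      2+dT≤P : 2 + d * suc T ≤ P
      2+dT≤P = s≤s⁻¹ (≤-trans Q<p (≤-reflexive (sym p≡)))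
      1≤P : 1 ≤ P
      1≤P = ≤-trans (s≤s z≤n) 2+dT≤P
      1+dt≤P : 1 + d * t ≤ P
      1+dt≤P = ≤-trans (s≤s (≤-trans (≤-reflexive (*-comm d t)) (m/n*n≤m (P ∸ 1) d))) (≤-reflexive (m+[n∸m]≡n 1≤P))
      T<t : T < t
      T<t = ≤-trans (≤-reflexive (sym (m*n/n≡m (suc T) d))) (/-monoˡ-≤ d (≤-trans (≤-reflexive (*-comm (suc T) d))
        (∸-monoˡ-≤ 1 (≤-trans (n≤1+n _) 2+dT≤P))))
      t-nonZero : NonZero t
      t-nonZero = >-nonZero (≤-<-trans z≤n T<t)
      d≤dt : d ≤ d * t
      d≤dt = m≤m*n d t {{t-nonZero}}
      triple : ∀ d t → d * t + d * t + d * t ≡ 3 * d * t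
      triple = solve-∀
      p≤ : threshold d k ≤ 3 * d * t
      p≤ = begin
        threshold d k                            ≡⟨ p≡ ⟨
        suc P                                    ≡⟨ cong suc (m+[n∸m]≡n 1≤P) ⟨
        2 + (P ∸ 1)                              ≡⟨ cong (_+_ 2) (m≡m%n+[m/n]*n (P ∸ 1) d) ⟩
        2 + ((P ∸ 1) % d + t * d)                ≤⟨ +-mono-≤ 1<d (+-monoˡ-≤ (t * d) (<⇒≤ (m%n<n (P ∸ 1) d))) ⟩
        d + (d + t * d)                          ≤⟨ +-mono-≤ d≤dt (+-mono-≤ d≤dt (≤-reflexive (*-comm t d))) ⟩
        d * t + (d * t + d * t)                  ≡⟨ +-assoc (d * t) (d * t) (d * t) ⟨
        d * t + d * t + d * t                    ≡⟨ triple d t ⟩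
        3 * d * t                                ∎

  side : ∀ P {q} → suc P ≡ d * q → suc P / d ≡ q
  side P {q} p≡ = trans (cong (_/ d) (trans p≡ (*-comm d q))) (m*n/n≡m q d)

  module SpatialExceptions (3≤d : 3 ≤ d) where

    C : ℕ
    C = length (Arcs.pool (d ∸ 3)) * d

    -- `suc P / d` stands for q and makes sense for every P; windows whose norm d does not divide
    -- merely add spare candidates.
    candidates : ℕ → List ℕ
    candidates P = map (λ n → κ[ d , P ] + n * (suc P / d)) (1 ∷ map (λ j → length (shell d (suc P)) ∸ j) (upTo C))

    length-candidates : ∀ P → length (candidates P) ≡ suc C
    length-candidates P = cong suc (trans (length-map _ (map (λ j → length (shell d (suc P)) ∸ j) (upTo C)))
      (trans (length-map _ (upTo C)) (length-upTo C)))

    locate : ∀ {P m} → Exception P m → κ[ d , P ] + m ∈ candidates P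
    locate (planar _ _ d≡2 _ _ _ _ _) = contradiction (subst (3 ≤_) d≡2 3≤d) (<-irrefl refl)
    locate {P} (spatial q n _ p≡ m≡ n<S n-extreme) = subst (_∈ candidates P)
      (cong (_+_ κ[ d , P ]) (trans (cong (_*_ n) (side P p≡)) (sym m≡)))
      (∈-map⁺ (λ n → κ[ d , P ] + n * (suc P / d)) (listed n-extreme))
      where
      S : ℕ
      S = length (shell d (suc P))
      listed : n ≡ 1 ⊎ S < n + C → n ∈ 1 ∷ map (λ j → S ∸ j) (upTo C)
      listed (inj₁ refl)  = here refl
      listed (inj₂ S<n+C) = there (subst (_∈ map (λ j → S ∸ j) (upTo C)) (m∸[m∸n]≡n (<⇒≤ n<S))
        (∈-map⁺ (λ j → S ∸ j) (∈-upTo⁺ (+-cancelʳ-< n (S ∸ n) C (subst₂ _<_ (sym (m∸n+n≡m (<⇒≤ n<S))) (+-comm n C) S<n+C)))))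

    covered : ∀ {k} → E k → k ∈ candidates (pred-threshold k)
    covered {k} (_ , δ≢) = subst (_∈ candidates (pred-threshold k)) (κ+offset k) (locate (exceptional k δ≢))

    count-E : ∀ k → count E? k ≤ threshold d k * suc C
    count-E k = ≤-trans (count≤length E? k (concatMap candidates (upTo (threshold d k))) λ {k′} _ k′≤k Ek′ →
        ∈-concatMap⁺ candidates (lose (∈-upTo⁺ (<-≤-trans (≤-reflexive (suc-pred-threshold k′)) (threshold-mono k′≤k))) (covered Ek′)))
      (≤-reflexive (trans (length-concatMap candidates (upTo (threshold d k)))
        (trans (sum-map-cong {X = upTo (threshold d k)} (λ {P} _ → length-candidates P))
          (trans (sum-map-const (suc C) (upTo (threshold d k))) (cong (_* suc C) (length-upTo (threshold d k)))))))

    -- The count is O(p), and p^(d - 1) is of smaller order than k.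
    sparse : ∀ M → ∃[ K ] ∀ k → K ≤ k → (M * count E? k) ^ (d ∸ 1) < k
    sparse M = let K , bound = threshold-growth ((M * suc C) ^ (d ∸ 1)) in K , λ k K≤k →
      ≤-<-trans (power-bound M (count E? k) (threshold d k) (suc C) (d ∸ 1) (count-E k)) (bound k K≤k)

  -- Exceptions in a window come in pairs whose distance p / 2 is at least Q,
  -- apart from finitely many windows.
  module PlanarExceptions (d≡2 : d ≡ 2) (Q : ℕ) .{{_ : NonZero Q}} where

    -- Here b bounds the offsets considered: n q ≤ b and q ≥ Q give n ≤ b / Q. Dividing by the same
    -- Q in all windows lets the bounds be added up.
    candidates : ℕ → ℕ → List ℕ
    candidates b P = cartesianProductWith (λ n c → κ[ d , P ] + (n * (suc P / d) + c)) (upTo (suc (b / Q))) (upTo 2)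

    Q*length-candidates : ∀ b P → Q * length (candidates b P) ≤ 2 * Q + 2 * b
    Q*length-candidates b P = begin
      Q * length (candidates b P)                       ≡⟨ cong (_*_ Q) (length-cartesianProductWith (λ n c → κ[ d , P ] + (n * (suc P / d) + c)) (upTo (suc (b / Q))) (upTo 2)) ⟩
      Q * (length (upTo (suc (b / Q))) * 2)             ≡⟨ cong (λ l → Q * (l * 2)) (length-upTo (suc (b / Q))) ⟩
      Q * (suc (b / Q) * 2)                             ≡⟨ expand Q (b / Q) ⟩
      2 * Q + 2 * (b / Q * Q)                           ≤⟨ +-monoʳ-≤ (2 * Q) (*-monoʳ-≤ 2 (m/n*n≤m b Q)) ⟩
      2 * Q + 2 * b                                     ∎
      where
      open ≤-Reasoning
      expand : ∀ Q x → Q * (suc x * 2) ≡ 2 * Q + 2 * (x * Q)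
      expand = solve-∀

    width : ℕ → ℕ
    width P = κ[ d , suc P ] ∸ κ[ d , P ]

    before : ℕ → List ℕ
    before P = concatMap (λ P′ → candidates (width P′) P′) (upTo P)

    -- The widths of the windows add up to κ, so the total is 2 κ / Q plus two candidates per
    -- window.
    Q*length-before : ∀ P → Q * length (before P) ≤ 2 * Q * P + 2 * κ[ d , P ]
    Q*length-before P = ≤-trans (≤-reflexive (cong (_*_ Q) (length-concatMap (λ P′ → candidates (width P′) P′) (upTo P)))) (telescope P)
      where
      open ≤-Reasoning
      f : ℕ → ℕ
      f P′ = length (candidates (width P′) P′)
      regroup : ∀ Q P κ w → 2 * Q * P + 2 * κ + (2 * Q + 2 * w) ≡ 2 * Q * suc P + 2 * (κ + w)
      regroup = solve-∀
      telescope : ∀ P → Q * sum (map f (upTo P)) ≤ 2 * Q * P + 2 * κ[ d , P ]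
      telescope zero    = ≤-trans (≤-reflexive (*-zeroʳ Q)) z≤n
      telescope (suc P) = begin
        Q * sum (map f (upTo (suc P)))                          ≡⟨ cong (_*_ Q) (sum-upTo-suc f P) ⟩
        Q * (sum (map f (upTo P)) + f P)                        ≡⟨ *-distribˡ-+ Q (sum (map f (upTo P))) (f P) ⟩
        Q * sum (map f (upTo P)) + Q * f P                      ≤⟨ +-mono-≤ (telescope P) (Q*length-candidates (width P) P) ⟩
        2 * Q * P + 2 * κ[ d , P ] + (2 * Q + 2 * width P)      ≡⟨ regroup Q P κ[ d , P ] (width P) ⟩
        2 * Q * suc P + 2 * (κ[ d , P ] + width P)              ≡⟨ cong (λ z → 2 * Q * suc P + 2 * z) (m+[n∸m]≡n (Bounds.κ-ball-mono d (n≤1+n P))) ⟩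
        2 * Q * suc P + 2 * κ[ d , suc P ]                      ∎

    -- All k in windows with q ≤ Q lie below this constant and are simply all counted.
    A₀ : ℕ
    A₀ = κ[ d , d * Q ]

    locate : ∀ {P m b} → Exception P m → m ≤ b → suc P ≤ d * Q ⊎ κ[ d , P ] + m ∈ candidates b P
    locate (spatial _ _ 3≤d _ _ _ _) _ = contradiction (subst (3 ≤_) d≡2 3≤d) (<-irrefl refl)
    locate {P} {m} {b} (planar q c _ p≡ _ c<2 n m≡) m≤b = Sum.map
      (λ q≤Q → ≤-trans (≤-reflexive p≡) (*-monoʳ-≤ d q≤Q))
      (λ Q≤q → subst (_∈ candidates b P)
        (cong (_+_ κ[ d , P ]) (trans (cong (λ z → n * z + c) (side P p≡)) (sym m≡)))
        (∈-cartesianProductWith⁺ (λ n c → κ[ d , P ] + (n * (suc P / d) + c)) (∈-upTo⁺ (s≤s (n≤ Q≤q))) (∈-upTo⁺ c<2)))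
      (≤-total q Q)
      where
      n≤ : Q ≤ q → n ≤ b / Q
      n≤ Q≤q = ≤-trans (≤-reflexive (sym (m*n/n≡m n Q))) (/-monoˡ-≤ Q
        (≤-trans (*-monoʳ-≤ n Q≤q) (≤-trans (m≤m+n (n * q) c) (≤-trans (≤-reflexive (sym m≡)) m≤b))))

    covered : ∀ {k b} → E k → offset k ≤ b → k < A₀ ⊎ k ∈ candidates b (pred-threshold k)
    covered {k} {b} (_ , δ≢) m≤b = Sum.map below (subst (_∈ candidates b P) (κ+offset k)) located
      where
      P : ℕ
      P = pred-threshold k
      located : suc P ≤ d * Q ⊎ κ[ d , P ] + offset k ∈ candidates b P
      located = locate {P} {offset k} {b} (exceptional k δ≢) m≤b
      below : suc P ≤ d * Q → k < A₀
      below p≤dQ = <-≤-trans (<κ-threshold k)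
        (Bounds.κ-ball-mono d {threshold d k} {d * Q} (≤-trans (≤-reflexive (sym (suc-pred-threshold k))) p≤dQ))

    offset≤width : ∀ k → offset k ≤ width (pred-threshold k)
    offset≤width k = m+n≤o⇒m≤o∸n (offset k) (begin
      offset k + κ[ d , pred-threshold k ]      ≡⟨ +-comm (offset k) _ ⟩
      κ[ d , pred-threshold k ] + offset k      ≤⟨ <⇒≤ (in-window k) ⟩
      κ[ d , suc (pred-threshold k) ]           ∎)
      where open ≤-Reasoning

    -- In the window of k only offsets up to that of k count, so the telescoped total ends with 2 k
    -- instead of twice the next κ.
    all-candidates : ℕ → List ℕ
    all-candidates k = upTo A₀ ++ (before (pred-threshold k) ++ candidates (offset k) (pred-threshold k))

    Q*length-all-candidates : ∀ k → Q * length (all-candidates k) ≤ Q * A₀ + 2 * Q * threshold d k + 2 * k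
    Q*length-all-candidates k = begin
      Q * length (all-candidates k)                ≡⟨ cong (_*_ Q) (trans (length-++ (upTo A₀)) (cong₂ _+_ (length-upTo A₀) (length-++ (before P)))) ⟩
      Q * (A₀ + (length (before P) + c))            ≡⟨ expand Q A₀ (length (before P)) c ⟩
      Q * A₀ + (Q * length (before P) + Q * c)      ≤⟨ +-monoʳ-≤ (Q * A₀) (+-mono-≤ (Q*length-before P) (Q*length-candidates (offset k) P)) ⟩
      Q * A₀ + (2 * Q * P + 2 * κ[ d , P ] + (2 * Q + 2 * offset k))  ≡⟨ regroup (Q * A₀) Q P κ[ d , P ] (offset k) ⟩
      Q * A₀ + 2 * Q * suc P + 2 * (κ[ d , P ] + offset k)            ≡⟨ cong₂ (λ x y → Q * A₀ + 2 * Q * x + 2 * y) (suc-pred-threshold k) (κ+offset k) ⟩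
      Q * A₀ + 2 * Q * threshold d k + 2 * k        ∎
      where
      open ≤-Reasoning
      P c : ℕ
      P = pred-threshold k
      c = length (candidates (offset k) P)
      expand : ∀ Q a b c → Q * (a + (b + c)) ≡ Q * a + (Q * b + Q * c)
      expand = solve-∀
      regroup : ∀ a Q P κ w → a + (2 * Q * P + 2 * κ + (2 * Q + 2 * w)) ≡ a + 2 * Q * suc P + 2 * (κ + w)
      regroup = solve-∀

    all-covered : ∀ {k k′} → k′ ≤ k → E k′ → k′ ∈ all-candidates k
    all-covered {k} {k′} k′≤k Ek′ = [ earlier , same ]′ (m≤n⇒m<n∨m≡n (pred-threshold-mono k′≤k))
      where
      P P′ : ℕ
      P  = pred-threshold k
      P′ = pred-threshold k′
      place : k′ < A₀ ⊎ k′ ∈ before P ++ candidates (offset k) P → k′ ∈ all-candidates k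
      place = [ (λ k′<A₀ → ∈-++⁺ˡ (∈-upTo⁺ k′<A₀)) , ∈-++⁺ʳ (upTo A₀) ]′
      earlier : P′ < P → k′ ∈ all-candidates k
      earlier P′<P = place (Sum.map₂ found (covered {k′} {width P′} Ek′ (offset≤width k′)))
        where
        found : k′ ∈ candidates (width P′) P′ → k′ ∈ before P ++ candidates (offset k) P
        found k′∈ = ∈-++⁺ˡ (∈-concatMap⁺ (λ P′ → candidates (width P′) P′) (lose (∈-upTo⁺ P′<P) k′∈))
      same : P′ ≡ P → k′ ∈ all-candidates k
      same P′≡P = place (Sum.map₂ found (covered {k′} {offset k} Ek′ offset≤))
        where
        found : k′ ∈ candidates (offset k) P′ → k′ ∈ before P ++ candidates (offset k) P
        found k′∈ = ∈-++⁺ʳ (before P) (subst (λ P′ → k′ ∈ candidates (offset k) P′) P′≡P k′∈)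
        offset≤ : offset k′ ≤ offset k
        offset≤ = ≤-trans (∸-monoˡ-≤ κ[ d , P′ ] k′≤k) (≤-reflexive (cong (λ P → k ∸ κ[ d , P ]) P′≡P))

    Q*count-E : ∀ k → Q * count E? k ≤ Q * A₀ + 2 * Q * threshold d k + 2 * k
    Q*count-E k = ≤-trans (*-monoʳ-≤ Q (count≤length E? k (all-candidates k) λ _ → all-covered))
      (Q*length-all-candidates k)

  sparse₂ : d ≡ 2 → ∀ M → ∃[ K ] ∀ k → K ≤ k → (M * count E? k) ^ (d ∸ 1) < k
  sparse₂ d≡2 M = let K , bound = threshold-growth (8 * suc M) in
    -- The second summand makes the constant part Q A₀ of the count at most k.
    K + 4 * suc M * A₀ , λ k K≤k →
      subst (_< k) (sym (^-1 (M * count E? k) d∸1≡1))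
        (quarter M (count E? k) A₀ (threshold d k) k (Q*count-E k)
          (subst (λ t → 8 * suc M * t < k) (^-1 (threshold d k) d∸1≡1) (bound k (≤-trans (m≤m+n K _) K≤k)))
          (≤-trans (m≤n+m (4 * suc M * A₀) K) K≤k))
    where
    open PlanarExceptions d≡2 (4 * suc M)
    d∸1≡1 : d ∸ 1 ≡ 1
    d∸1≡1 = cong (_∸ 1) d≡2
    ^-1 : ∀ x {e} → e ≡ 1 → x ^ e ≡ x
    ^-1 x refl = ^-identityʳ x

  sparse : ∀ M → ∃[ K ] ∀ k → K ≤ k → (M * count E? k) ^ (d ∸ 1) < k
  sparse = [ sparse₂ , (λ 3≤d → SpatialExceptions.sparse 3≤d) ]′ 2≡⊎2<d
    where
    2≡⊎2<d : d ≡ 2 ⊎ 2 < d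
    2≡⊎2<d = [ inj₂ , inj₁ ∘ sym ]′ (m≤n⇒m<n∨m≡n 1<d)

theorem1p2 : (d : ℕ) → .{{_ : NonTrivial d}} →
    Σ[ E ∈ Pred ℕ 0ℓ ] Σ[ E? ∈ Decidable E ]
    (∀ k → E k → 0 < k) ×
    Infinite E ×
    RootQuotientTendsToZero (count E?) (d ∸ 1) ×
    (∀ k → 0 < k → ¬ E k → + δz d k ≡ floor (lambda d k)) ×
    (∀ k → E k → + δz d k ≡ floor (lambda d k) - 1ℤ)
theorem1p2 d = E , E? , (λ _ → proj₁) ,
  (λ n → let k , n<k , 0<k , δ≢ = infinitely-many n in k , n<k , 0<k , δ≢) ,
  rootQuotientTendsToZero (count E?) (d ∸ 1) sparse ,
  (λ k 0<k ¬Ek → trans (cong +_ (decidable-stable (δz d k ≟ ⌊λ⌋ k) λ δ≢ → ¬Ek (0<k , δ≢))) (sym (floor-lambda k))) ,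
  λ k (_ , δ≢) → sym (trans (cong (_- 1ℤ) (trans (floor-lambda k) (cong +_ (≤-antisym (⌊λ⌋≤1+δ k) (≤∧≢⇒< (δ≤⌊λ⌋ k) δ≢)))))
    (ℤ.⊖-≥ (s≤s (z≤n {δz d k}))))
  where
  open Window d
  open Exceptions d
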